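{- Let $\mathcal{P}_1$ be the set of odd primes $p$ such that the order $s$ of $2$ in $(\mathbb{Z}/p\mathbb{Z})^*$ equals $p-1$. The prime numbers $p\in\mathcal{P}_1$ for which $\beta>1/2$ are $3$ and $5$.
   Context: $\eta_n=(-1)^{s_2(n)}$ for $n\ge0$, where $s_2(n)$ is the sum of the binary digits of $n$. For an odd prime $p$ and $i\in\mathbb{Z}/p\mathbb{Z}$, the $p$-rarefied sum is $S_{p,i}(n)=\sum_{0\le j<n,\ j\equiv i\,(\mathrm{mod}\,p)}\eta_j$. With $s$ the order of $2$ in $(\mathbb{Z}/p\mathbb{Z})^*$, $\lambda_1$ denotes the largest modulus of an eigenvalue of the $p\times p$ matrix $M=(S_{p,i-j}(2^s))_{0\le i,j\le p-1}$ (indices $i-j$ taken mod $p$), and $\beta=\beta(p)=\frac{\log\lambda_1}{s\log2}$. -}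

module Defs where

open import Data.Nat.Base as ℕ using (ℕ; zero; suc)
import Data.Nat.Properties as ℕₚ
import Data.Nat.Divisibility as ℕ∣
open import Data.Nat.Primality using (Prime)
open import Data.Nat.ListAction using (sum)
open import Data.Integer.Base as ℤ using (ℤ; +_)
open import Data.Integer.Divisibility.Signed using (_∣?_)
open import Data.Rational.Base
open import Data.Rational.Properties
open import Data.Rational.Solver using (module +-*-Solver)
import Data.Rational.Unnormalised.Base as ℚᵘ
import Data.Rational.Unnormalised.Properties as ℚᵘₚ
import Data.Integer.Properties as ℤₚ
open import Data.Digit using (toDigits)
open import Data.Fin.Base using (Fin; toℕ)
open import Data.List.Base as List using (List; upTo; filter)
import Data.Vec.Functional as Vec
open import Data.Product.Base using (Σ; ∃; ∃-syntax; Σ-syntax; _×_; _,_; proj₁; proj₂)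
open import Data.Sum.Base using (inj₁; inj₂)
open import Relation.Nullary using (¬_; yes; no; contradiction)
open import Relation.Binary.PropositionalEquality
open +-*-Solver using (solve; _:+_; _:*_; _:-_; :-_; _:=_; con)

fromℕ : ℕ → ℚ
fromℕ n = + n / 1

-- Total reciprocal, with the convention 1/0 = 0.  On sequences that are
-- eventually bounded away from 0 only finitely many terms see the convention.
inv : ℚ → ℚ
inv q with q ≟ 0ℚ
... | yes _  = 0ℚ
... | no q≢0 = (1/ q) {{≢-nonZero q≢0}}

∑< : ℕ → (ℕ → ℚ) → ℚ
∑< zero    f = 0ℚ
∑< (suc n) f = ∑< n f + f n

-- Left Riemann sum of f from a to b with n equal (signed) steps.
riemannSum : (ℚ → ℚ) → ℚ → ℚ → (n : ℕ) .{{_ : ℕ.NonZero n}} → ℚ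
riemannSum f a b n = ∑< n (λ k → h * f (a + (+ k / 1) * h))
  where h = (b - a) * (+ 1 / n)

∣-∣-sym : ∀ a b → ∣ a - b ∣ ≡ ∣ b - a ∣
∣-∣-sym a b = trans (sym (∣-p∣≡∣p∣ (a - b)))
  (cong ∣_∣ (solve 2 (λ a b → :- (a :- b) := b :- a) refl a b))

tri : ∀ a b c → ∣ a - c ∣ ≤ ∣ a - b ∣ + ∣ b - c ∣
tri a b c = subst (λ t → ∣ t ∣ ≤ ∣ a - b ∣ + ∣ b - c ∣)
  (solve 3 (λ a b c → (a :- b) :+ (b :- c) := a :- c) refl a b c)
  (∣p+q∣≤∣p∣+∣q∣ (a - b) (b - c))

0≤*-mono-≤ : ∀ {a b c d} → 0ℚ ≤ a → 0ℚ ≤ d → a ≤ b → c ≤ d → a * c ≤ b * d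
0≤*-mono-≤ {a} {b} {c} {d} 0≤a 0≤d a≤b c≤d = ≤-trans
  (*-monoˡ-≤-nonNeg a {{nonNegative 0≤a}} c≤d)
  (*-monoʳ-≤-nonNeg d {{nonNegative 0≤d}} a≤b)

0≤* : ∀ {a b} → 0ℚ ≤ a → 0ℚ ≤ b → 0ℚ ≤ a * b
0≤* {a} {b} 0≤a 0≤b = subst (_≤ a * b) (*-zeroʳ a)
  (*-monoˡ-≤-nonNeg a {{nonNegative 0≤a}} 0≤b)

0<* : ∀ {a b} → 0ℚ < a → 0ℚ < b → 0ℚ < a * b
0<* {a} {b} 0<a 0<b = positive⁻¹ (a * b) {{pos*pos⇒pos a {{positive 0<a}} b {{positive 0<b}}}}

0≤+ : ∀ {a b} → 0ℚ ≤ a → 0ℚ ≤ b → 0ℚ ≤ a + b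
0≤+ 0≤a 0≤b = +-mono-≤ 0≤a 0≤b

abstract
  0<1 : 0ℚ < 1ℚ
  0<1 = positive⁻¹ 1ℚ

inv-≢0 : ∀ {q} → 0ℚ < q → q * inv q ≡ 1ℚ
inv-≢0 {q} 0<q with q ≟ 0ℚ
... | yes refl = contradiction 0<q (<-irrefl refl)
... | no q≢0   = *-inverseʳ q {{≢-nonZero q≢0}}

inv-pos : ∀ {q} → 0ℚ < q → 0ℚ < inv q
inv-pos {q} 0<q with q ≟ 0ℚ
... | yes refl = contradiction 0<q (<-irrefl refl)
... | no q≢0   = positive⁻¹ _ {{1/pos⇒pos q {{positive 0<q}}}}

inv-anti : ∀ {p q} → 0ℚ < p → p ≤ q → inv q ≤ inv p
inv-anti {p} {q} 0<p p≤q = subst₂ _≤_ l r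
  (*-monoʳ-≤-nonNeg (inv p * inv q) {{nonNegative (0≤* (<⇒≤ (inv-pos 0<p)) (<⇒≤ (inv-pos 0<q)))}} p≤q)
  where
  0<q = <-≤-trans 0<p p≤q
  l : p * (inv p * inv q) ≡ inv q
  l = trans (sym (*-assoc p (inv p) (inv q)))
        (trans (cong (_* inv q) (inv-≢0 0<p)) (*-identityˡ (inv q)))
  r : q * (inv p * inv q) ≡ inv p
  r = trans (solve 3 (λ q a b → q :* (a :* b) := (q :* b) :* a) refl q (inv p) (inv q))
        (trans (cong (_* inv p) (inv-≢0 0<q)) (*-identityˡ (inv p)))

inv-diff : ∀ {a b} → 0ℚ < a → 0ℚ < b → inv a - inv b ≡ (b - a) * (inv a * inv b)
inv-diff {a} {b} 0<a 0<b = sym (begin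
  (b - a) * (inv a * inv b)
    ≡⟨ solve 4 (λ a b x y → (b :- a) :* (x :* y) := (b :* y) :* x :- (a :* x) :* y)
         refl a b (inv a) (inv b) ⟩
  (b * inv b) * inv a - (a * inv a) * inv b
    ≡⟨ cong₂ (λ s t → s * inv a - t * inv b) (inv-≢0 0<b) (inv-≢0 0<a) ⟩
  1ℚ * inv a - 1ℚ * inv b
    ≡⟨ cong₂ _-_ (*-identityˡ (inv a)) (*-identityˡ (inv b)) ⟩
  inv a - inv b ∎)
  where open ≡-Reasoning

inv-prod-bound : ∀ {μ a b} → 0ℚ < μ → μ ≤ a → μ ≤ b →
                 ∣ inv a * inv b ∣ ≤ inv μ * inv μ
inv-prod-bound {μ} {a} {b} 0<μ μ≤a μ≤b = subst (_≤ inv μ * inv μ)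
  (sym (0≤p⇒∣p∣≡p (0≤* 0≤ia (<⇒≤ (inv-pos (<-≤-trans 0<μ μ≤b))))))
  (0≤*-mono-≤ 0≤ia (<⇒≤ (inv-pos 0<μ)) (inv-anti 0<μ μ≤a) (inv-anti 0<μ μ≤b))
  where 0≤ia = <⇒≤ (inv-pos (<-≤-trans 0<μ μ≤a))

inv-lipschitz : ∀ {μ a b} → 0ℚ < μ → μ ≤ a → μ ≤ b →
                ∣ inv a - inv b ∣ ≤ ∣ a - b ∣ * (inv μ * inv μ)
inv-lipschitz {μ} {a} {b} 0<μ μ≤a μ≤b = begin
  ∣ inv a - inv b ∣                ≡⟨ cong ∣_∣ (inv-diff (<-≤-trans 0<μ μ≤a) (<-≤-trans 0<μ μ≤b)) ⟩
  ∣ (b - a) * (inv a * inv b) ∣    ≡⟨ ∣p*q∣≡∣p∣*∣q∣ (b - a) (inv a * inv b) ⟩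
  ∣ b - a ∣ * ∣ inv a * inv b ∣    ≡⟨ cong (_* ∣ inv a * inv b ∣) (∣-∣-sym b a) ⟩
  ∣ a - b ∣ * ∣ inv a * inv b ∣
    ≤⟨ *-monoˡ-≤-nonNeg ∣ a - b ∣ {{∣-∣-nonNeg (a - b)}} (inv-prod-bound 0<μ μ≤a μ≤b) ⟩
  ∣ a - b ∣ * (inv μ * inv μ)      ∎
  where open ≤-Reasoning

fromℕ-+ : ∀ m n → fromℕ (m ℕ.+ n) ≡ fromℕ m + fromℕ n
fromℕ-+ m n = toℚᵘ-injective (begin
  toℚᵘ (fromℕ (m ℕ.+ n))              ≈⟨ toℚᵘ-fromℚᵘ (ℚᵘ.mkℚᵘ (+ (m ℕ.+ n)) 0) ⟩
  ℚᵘ.mkℚᵘ (+ (m ℕ.+ n)) 0             ≈⟨ ℚᵘ.*≡* (cong₂ (λ x y → (x ℤ.+ y) ℤ.* + 1)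
                                            (sym (ℤₚ.*-identityʳ (+ m))) (sym (ℤₚ.*-identityʳ (+ n)))) ⟩
  ℚᵘ.mkℚᵘ (+ m) 0 ℚᵘ.+ ℚᵘ.mkℚᵘ (+ n) 0
    ≈⟨ ℚᵘₚ.+-cong (toℚᵘ-fromℚᵘ (ℚᵘ.mkℚᵘ (+ m) 0)) (toℚᵘ-fromℚᵘ (ℚᵘ.mkℚᵘ (+ n) 0)) ⟨
  toℚᵘ (fromℕ m) ℚᵘ.+ toℚᵘ (fromℕ n)  ≈⟨ toℚᵘ-homo-+ (fromℕ m) (fromℕ n) ⟨
  toℚᵘ (fromℕ m + fromℕ n)            ∎)
  where open ℚᵘₚ.≃-Reasoning

fromℕ-* : ∀ m n → fromℕ (m ℕ.* n) ≡ fromℕ m * fromℕ n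
fromℕ-* zero    n = sym (*-zeroˡ (fromℕ n))
fromℕ-* (suc m) n = begin
  fromℕ (n ℕ.+ m ℕ.* n)             ≡⟨ fromℕ-+ n (m ℕ.* n) ⟩
  fromℕ n + fromℕ (m ℕ.* n)         ≡⟨ cong (λ t → fromℕ n + t) (fromℕ-* m n) ⟩
  fromℕ n + fromℕ m * fromℕ n       ≡⟨ solve 2 (λ a b → b :+ a :* b := (con 1ℚ :+ a) :* b) refl (fromℕ m) (fromℕ n) ⟩
  (1ℚ + fromℕ m) * fromℕ n          ≡⟨ cong (_* fromℕ n) (fromℕ-+ 1 m) ⟨
  fromℕ (suc m) * fromℕ n           ∎
  where open ≡-Reasoning

0≤fromℕ : ∀ n → 0ℚ ≤ fromℕ n
0≤fromℕ zero    = ≤-refl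
0≤fromℕ (suc n) = subst (0ℚ ≤_) (sym (fromℕ-+ 1 n)) (0≤+ (<⇒≤ 0<1) (0≤fromℕ n))

fromℕ-mono : ∀ {m n} → m ℕ.≤ n → fromℕ m ≤ fromℕ n
fromℕ-mono {m} {n} m≤n = subst₂ _≤_ (+-identityʳ (fromℕ m))
  (trans (sym (fromℕ-+ m (n ℕ.∸ m))) (cong fromℕ (ℕₚ.m+[n∸m]≡n m≤n)))
  (+-monoʳ-≤ (fromℕ m) (0≤fromℕ (n ℕ.∸ m)))

1/n : (n : ℕ) .{{_ : ℕ.NonZero n}} → ℚ
1/n n = + 1 / n

n*1/n : ∀ n .{{_ : ℕ.NonZero n}} → fromℕ n * 1/n n ≡ 1ℚ
n*1/n n@(suc k) = toℚᵘ-injective (begin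
  toℚᵘ (fromℕ n * 1/n n)                ≈⟨ toℚᵘ-homo-* (fromℕ n) (1/n n) ⟩
  toℚᵘ (fromℕ n) ℚᵘ.* toℚᵘ (1/n n)
    ≈⟨ ℚᵘₚ.*-cong (toℚᵘ-fromℚᵘ (ℚᵘ.mkℚᵘ (+ n) 0)) (toℚᵘ-fromℚᵘ (ℚᵘ.mkℚᵘ (+ 1) k)) ⟩
  ℚᵘ.mkℚᵘ (+ n) 0 ℚᵘ.* ℚᵘ.mkℚᵘ (+ 1) k  ≈⟨ ℚᵘ.*≡* num ⟩
  toℚᵘ 1ℚ                               ∎)
  where
  open ℚᵘₚ.≃-Reasoning
  num : (+ n ℤ.* + 1) ℤ.* + 1 ≡ + 1 ℤ.* + (1 ℕ.* n)
  num = trans (trans (ℤₚ.*-identityʳ (+ n ℤ.* + 1)) (ℤₚ.*-identityʳ (+ n)))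
    (sym (trans (ℤₚ.*-identityˡ (+ (1 ℕ.* n))) (cong +_ (ℕₚ.*-identityˡ n))))

1/n-≤ : ∀ ε → 0ℚ < ε → ∃[ N ] ∀ n → N ℕ.≤ n → 1/n (suc n) ≤ ε
1/n-≤ (mkℚ (+ zero)   d c) 0<ε = contradiction (drop-*<* 0<ε) (ℤₚ.<-irrefl refl)
1/n-≤ (mkℚ ℤ.-[1+ a ] d c) (*<* ())
1/n-≤ ε@(mkℚ (+ suc a) d c) 0<ε = d , λ n d≤n → toℚᵘ-cancel-≤
  (ℚᵘₚ.≤-respˡ-≃ (ℚᵘₚ.≃-sym (toℚᵘ-fromℚᵘ (ℚᵘ.mkℚᵘ (+ 1) n)))
    (ℚᵘ.*≤* (subst₂ ℤ._≤_ (sym (ℤₚ.*-identityˡ (+ suc d))) refl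
      (ℤ.+≤+ (ℕₚ.≤-trans (ℕ.s≤s d≤n) (ℕₚ.m≤m+n (suc n) (a ℕ.* suc n)))))))

∑<-bound : ∀ n f g c → (∀ k → k ℕ.< n → ∣ f k - g k ∣ ≤ c) →
           ∣ ∑< n f - ∑< n g ∣ ≤ fromℕ n * c
∑<-bound zero    f g c _ = ≤-reflexive (sym (*-zeroˡ c))
∑<-bound (suc n) f g c H = begin
  ∣ (∑< n f + f n) - (∑< n g + g n) ∣
    ≡⟨ cong ∣_∣ (solve 4 (λ a b c d → (a :+ b) :- (c :+ d) := (a :- c) :+ (b :- d))
                  refl (∑< n f) (f n) (∑< n g) (g n)) ⟩
  ∣ (∑< n f - ∑< n g) + (f n - g n) ∣       ≤⟨ ∣p+q∣≤∣p∣+∣q∣ (∑< n f - ∑< n g) (f n - g n) ⟩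
  ∣ ∑< n f - ∑< n g ∣ + ∣ f n - g n ∣
    ≤⟨ +-mono-≤ (∑<-bound n f g c (λ k k<n → H k (ℕₚ.m<n⇒m<1+n k<n))) (H n ℕₚ.≤-refl) ⟩
  fromℕ n * c + c                           ≡⟨ solve 2 (λ n c → n :* c :+ c := (con 1ℚ :+ n) :* c) refl (fromℕ n) c ⟩
  (1ℚ + fromℕ n) * c                        ≡⟨ cong (_* c) (fromℕ-+ 1 n) ⟨
  fromℕ (suc n) * c                         ∎
  where open ≤-Reasoning

∑<-const : ∀ n c → ∑< n (λ _ → c) ≡ fromℕ n * c
∑<-const zero    c = sym (*-zeroˡ c)
∑<-const (suc n) c = begin
  ∑< n (λ _ → c) + c   ≡⟨ cong (_+ c) (∑<-const n c) ⟩
  fromℕ n * c + c      ≡⟨ solve 2 (λ n c → n :* c :+ c := (con 1ℚ :+ n) :* c) refl (fromℕ n) c ⟩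
  (1ℚ + fromℕ n) * c   ≡⟨ cong (_* c) (fromℕ-+ 1 n) ⟨
  fromℕ (suc n) * c    ∎
  where open ≡-Reasoning

∑<-split : ∀ a b f → ∑< (a ℕ.+ b) f ≡ ∑< a f + ∑< b (λ r → f (a ℕ.+ r))
∑<-split a zero    f = trans (cong (λ t → ∑< t f) (ℕₚ.+-identityʳ a)) (sym (+-identityʳ (∑< a f)))
∑<-split a (suc b) f = begin
  ∑< (a ℕ.+ suc b) f                                        ≡⟨ cong (λ t → ∑< t f) (ℕₚ.+-suc a b) ⟩
  ∑< (a ℕ.+ b) f + f (a ℕ.+ b)                              ≡⟨ cong (_+ f (a ℕ.+ b)) (∑<-split a b f) ⟩
  ∑< a f + ∑< b (λ r → f (a ℕ.+ r)) + f (a ℕ.+ b)           ≡⟨ +-assoc (∑< a f) _ _ ⟩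
  ∑< a f + (∑< b (λ r → f (a ℕ.+ r)) + f (a ℕ.+ b))         ∎
  where open ≡-Reasoning

∑<-blocks : ∀ n m f g c →
            (∀ k → k ℕ.< n → ∣ f k - ∑< m (λ r → g (k ℕ.* m ℕ.+ r)) ∣ ≤ c) →
            ∣ ∑< n f - ∑< (n ℕ.* m) g ∣ ≤ fromℕ n * c
∑<-blocks n m f g c H = subst (λ t → ∣ ∑< n f - t ∣ ≤ fromℕ n * c) (regroup n)
  (∑<-bound n f (λ k → ∑< m (λ r → g (k ℕ.* m ℕ.+ r))) c H)
  where
  regroup : ∀ j → ∑< j (λ k → ∑< m (λ r → g (k ℕ.* m ℕ.+ r))) ≡ ∑< (j ℕ.* m) g
  regroup zero    = refl
  regroup (suc j) = trans (cong (_+ ∑< m (λ r → g (j ℕ.* m ℕ.+ r))) (regroup j))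
    (trans (sym (∑<-split (j ℕ.* m) m g)) (cong (λ t → ∑< t g) (ℕₚ.+-comm (j ℕ.* m) m)))

step : ℚ → (n : ℕ) .{{_ : ℕ.NonZero n}} → ℚ
step q n = (q - 1ℚ) * 1/n n

n*step : ∀ q n .{{_ : ℕ.NonZero n}} → fromℕ n * step q n ≡ q - 1ℚ
n*step q n = begin
  fromℕ n * ((q - 1ℚ) * 1/n n)   ≡⟨ solve 3 (λ n q i → n :* (q :* i) := q :* (n :* i)) refl (fromℕ n) (q - 1ℚ) (1/n n) ⟩
  (q - 1ℚ) * (fromℕ n * 1/n n)   ≡⟨ cong ((q - 1ℚ) *_) (n*1/n n) ⟩
  (q - 1ℚ) * 1ℚ                  ≡⟨ *-identityʳ (q - 1ℚ) ⟩
  q - 1ℚ                         ∎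
  where open ≡-Reasoning

node-≥ : ∀ {μ q n} .{{_ : ℕ.NonZero n}} → μ ≤ 1ℚ → μ ≤ q → ∀ k → k ℕ.≤ n →
         μ ≤ 1ℚ + fromℕ k * step q n
node-≥ {μ} {q} {n} μ≤1 μ≤q k k≤n with ≤-total 0ℚ (step q n)
... | inj₁ 0≤h = ≤-trans μ≤1 (subst (_≤ 1ℚ + fromℕ k * step q n) (+-identityʳ 1ℚ)
                   (+-monoʳ-≤ 1ℚ (0≤* (0≤fromℕ k) 0≤h)))
... | inj₂ h≤0 = ≤-trans μ≤q (subst (_≤ 1ℚ + fromℕ k * step q n) eq
                   (+-monoʳ-≤ 1ℚ (*-monoʳ-≤-nonPos (step q n) {{nonPositive h≤0}} (fromℕ-mono k≤n))))
  where
  eq : 1ℚ + fromℕ n * step q n ≡ q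
  eq = trans (cong (λ t → 1ℚ + t) (n*step q n)) (solve 1 (λ q → con 1ℚ :+ (q :- con 1ℚ) := q) refl q)

logSum : ℚ → (n : ℕ) .{{_ : ℕ.NonZero n}} → ℚ
logSum = riemannSum inv 1ℚ

logSum-lipschitz : ∀ {μ a b} n .{{_ : ℕ.NonZero n}} → 0ℚ < μ → μ ≤ 1ℚ → μ ≤ a → μ ≤ b →
                   ∣ logSum a n - logSum b n ∣ ≤ ∣ a - b ∣ * (inv μ * inv μ)
logSum-lipschitz {μ} {a} {b} n 0<μ μ≤1 μ≤a μ≤b = subst (∣ logSum a n - logSum b n ∣ ≤_) total
  (∑<-bound n _ _ (∣ ha - hb ∣ * (inv μ * inv μ)) term)
  where
  ha = step a n
  hb = step b n
  term : ∀ k → k ℕ.< n →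
    ∣ ha * inv (1ℚ + fromℕ k * ha) - hb * inv (1ℚ + fromℕ k * hb) ∣ ≤ ∣ ha - hb ∣ * (inv μ * inv μ)
  term k k<n = begin
    ∣ ha * inv x - hb * inv y ∣           ≡⟨ cong ∣_∣ eq ⟩
    ∣ (ha - hb) * (inv x * inv y) ∣       ≡⟨ ∣p*q∣≡∣p∣*∣q∣ (ha - hb) (inv x * inv y) ⟩
    ∣ ha - hb ∣ * ∣ inv x * inv y ∣
      ≤⟨ *-monoˡ-≤-nonNeg ∣ ha - hb ∣ {{∣-∣-nonNeg (ha - hb)}} (inv-prod-bound 0<μ μ≤x μ≤y) ⟩
    ∣ ha - hb ∣ * (inv μ * inv μ)         ∎
    where
    open ≤-Reasoning
    x = 1ℚ + fromℕ k * ha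
    y = 1ℚ + fromℕ k * hb
    μ≤x = node-≥ {n = n} μ≤1 μ≤a k (ℕₚ.<⇒≤ k<n)
    μ≤y = node-≥ {n = n} μ≤1 μ≤b k (ℕₚ.<⇒≤ k<n)
    eq : ha * inv x - hb * inv y ≡ (ha - hb) * (inv x * inv y)
    eq = trans
      (cong₂ _-_
        (trans (sym (*-identityʳ (ha * inv x))) (cong (ha * inv x *_) (sym (inv-≢0 (<-≤-trans 0<μ μ≤y)))))
        (trans (sym (*-identityʳ (hb * inv y))) (cong (hb * inv y *_) (sym (inv-≢0 (<-≤-trans 0<μ μ≤x))))))
      (solve 5 (λ ha hb k u v →
           ha :* u :* ((con 1ℚ :+ k :* hb) :* v) :- hb :* v :* ((con 1ℚ :+ k :* ha) :* u)
           := (ha :- hb) :* (u :* v))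
         refl ha hb (fromℕ k) (inv x) (inv y))
  total : fromℕ n * (∣ ha - hb ∣ * (inv μ * inv μ)) ≡ ∣ a - b ∣ * (inv μ * inv μ)
  total = trans (sym (*-assoc (fromℕ n) ∣ ha - hb ∣ _)) (cong (_* (inv μ * inv μ)) (begin
    fromℕ n * ∣ ha - hb ∣               ≡⟨ cong (_* ∣ ha - hb ∣) (0≤p⇒∣p∣≡p (0≤fromℕ n)) ⟨
    ∣ fromℕ n ∣ * ∣ ha - hb ∣           ≡⟨ ∣p*q∣≡∣p∣*∣q∣ (fromℕ n) (ha - hb) ⟨
    ∣ fromℕ n * (ha - hb) ∣
      ≡⟨ cong ∣_∣ (solve 3 (λ n x y → n :* (x :- y) := n :* x :- n :* y) refl (fromℕ n) ha hb) ⟩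
    ∣ fromℕ n * ha - fromℕ n * hb ∣     ≡⟨ cong₂ (λ s t → ∣ s - t ∣) (n*step a n) (n*step b n) ⟩
    ∣ (a - 1ℚ) - (b - 1ℚ) ∣
      ≡⟨ cong ∣_∣ (solve 2 (λ a b → (a :- con 1ℚ) :- (b :- con 1ℚ) := a :- b) refl a b) ⟩
    ∣ a - b ∣                           ∎))
    where open ≡-Reasoning

logSum-refine : ∀ {μ q} n m .{{_ : ℕ.NonZero n}} .{{_ : ℕ.NonZero m}} .{{_ : ℕ.NonZero (n ℕ.* m)}} →
                0ℚ < μ → μ ≤ 1ℚ → μ ≤ q →
                ∣ logSum q n - logSum q (n ℕ.* m) ∣ ≤
                ∣ q - 1ℚ ∣ * ∣ q - 1ℚ ∣ * (inv μ * inv μ) * 1/n n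
logSum-refine {μ} {q} n m 0<μ μ≤1 μ≤q = subst (∣ logSum q n - logSum q (n ℕ.* m) ∣ ≤_) total
  (∑<-blocks n m _ _ (∣ h ∣ * (∣ h ∣ * L)) block)
  where
  L  = inv μ * inv μ
  h  = step q n
  h′ = step q (n ℕ.* m)
  0≤L = 0≤* (<⇒≤ (inv-pos 0<μ)) (<⇒≤ (inv-pos 0<μ))

  m*h′ : fromℕ m * h′ ≡ h
  m*h′ = begin
    fromℕ m * h′                             ≡⟨ *-identityˡ (fromℕ m * h′) ⟨
    1ℚ * (fromℕ m * h′)                      ≡⟨ cong (_* (fromℕ m * h′)) (n*1/n n) ⟨
    fromℕ n * 1/n n * (fromℕ m * h′)
      ≡⟨ solve 4 (λ n i m h → n :* i :* (m :* h) := (n :* m) :* h :* i) refl (fromℕ n) (1/n n) (fromℕ m) h′ ⟩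
    (fromℕ n * fromℕ m) * h′ * 1/n n         ≡⟨ cong (λ t → t * h′ * 1/n n) (fromℕ-* n m) ⟨
    fromℕ (n ℕ.* m) * h′ * 1/n n             ≡⟨ cong (_* 1/n n) (n*step q (n ℕ.* m)) ⟩
    h                                        ∎
    where open ≡-Reasoning

  ∣r*h′∣≤ : ∀ r → r ℕ.≤ m → ∣ fromℕ r * h′ ∣ ≤ ∣ h ∣
  ∣r*h′∣≤ r r≤m = subst₂ _≤_ (abs r) (trans (abs m) (cong ∣_∣ m*h′))
    (*-monoʳ-≤-nonNeg ∣ h′ ∣ {{∣-∣-nonNeg h′}} (fromℕ-mono r≤m))
    where
    abs : ∀ j → fromℕ j * ∣ h′ ∣ ≡ ∣ fromℕ j * h′ ∣
    abs j = trans (cong (_* ∣ h′ ∣) (sym (0≤p⇒∣p∣≡p (0≤fromℕ j)))) (sym (∣p*q∣≡∣p∣*∣q∣ (fromℕ j) h′))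

  block : ∀ k → k ℕ.< n →
    ∣ h * inv (1ℚ + fromℕ k * h)
      - ∑< m (λ r → h′ * inv (1ℚ + fromℕ (k ℕ.* m ℕ.+ r) * h′)) ∣ ≤ ∣ h ∣ * (∣ h ∣ * L)
  block k k<n = subst₂ (λ s t → ∣ s - ∑< m g ∣ ≤ t) coarse bound
    (∑<-bound m (λ _ → h′ * inv x) g (∣ h′ ∣ * (∣ h ∣ * L)) fine)
    where
    x = 1ℚ + fromℕ k * h
    g = λ r → h′ * inv (1ℚ + fromℕ (k ℕ.* m ℕ.+ r) * h′)
    μ≤x = node-≥ {n = n} μ≤1 μ≤q k (ℕₚ.<⇒≤ k<n)
    coarse : ∑< m (λ _ → h′ * inv x) ≡ h * inv x
    coarse = trans (∑<-const m (h′ * inv x))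
      (trans (sym (*-assoc (fromℕ m) h′ (inv x))) (cong (_* inv x) m*h′))
    bound : fromℕ m * (∣ h′ ∣ * (∣ h ∣ * L)) ≡ ∣ h ∣ * (∣ h ∣ * L)
    bound = trans (sym (*-assoc (fromℕ m) ∣ h′ ∣ _)) (cong (_* (∣ h ∣ * L))
      (trans (cong (_* ∣ h′ ∣) (sym (0≤p⇒∣p∣≡p (0≤fromℕ m))))
        (trans (sym (∣p*q∣≡∣p∣*∣q∣ (fromℕ m) h′)) (cong ∣_∣ m*h′))))
    fine : ∀ r → r ℕ.< m →
      ∣ h′ * inv x - h′ * inv (1ℚ + fromℕ (k ℕ.* m ℕ.+ r) * h′) ∣ ≤ ∣ h′ ∣ * (∣ h ∣ * L)
    fine r r<m = begin
      ∣ h′ * inv x - h′ * inv y ∣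
        ≡⟨ cong ∣_∣ (solve 3 (λ h u v → h :* u :- h :* v := h :* (u :- v)) refl h′ (inv x) (inv y)) ⟩
      ∣ h′ * (inv x - inv y) ∣          ≡⟨ ∣p*q∣≡∣p∣*∣q∣ h′ (inv x - inv y) ⟩
      ∣ h′ ∣ * ∣ inv x - inv y ∣
        ≤⟨ *-monoˡ-≤-nonNeg ∣ h′ ∣ {{∣-∣-nonNeg h′}} (inv-lipschitz 0<μ μ≤x μ≤y) ⟩
      ∣ h′ ∣ * (∣ x - y ∣ * L)
        ≤⟨ *-monoˡ-≤-nonNeg ∣ h′ ∣ {{∣-∣-nonNeg h′}} (*-monoʳ-≤-nonNeg L {{nonNegative 0≤L}} near) ⟩
      ∣ h′ ∣ * (∣ h ∣ * L)              ∎
      where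
      open ≤-Reasoning
      y = 1ℚ + fromℕ (k ℕ.* m ℕ.+ r) * h′
      km+r≤nm : k ℕ.* m ℕ.+ r ℕ.≤ n ℕ.* m
      km+r≤nm = ℕₚ.≤-trans (ℕₚ.+-monoʳ-≤ (k ℕ.* m) (ℕₚ.<⇒≤ r<m))
        (ℕₚ.≤-trans (ℕₚ.≤-reflexive (ℕₚ.+-comm (k ℕ.* m) m)) (ℕₚ.*-monoˡ-≤ m k<n))
      μ≤y = node-≥ {n = n ℕ.* m} μ≤1 μ≤q (k ℕ.* m ℕ.+ r) km+r≤nm
      y-x : y - x ≡ fromℕ r * h′
      y-x = trans (cong₂ (λ s t → (1ℚ + s * h′) - (1ℚ + fromℕ k * t))
              (trans (fromℕ-+ (k ℕ.* m) r) (cong (_+ fromℕ r) (fromℕ-* k m))) (sym m*h′))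
            (solve 4 (λ k m r h → (con 1ℚ :+ (k :* m :+ r) :* h) :- (con 1ℚ :+ k :* (m :* h)) := r :* h)
              refl (fromℕ k) (fromℕ m) (fromℕ r) h′)
      near : ∣ x - y ∣ ≤ ∣ h ∣
      near = subst (_≤ ∣ h ∣) (sym (trans (∣-∣-sym x y) (cong ∣_∣ y-x))) (∣r*h′∣≤ r (ℕₚ.<⇒≤ r<m))

  0≤1/n : 0ℚ ≤ 1/n n
  0≤1/n = nonNegative⁻¹ (1/n n) {{normalize-nonNeg 1 n}}

  total : fromℕ n * (∣ h ∣ * (∣ h ∣ * L)) ≡ ∣ q - 1ℚ ∣ * ∣ q - 1ℚ ∣ * L * 1/n n
  total = begin
    fromℕ n * (∣ h ∣ * (∣ h ∣ * L))
      ≡⟨ cong (λ t → fromℕ n * (t * (t * L)))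
           (trans (∣p*q∣≡∣p∣*∣q∣ (q - 1ℚ) (1/n n)) (cong (∣ q - 1ℚ ∣ *_) (0≤p⇒∣p∣≡p 0≤1/n))) ⟩
    fromℕ n * (∣ q - 1ℚ ∣ * 1/n n * (∣ q - 1ℚ ∣ * 1/n n * L))
      ≡⟨ solve 4 (λ n d i l → n :* (d :* i :* (d :* i :* l)) := (n :* i) :* (d :* d :* l :* i))
           refl (fromℕ n) ∣ q - 1ℚ ∣ (1/n n) L ⟩
    (fromℕ n * 1/n n) * (∣ q - 1ℚ ∣ * ∣ q - 1ℚ ∣ * L * 1/n n)
      ≡⟨ cong (_* (∣ q - 1ℚ ∣ * ∣ q - 1ℚ ∣ * L * 1/n n)) (n*1/n n) ⟩
    1ℚ * (∣ q - 1ℚ ∣ * ∣ q - 1ℚ ∣ * L * 1/n n)   ≡⟨ *-identityˡ _ ⟩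
    ∣ q - 1ℚ ∣ * ∣ q - 1ℚ ∣ * L * 1/n n          ∎
    where open ≡-Reasoning

Cauchy : (ℕ → ℚ) → Set
Cauchy f = ∀ ε → 0ℚ < ε → ∃[ N ] ∀ m n → N ℕ.≤ m → N ℕ.≤ n → ∣ f m - f n ∣ ≤ ε

-- Real numbers are Cauchy sequences of rationals, taken up to _≈_.
record ℝ : Set where
  constructor mkℝ
  field
    seq    : ℕ → ℚ
    cauchy : Cauchy seq

open ℝ public

infix 4 _≈_ _<ᵣ_ _≤ᵣ_

_≈_ : ℝ → ℝ → Set
x ≈ y = ∀ ε → 0ℚ < ε → ∃[ N ] ∀ n → N ℕ.≤ n → ∣ seq x n - seq y n ∣ ≤ ε

_<ᵣ_ : ℝ → ℝ → Set
x <ᵣ y = Σ[ δ ∈ ℚ ] 0ℚ < δ × ∃[ N ] ∀ n → N ℕ.≤ n → seq x n + δ ≤ seq y n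

_≤ᵣ_ : ℝ → ℝ → Set
x ≤ᵣ y = ¬ (y <ᵣ x)

⊔⇒ˡ : ∀ m n {o} → m ℕ.⊔ n ℕ.≤ o → m ℕ.≤ o
⊔⇒ˡ m n = ℕₚ.≤-trans (ℕₚ.m≤m⊔n m n)

⊔⇒ʳ : ∀ m n {o} → m ℕ.⊔ n ℕ.≤ o → n ℕ.≤ o
⊔⇒ʳ m n = ℕₚ.≤-trans (ℕₚ.m≤n⊔m m n)

cauchy-scale : ∀ f K → 0ℚ < K →
  (∀ ε → 0ℚ < ε → ∃[ N ] ∀ m n → N ℕ.≤ m → N ℕ.≤ n → ∣ f m - f n ∣ ≤ K * ε) → Cauchy f
cauchy-scale f K 0<K H ε 0<ε with H (ε * inv K) (0<* 0<ε (inv-pos 0<K))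
... | N , P = N , λ m n N≤m N≤n → subst (∣ f m - f n ∣ ≤_) eq (P m n N≤m N≤n)
  where
  eq : K * (ε * inv K) ≡ ε
  eq = trans (solve 3 (λ k e i → k :* (e :* i) := e :* (k :* i)) refl K ε (inv K))
    (trans (cong (ε *_) (inv-≢0 0<K)) (*-identityʳ ε))

∣∣≤-near : ∀ {a b c} → ∣ a - b ∣ ≤ c → ∣ a ∣ ≤ ∣ b ∣ + c
∣∣≤-near {a} {b} {c} H = begin
  ∣ a ∣             ≡⟨ cong ∣_∣ (solve 2 (λ a b → a := b :+ (a :- b)) refl a b) ⟩
  ∣ b + (a - b) ∣   ≤⟨ ∣p+q∣≤∣p∣+∣q∣ b (a - b) ⟩
  ∣ b ∣ + ∣ a - b ∣ ≤⟨ +-monoʳ-≤ ∣ b ∣ H ⟩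
  ∣ b ∣ + c         ∎
  where open ≤-Reasoning

abstract
  bounded : ∀ {f} → Cauchy f → Σ[ B ∈ ℚ ] 0ℚ < B × ∃[ N ] ∀ n → N ℕ.≤ n → ∣ f n ∣ ≤ B
  bounded {f} c with c 1ℚ 0<1
  ... | N , P = ∣ f N ∣ + 1ℚ , +-mono-≤-< (0≤∣p∣ (f N)) 0<1 , N ,
                λ n N≤n → ∣∣≤-near {f n} {f N} (P n N N≤n ℕₚ.≤-refl)

ι : ℚ → ℝ
ι q = mkℝ (λ _ → q) (λ ε 0<ε → 0 , λ _ _ _ _ →
  subst (_≤ ε) (sym (cong ∣_∣ (+-inverseʳ q))) (<⇒≤ 0<ε))

infixl 6 _+ᵣ_ _-ᵣ_
infixl 7 _*ᵣ_
infix  8 -ᵣ_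

_+ᵣ_ : ℝ → ℝ → ℝ
x +ᵣ y = mkℝ (λ n → seq x n + seq y n) (cauchy-scale (λ n → seq x n + seq y n) (1ℚ + 1ℚ) (positive⁻¹ (1ℚ + 1ℚ)) modulus)
  where
  modulus : ∀ ε → 0ℚ < ε → ∃[ N ] ∀ m n → N ℕ.≤ m → N ℕ.≤ n →
            ∣ (seq x m + seq y m) - (seq x n + seq y n) ∣ ≤ (1ℚ + 1ℚ) * ε
  modulus ε 0<ε with cauchy x ε 0<ε | cauchy y ε 0<ε
  ... | N₁ , P | N₂ , Q = N₁ ℕ.⊔ N₂ , λ m n N≤m N≤n → begin
    ∣ (seq x m + seq y m) - (seq x n + seq y n) ∣
      ≡⟨ cong ∣_∣ (solve 4 (λ a b c d → (a :+ b) :- (c :+ d) := (a :- c) :+ (b :- d))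
           refl (seq x m) (seq y m) (seq x n) (seq y n)) ⟩
    ∣ (seq x m - seq x n) + (seq y m - seq y n) ∣
      ≤⟨ ∣p+q∣≤∣p∣+∣q∣ (seq x m - seq x n) (seq y m - seq y n) ⟩
    ∣ seq x m - seq x n ∣ + ∣ seq y m - seq y n ∣
      ≤⟨ +-mono-≤ (P m n (⊔⇒ˡ N₁ N₂ N≤m) (⊔⇒ˡ N₁ N₂ N≤n))
                  (Q m n (⊔⇒ʳ N₁ N₂ N≤m) (⊔⇒ʳ N₁ N₂ N≤n)) ⟩
    ε + ε            ≡⟨ solve 1 (λ e → e :+ e := (con 1ℚ :+ con 1ℚ) :* e) refl ε ⟩
    (1ℚ + 1ℚ) * ε    ∎
    where open ≤-Reasoning

-ᵣ_ : ℝ → ℝ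
-ᵣ x = mkℝ (λ n → - seq x n) λ ε 0<ε → proj₁ (cauchy x ε 0<ε) , λ m n N≤m N≤n →
  subst (_≤ ε)
    (trans (sym (∣-p∣≡∣p∣ (seq x m - seq x n)))
      (cong ∣_∣ (solve 2 (λ a b → :- (a :- b) := :- a :- :- b) refl (seq x m) (seq x n))))
    (proj₂ (cauchy x ε 0<ε) m n N≤m N≤n)

_-ᵣ_ : ℝ → ℝ → ℝ
x -ᵣ y = x +ᵣ -ᵣ y

*-diff : ∀ {A B ε} a b c d → 0ℚ ≤ ε → ∣ a ∣ ≤ A → ∣ d ∣ ≤ B → ∣ b - d ∣ ≤ ε → ∣ a - c ∣ ≤ ε →
         ∣ a * b - c * d ∣ ≤ (A + B) * ε
*-diff {A} {B} {ε} a b c d 0≤ε ∣a∣≤A ∣d∣≤B ∣b-d∣≤ε ∣a-c∣≤ε = begin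
  ∣ a * b - c * d ∣
    ≡⟨ cong ∣_∣ (solve 4 (λ a b c d → a :* b :- c :* d := a :* (b :- d) :+ (a :- c) :* d) refl a b c d) ⟩
  ∣ a * (b - d) + (a - c) * d ∣            ≤⟨ ∣p+q∣≤∣p∣+∣q∣ (a * (b - d)) ((a - c) * d) ⟩
  ∣ a * (b - d) ∣ + ∣ (a - c) * d ∣        ≡⟨ cong₂ _+_ (∣p*q∣≡∣p∣*∣q∣ a (b - d)) (∣p*q∣≡∣p∣*∣q∣ (a - c) d) ⟩
  ∣ a ∣ * ∣ b - d ∣ + ∣ a - c ∣ * ∣ d ∣
    ≤⟨ +-mono-≤ (0≤*-mono-≤ (0≤∣p∣ a) 0≤ε ∣a∣≤A ∣b-d∣≤ε)
                (0≤*-mono-≤ (0≤∣p∣ (a - c)) (≤-trans (0≤∣p∣ d) ∣d∣≤B) ∣a-c∣≤ε ∣d∣≤B) ⟩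
  A * ε + ε * B                            ≡⟨ solve 3 (λ a b e → a :* e :+ e :* b := (a :+ b) :* e) refl A B ε ⟩
  (A + B) * ε                              ∎
  where open ≤-Reasoning

*-cauchy : ∀ f g → Cauchy f → Cauchy g → Cauchy (λ n → f n * g n)
*-cauchy f g cf cg with bounded {f} cf | bounded {g} cg
... | A , 0<A , N₁ , ∣f∣≤A | B , 0<B , N₂ , ∣g∣≤B =
  cauchy-scale (λ n → f n * g n) (A + B) (+-mono-< 0<A 0<B) modulus
  where
  modulus : ∀ ε → 0ℚ < ε → ∃[ N ] ∀ m n → N ℕ.≤ m → N ℕ.≤ n → ∣ f m * g m - f n * g n ∣ ≤ (A + B) * ε
  modulus ε 0<ε with cf ε 0<ε | cg ε 0<ε
  ... | N₃ , P | N₄ , Q = (N₁ ℕ.⊔ N₂) ℕ.⊔ (N₃ ℕ.⊔ N₄) , λ m n N≤m N≤n →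
    let l₁ = λ k (N≤k : (N₁ ℕ.⊔ N₂) ℕ.⊔ (N₃ ℕ.⊔ N₄) ℕ.≤ k) → ⊔⇒ˡ (N₁ ℕ.⊔ N₂) (N₃ ℕ.⊔ N₄) N≤k
        l₂ = λ k (N≤k : (N₁ ℕ.⊔ N₂) ℕ.⊔ (N₃ ℕ.⊔ N₄) ℕ.≤ k) → ⊔⇒ʳ (N₁ ℕ.⊔ N₂) (N₃ ℕ.⊔ N₄) N≤k
    in *-diff (f m) (g m) (f n) (g n) (<⇒≤ 0<ε)
         (∣f∣≤A m (⊔⇒ˡ N₁ N₂ (l₁ m N≤m)))
         (∣g∣≤B n (⊔⇒ʳ N₁ N₂ (l₁ n N≤n)))
         (Q m n (⊔⇒ʳ N₃ N₄ (l₂ m N≤m)) (⊔⇒ʳ N₃ N₄ (l₂ n N≤n)))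
         (P m n (⊔⇒ˡ N₃ N₄ (l₂ m N≤m)) (⊔⇒ˡ N₃ N₄ (l₂ n N≤n)))

-- Eventual lower bound read off from a proof of positivity.
lower : ∀ x → ι 0ℚ <ᵣ x → Σ[ δ ∈ ℚ ] 0ℚ < δ × ∃[ N ] ∀ n → N ℕ.≤ n → δ ≤ seq x n
lower x (δ , 0<δ , N , P) = δ , 0<δ , N , λ n N≤n → subst (_≤ seq x n) (+-identityˡ δ) (P n N≤n)

inv-cauchy : ∀ x → ι 0ℚ <ᵣ x → Cauchy (λ n → inv (seq x n))
inv-cauchy x 0<x with lower x 0<x
... | δ , 0<δ , N₁ , δ≤x = cauchy-scale (λ n → inv (seq x n)) L 0<L modulus
  where
  L = inv δ * inv δ
  0<L = 0<* (inv-pos 0<δ) (inv-pos 0<δ)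
  modulus : ∀ ε → 0ℚ < ε → ∃[ N ] ∀ m n → N ℕ.≤ m → N ℕ.≤ n → ∣ inv (seq x m) - inv (seq x n) ∣ ≤ L * ε
  modulus ε 0<ε with cauchy x ε 0<ε
  ... | N₂ , P = N₁ ℕ.⊔ N₂ , λ m n N≤m N≤n → begin
    ∣ inv (seq x m) - inv (seq x n) ∣
      ≤⟨ inv-lipschitz 0<δ (δ≤x m (⊔⇒ˡ N₁ N₂ N≤m)) (δ≤x n (⊔⇒ˡ N₁ N₂ N≤n)) ⟩
    ∣ seq x m - seq x n ∣ * L
      ≤⟨ *-monoʳ-≤-nonNeg L {{nonNegative (<⇒≤ 0<L)}}
           (P m n (⊔⇒ʳ N₁ N₂ N≤m) (⊔⇒ʳ N₁ N₂ N≤n)) ⟩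
    ε * L   ≡⟨ *-comm ε L ⟩
    L * ε   ∎
    where open ≤-Reasoning

logSum-cauchy : ∀ x → ι 0ℚ <ᵣ x → Cauchy (λ n → logSum (seq x n) (suc n))
logSum-cauchy x 0<x with lower x 0<x | bounded (cauchy (x +ᵣ -ᵣ ι 1ℚ))
... | δ , 0<δ , N₁ , δ≤x | B , 0<B , N₂ , ∣x-1∣≤B =
  cauchy-scale (λ n → logSum (seq x n) (suc n)) K 0<K modulus
  where
  μ = δ ⊓ 1ℚ
  μ≤1 : μ ≤ 1ℚ
  μ≤1 = p⊓q≤q δ 1ℚ
  0<μ : 0ℚ < μ
  0<μ with ≤-total δ 1ℚ
  ... | inj₁ δ≤1 = subst (0ℚ <_) (sym (p≤q⇒p⊓q≡p δ≤1)) 0<δ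
  ... | inj₂ 1≤δ = subst (0ℚ <_) (sym (p≥q⇒p⊓q≡q 1≤δ)) 0<1
  L = inv μ * inv μ
  0<L : 0ℚ < L
  0<L = 0<* (inv-pos 0<μ) (inv-pos 0<μ)
  C = B * B * L
  0<C : 0ℚ < C
  0<C = 0<* (0<* 0<B 0<B) 0<L
  K = L + (C + C)
  0<K : 0ℚ < K
  0<K = +-mono-< 0<L (+-mono-< 0<C 0<C)

  refine : ∀ ε n k q → μ ≤ q → ∣ q - 1ℚ ∣ ≤ B → 1/n (suc n) ≤ ε →
           ∣ logSum q (suc n) - logSum q (suc n ℕ.* suc k) ∣ ≤ C * ε
  refine ε n k q μ≤q ∣q-1∣≤B 1/n≤ε = ≤-trans (logSum-refine (suc n) (suc k) 0<μ μ≤1 μ≤q)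
    (0≤*-mono-≤ (0≤* (0≤* 0≤d 0≤d) (<⇒≤ 0<L))
      (≤-trans 0≤1/n 1/n≤ε)
      (*-monoʳ-≤-nonNeg L {{nonNegative (<⇒≤ 0<L)}} (0≤*-mono-≤ 0≤d (<⇒≤ 0<B) ∣q-1∣≤B ∣q-1∣≤B))
      1/n≤ε)
    where
    0≤d = 0≤∣p∣ (q - 1ℚ)
    0≤1/n : 0ℚ ≤ 1/n (suc n)
    0≤1/n = nonNegative⁻¹ (1/n (suc n)) {{normalize-nonNeg 1 (suc n)}}

  modulus : ∀ ε → 0ℚ < ε → ∃[ N ] ∀ m n → N ℕ.≤ m → N ℕ.≤ n →
            ∣ logSum (seq x m) (suc m) - logSum (seq x n) (suc n) ∣ ≤ K * ε
  modulus ε 0<ε with cauchy x ε 0<ε | 1/n-≤ ε 0<ε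
  ... | N₃ , P | N₄ , Q = (N₁ ℕ.⊔ N₂) ℕ.⊔ (N₃ ℕ.⊔ N₄) , λ m n N≤m N≤n →
    let l₁ = λ k (N≤k : (N₁ ℕ.⊔ N₂) ℕ.⊔ (N₃ ℕ.⊔ N₄) ℕ.≤ k) → ⊔⇒ˡ (N₁ ℕ.⊔ N₂) (N₃ ℕ.⊔ N₄) N≤k
        l₂ = λ k (N≤k : (N₁ ℕ.⊔ N₂) ℕ.⊔ (N₃ ℕ.⊔ N₄) ℕ.≤ k) → ⊔⇒ʳ (N₁ ℕ.⊔ N₂) (N₃ ℕ.⊔ N₄) N≤k
        μ≤ = λ k N≤k → ≤-trans (p⊓q≤p δ 1ℚ) (δ≤x k (⊔⇒ˡ N₁ N₂ (l₁ k N≤k)))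
        a = seq x m
        b = seq x n
        common = logSum b (suc m ℕ.* suc n)
    in begin
    ∣ logSum a (suc m) - logSum b (suc n) ∣
      ≤⟨ tri (logSum a (suc m)) (logSum b (suc m)) (logSum b (suc n)) ⟩
    ∣ logSum a (suc m) - logSum b (suc m) ∣ + ∣ logSum b (suc m) - logSum b (suc n) ∣
      ≤⟨ +-mono-≤
           (≤-trans (logSum-lipschitz (suc m) 0<μ μ≤1 (μ≤ m N≤m) (μ≤ n N≤n))
             (*-monoʳ-≤-nonNeg L {{nonNegative (<⇒≤ 0<L)}}
               (P m n (⊔⇒ˡ N₃ N₄ (l₂ m N≤m)) (⊔⇒ˡ N₃ N₄ (l₂ n N≤n)))))
           (tri (logSum b (suc m)) common (logSum b (suc n))) ⟩
    ε * L + (∣ logSum b (suc m) - common ∣ + ∣ common - logSum b (suc n) ∣)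
      ≡⟨ cong (λ t → ε * L + (∣ logSum b (suc m) - common ∣ + t))
           (trans (∣-∣-sym common (logSum b (suc n)))
             (cong (λ t → ∣ logSum b (suc n) - t ∣) (commute b m n))) ⟩
    ε * L + (∣ logSum b (suc m) - common ∣ + ∣ logSum b (suc n) - logSum b (suc n ℕ.* suc m) ∣)
      ≤⟨ +-monoʳ-≤ (ε * L) (+-mono-≤
           (refine ε m n b (μ≤ n N≤n) (∣x-1∣≤B n (⊔⇒ʳ N₁ N₂ (l₁ n N≤n)))
             (Q m (⊔⇒ʳ N₃ N₄ (l₂ m N≤m))))
           (refine ε n m b (μ≤ n N≤n) (∣x-1∣≤B n (⊔⇒ʳ N₁ N₂ (l₁ n N≤n)))
             (Q n (⊔⇒ʳ N₃ N₄ (l₂ n N≤n))))) ⟩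
    ε * L + (C * ε + C * ε)
      ≡⟨ solve 3 (λ e l c → e :* l :+ (c :* e :+ c :* e) := (l :+ (c :+ c)) :* e) refl ε L C ⟩
    K * ε ∎
    where
    open ≤-Reasoning
    commute : ∀ b m n → logSum b (suc m ℕ.* suc n) ≡ logSum b (suc n ℕ.* suc m)
    commute b m n = transport (suc m ℕ.* suc n) (suc n ℕ.* suc m) (ℕₚ.*-comm (suc m) (suc n))
      where
      transport : ∀ i j .{{_ : ℕ.NonZero i}} .{{_ : ℕ.NonZero j}} → i ≡ j → logSum b i ≡ logSum b j
      transport i .i refl = refl

_*ᵣ_ : ℝ → ℝ → ℝ
x *ᵣ y = mkℝ (λ n → seq x n * seq y n) (*-cauchy (seq x) (seq y) (cauchy x) (cauchy y))

infixl 7 _/ᵣ_[_]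

_/ᵣ_[_] : (x y : ℝ) → ι 0ℚ <ᵣ y → ℝ
x /ᵣ y [ 0<y ] = x *ᵣ mkℝ (λ n → inv (seq y n)) (inv-cauchy y 0<y)

-- Natural logarithm as the integral log x = ∫₁ˣ dt/t, as a limit of Riemann sums: the n-th
-- approximation uses n + 1 steps and the n-th approximation of x.
log : (x : ℝ) → ι 0ℚ <ᵣ x → ℝ
log x 0<x = mkℝ (λ n → riemannSum inv 1ℚ (seq x n) (suc n)) (logSum-cauchy x 0<x)

record ℂ : Set where
  constructor _+i_
  field
    re im : ℝ

open ℂ public

infix  4 _≈ᶜ_
infixl 6 _+ᶜ_
infixl 7 _*ᶜ_

_≈ᶜ_ : ℂ → ℂ → Set
z ≈ᶜ w = re z ≈ re w × im z ≈ im w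

_+ᶜ_ : ℂ → ℂ → ℂ
z +ᶜ w = (re z +ᵣ re w) +i (im z +ᵣ im w)

_*ᶜ_ : ℂ → ℂ → ℂ
z *ᶜ w = (re z *ᵣ re w -ᵣ im z *ᵣ im w) +i (re z *ᵣ im w +ᵣ im z *ᵣ re w)

ℤ→ℂ : ℤ → ℂ
ℤ→ℂ m = ι (m / 1) +i ι 0ℚ

0ᶜ : ℂ
0ᶜ = ℤ→ℂ (+ 0)

-- r = |z|
IsModulus : ℂ → ℝ → Set
IsModulus z r = ι 0ℚ ≤ᵣ r × r *ᵣ r ≈ re z *ᵣ re z +ᵣ im z *ᵣ im z

Matrix : Set → ℕ → Set
Matrix A n = Fin n → Fin n → A

IsEigenvalue : ∀ {n} → Matrix ℤ n → ℂ → Set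
IsEigenvalue {n} A z = Σ[ v ∈ (Fin n → ℂ) ]
  ¬ (∀ i → v i ≈ᶜ 0ᶜ) ×
  (∀ i → Vec.foldr _+ᶜ_ 0ᶜ (λ j → ℤ→ℂ (A i j) *ᶜ v j) ≈ᶜ z *ᶜ v i)

IsLargestEigenvalueModulus : ∀ {n} → Matrix ℤ n → ℝ → Set
IsLargestEigenvalueModulus A r =
  (∃[ z ] IsEigenvalue A z × IsModulus z r) ×
  (∀ z r′ → IsEigenvalue A z → IsModulus z r′ → r′ ≤ᵣ r)

s₂ : ℕ → ℕ
s₂ n = sum (List.map toℕ (proj₁ (toDigits 2 n)))

η : ℕ → ℤ
η n = ℤ.-1ℤ ℤ.^ s₂ n

-- The residue class i is given by an arbitrary integer representative.
S : (p : ℕ) (i : ℤ) → ℕ → ℤ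
S p i n = List.foldr ℤ._+_ ℤ.0ℤ (List.map η (filter (λ j → + p ∣? (+ j ℤ.- i)) (upTo n)))

M : (p s : ℕ) → Matrix ℤ p
M p s i j = S p (+ toℕ i ℤ.- + toℕ j) (2 ℕ.^ s)

IsOrderOf2 : (p s : ℕ) → Set
IsOrderOf2 p s = 0 ℕ.< s × p ℕ∣.∣ 2 ℕ.^ s ℕ.∸ 1 ×
  (∀ t → 0 ℕ.< t → p ℕ∣.∣ 2 ℕ.^ t ℕ.∸ 1 → s ℕ.≤ t)

OddPrime : ℕ → Set
OddPrime p = Prime p × ¬ (2 ℕ∣.∣ p)

P₁ : ℕ → Set
P₁ p = OddPrime p × IsOrderOf2 p (p ℕ.∸ 1)

0<2 : ι 0ℚ <ᵣ ι (+ 2 / 1)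
0<2 = 1ℚ , positive⁻¹ 1ℚ , 0 , λ _ _ → ≤ᵇ⇒≤ _

log2 : ℝ
log2 = log (ι (+ 2 / 1)) 0<2

-- b = β(p) = log λ₁ / (s log 2).  The positivity proofs are what the logarithm
-- and the quotient need in order to be defined.
Isβ : ℕ → ℝ → Set
Isβ p b = ∃[ s ] IsOrderOf2 p s × ∃[ λ₁ ] IsLargestEigenvalueModulus (M p s) λ₁ ×
  Σ[ 0<λ₁ ∈ ι 0ℚ <ᵣ λ₁ ] Σ[ 0<d ∈ ι 0ℚ <ᵣ ι (+ s / 1) *ᵣ log2 ]
    b ≈ log λ₁ 0<λ₁ /ᵣ (ι (+ s / 1) *ᵣ log2) [ 0<d ]

{-# OPTIONS --safe #-}

-- The generating polynomial of η on [0, 2ˢ) is ∏_{t<s} (1 - x^(2ᵗ)).  If 2 is a primitive root modulo p and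
-- s = p - 1, then modulo 1 + x + ... + x^(p-1) this is the product of all 1 - xᵏ with 0 < k < p, which equals p.
-- Hence M = pI - J with J the all-ones matrix, so λ₁ = p and β = log p / ((p - 1) log 2).
-- Now p² ≤ 2^(p-1) for p ≥ 7, whereas p = 2ᵏ + 1 with p - 1 = 2k (p = 3 or 5) gives log p > k log 2.

module Submission where

open import Level using (0ℓ)
open import Algebra.Bundles using (CommutativeRing)
open import Data.Bool.Base using (if_then_else_)
open import Data.Digit using (fromDigits; toDigits)
open import Data.Empty using (⊥; ⊥-elim)
open import Data.Fin.Base as Fin using (Fin; zero; suc; toℕ; punchIn)
import Data.Fin.Properties as Finₚ
open import Data.Integer.Base as ℤ using (ℤ; +_)
open import Data.Integer.Divisibility.Signed as ℤ∣ using (_∣?_)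
import Data.Integer.Properties as ℤₚ
import Data.Integer.Solver as ℤSolver
open import Data.List.Base as List using (List; []; _∷_; applyUpTo; upTo; filter)
import Data.List.Properties as Listₚ
open import Data.Nat.Base as ℕ using (ℕ; zero; suc)
open import Data.Nat.Coprimality using (Coprime; coprime-Bézout)
import Data.Nat.Divisibility as ℕ∣
import Data.Nat.DivMod as ℕ/
open import Data.Nat.GCD using (module Bézout)
open import Data.Nat.ListAction using (sum)
open import Data.Nat.Primality
  using (Prime; prime?; prime[2]; ¬prime[0]; ¬prime[1]; prime⇒irreducible; euclidsLemma)
import Data.Nat.Properties as ℕₚ
open import Data.Nat.Solver using () renaming (module +-*-Solver to ℕSolver)
open import Data.Product.Base using (_×_; _,_; proj₁; proj₂; ∃-syntax; Σ-syntax)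
open import Data.Sum.Base using (_⊎_; inj₁; inj₂)
open import Data.Vec.Base using (Vec; []; _∷_; replicate)
import Data.Vec.Functional as Vec
open import Function.Base using (_∘_; case_of_)
open import Function.Bundles using (_⇔_; mk⇔)
open import Relation.Binary.Bundles using (Setoid)
import Relation.Binary.PropositionalEquality as ≡
open import Relation.Binary.Structures using (IsEquivalence)
open import Relation.Nullary using (¬_; yes; no; does; contradiction)
open import Relation.Nullary.Decidable using (dec-true; dec-false; from-yes; from-no)
open import Relation.Unary using (Pred; Decidable)
open ≡ using (_≡_)

-- Products over roots of unity

-- The place of a p-th root of unity is taken by the shift `T` on integer sequences killed by 1 + T
-- + ... + T^(p-1). The operators on these sequences form a ring that is not known to be a domain,
-- so all cancellation rests on its being torsion-free: T^k c = c with p not dividing k forces p c =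
-- 0. The order of 2 enters through p - 1 powers of 2 that are incongruent modulo p. They give p - 1
-- roots, with regular differences, of a polynomial of degree p - 1. The rarefied sum S(i) is the
-- Thue-Morse product applied to the indicator χ of the multiples of p. But χ is not killed by 1 + T
-- + ... + T^(p-1); only (1 - T)χ is. The product formula therefore determines the result up to a
-- constant, and this constant becomes the summand -J. On the analytic side, log is a limit of
-- rational Riemann sums. At suitable indices these are harmonic sums over intervals [n, nx), and
-- cutting such intervals replaces log(xy) = log x + log y. All comparisons are made between these
-- finite sums, with explicit error budgets.

prime∤⇒coprime : ∀ {p k} → Prime p → ¬ (p ℕ∣.∣ k) → Coprime k p
prime∤⇒coprime p-prime p∤k (d∣k , d∣p) with prime⇒irreducible p-prime d∣p
... | inj₁ d≡1    = d≡1
... | inj₂ ≡.refl = ⊥-elim (p∤k d∣k)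

module RootsOfUnity {c ℓ} (R : CommutativeRing c ℓ) where
  open CommutativeRing R
  open import Algebra.Properties.Ring ring using (+-cancelʳ)
  open import Algebra.Properties.Semiring.Exp semiring using (_^_; ^-homo-*; ^-assocʳ; ^-congʳ)
  open import Algebra.Properties.Semiring.Mult semiring using () renaming (_×_ to _×ᵐ_)
  open import Relation.Binary.Reasoning.Setoid setoid
  open import Algebra.Solver.Ring.NaturalCoefficients.Default commutativeSemiring

  -- The monic polynomial with the given non-leading coefficients, lowest degree first.
  monic : ∀ {m} → Vec Carrier m → Carrier → Carrier
  monic []       y = 1#
  monic (a ∷ as) y = a + y * monic as y

  -- Horner's scheme: the coefficients of (f(y) - f(r)) / (y - r) are the values at `r` of the
  -- successive tails of `f`.
  quotient : ∀ {m} → Carrier → Vec Carrier (suc m) → Vec Carrier m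
  quotient r (a ∷ [])         = []
  quotient r (a ∷ as@(_ ∷ _)) = monic as r ∷ quotient r as

  -- Division by y - r; both sides are moved so that it becomes a semiring identity.
  monic-division : ∀ {m} (f : Vec Carrier (suc m)) r y →
    monic f y + r * monic (quotient r f) y ≈ y * monic (quotient r f) y + monic f r
  monic-division (a ∷ []) r y =
    solve 3 (λ a r y → (a :+ y :* con 1) :+ r :* con 1 := y :* con 1 :+ (a :+ r :* con 1)) refl a r y
  monic-division (a ∷ as@(_ ∷ _)) r y = begin
    (a + y * g y) + r * (g r + y * q)   ≈⟨ solve 6 (λ a y gy r gr q →
                                             (a :+ y :* gy) :+ r :* (gr :+ y :* q) :=
                                             y :* (gy :+ r :* q) :+ (a :+ r :* gr)) refl a y (g y) r (g r) q ⟩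
    y * (g y + r * q) + (a + r * g r)   ≈⟨ +-congʳ (*-congˡ (monic-division as r y)) ⟩
    y * (y * q + g r) + (a + r * g r)   ≈⟨ solve 5 (λ a y r gr q →
                                             y :* (y :* q :+ gr) :+ (a :+ r :* gr) :=
                                             y :* (gr :+ y :* q) :+ (a :+ r :* gr)) refl a y r (g r) q ⟩
    y * (g r + y * q) + (a + r * g r)   ∎
    where
    g = monic as
    q = monic (quotient r as) y

  ∏ : ℕ → (ℕ → Carrier) → Carrier
  ∏ zero    f = 1#
  ∏ (suc n) f = ∏ n f * f n

  -- Induction splits off the last root. By division the quotient `q` satisfies r_i q(r_i) = r_m
  -- q(r_i) at every earlier root, so regularity of the differences of the roots makes `q` vanish
  -- there.
  monic-roots : ∀ {m} (f : Vec Carrier m) (r : ℕ → Carrier) →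
    (∀ i → i ℕ.< m → monic f (r i) ≈ 0#) →
    (∀ i j → i ℕ.< j → j ℕ.< m → ∀ c → r i * c ≈ r j * c → c ≈ 0#) →
    ∀ y → monic f y ≈ ∏ m (λ i → y - r i)
  monic-roots {zero}  []      r root regular y = refl
  monic-roots {suc m} f r root regular y = begin
    monic f y                      ≈⟨ +-cancelʳ (rₘ * q y) _ _ factor ⟩
    q y * (y - rₘ)                 ≈⟨ *-congʳ (monic-roots (quotient rₘ f) r q-root
                                        (λ i j i<j j<m → regular i j i<j (ℕₚ.m<n⇒m<1+n j<m)) y) ⟩
    ∏ m (λ i → y - r i) * (y - rₘ) ∎
    where
    rₘ = r m
    q = monic (quotient rₘ f)
    division : ∀ z → monic f z + rₘ * q z ≈ z * q z
    division z = begin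
      monic f z + rₘ * q z    ≈⟨ monic-division f rₘ z ⟩
      z * q z + monic f rₘ    ≈⟨ +-congˡ (root m ℕₚ.≤-refl) ⟩
      z * q z + 0#            ≈⟨ +-identityʳ _ ⟩
      z * q z                 ∎
    factor : monic f y + rₘ * q y ≈ q y * (y - rₘ) + rₘ * q y
    factor = begin
      monic f y + rₘ * q y              ≈⟨ division y ⟩
      y * q y                           ≈⟨ +-identityʳ _ ⟨
      y * q y + 0#                      ≈⟨ +-congˡ (zeroʳ (q y)) ⟨
      y * q y + q y * 0#                ≈⟨ +-congˡ (*-congˡ (-‿inverseˡ rₘ)) ⟨
      y * q y + q y * (- rₘ + rₘ)       ≈⟨ solve 4 (λ y q s r → y :* q :+ q :* (s :+ r) := q :* (y :+ s) :+ r :* q)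
                                             refl y (q y) (- rₘ) rₘ ⟩
      q y * (y - rₘ) + rₘ * q y         ∎
    q-root : ∀ i → i ℕ.< m → q (r i) ≈ 0#
    q-root i i<m = regular i m i<m ℕₚ.≤-refl (q (r i)) (begin
      r i * q (r i)                       ≈⟨ division (r i) ⟨
      monic f (r i) + rₘ * q (r i)        ≈⟨ +-congʳ (root i (ℕₚ.m<n⇒m<1+n i<m)) ⟩
      0# + rₘ * q (r i)                   ≈⟨ +-identityˡ _ ⟩
      rₘ * q (r i)                        ∎)

  geometric : ℕ → Carrier → Carrier
  geometric m = monic (replicate m 1#)

  geometric-step : ∀ m y → y * geometric m y + 1# ≈ geometric m y + y ^ suc m
  geometric-step zero    y = solve 1 (λ y → y :* con 1 :+ con 1 := con 1 :+ y :* con 1) refl y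
  geometric-step (suc m) y = begin
    y * (1# + y * g) + 1#       ≈⟨ solve 2 (λ y g → y :* (con 1 :+ y :* g) :+ con 1 := con 1 :+ y :* (y :* g :+ con 1)) refl y g ⟩
    1# + y * (y * g + 1#)       ≈⟨ +-congˡ (*-congˡ (geometric-step m y)) ⟩
    1# + y * (g + y ^ suc m)    ≈⟨ solve 3 (λ y g h → con 1 :+ y :* (g :+ h) := con 1 :+ y :* g :+ y :* h) refl y g (y ^ suc m) ⟩
    1# + y * g + y ^ suc (suc m) ∎
    where g = geometric m y

  geometric-fixed : ∀ m {y c} → y * c ≈ c → geometric m y * c ≈ suc m ×ᵐ c
  geometric-fixed zero    {y} {c} yc≈c = trans (*-identityˡ c) (sym (+-identityʳ c))
  geometric-fixed (suc m) {y} {c} yc≈c = begin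
    (1# + y * g) * c   ≈⟨ solve 3 (λ y g c → (con 1 :+ y :* g) :* c := c :+ g :* (y :* c)) refl y g c ⟩
    c + g * (y * c)    ≈⟨ +-congˡ (*-congˡ yc≈c) ⟩
    c + g * c          ≈⟨ +-congˡ (geometric-fixed m yc≈c) ⟩
    c + suc m ×ᵐ c      ∎
    where g = geometric m y

  ^-fixed : ∀ n {y c} → y * c ≈ c → y ^ n * c ≈ c
  ^-fixed zero    {y} {c} yc≈c = *-identityˡ c
  ^-fixed (suc n) {y} {c} yc≈c = trans (*-assoc y (y ^ n) c) (trans (*-congˡ (^-fixed n yc≈c)) yc≈c)

  1^ : ∀ n → 1# ^ n ≈ 1#
  1^ zero    = refl
  1^ (suc n) = trans (*-identityˡ (1# ^ n)) (1^ n)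

  module _ (m : ℕ) (p-prime : Prime (suc m)) (p-regular : ∀ c → suc m ×ᵐ c ≈ 0# → c ≈ 0#) where

    private
      p : ℕ
      p = suc m

    geometric≈0⇒^p≈1 : ∀ {y} → geometric m y ≈ 0# → y ^ p ≈ 1#
    geometric≈0⇒^p≈1 {y} g≈0 = begin
      y ^ p                   ≈⟨ +-identityˡ _ ⟨
      0# + y ^ p              ≈⟨ +-congʳ g≈0 ⟨
      geometric m y + y ^ p   ≈⟨ geometric-step m y ⟨
      y * geometric m y + 1#  ≈⟨ +-congʳ (*-congˡ g≈0) ⟩
      y * 0# + 1#             ≈⟨ +-congʳ (zeroʳ y) ⟩
      0# + 1#                 ≈⟨ +-identityˡ 1# ⟩
      1#                      ∎

    -- The n with yⁿ c = c form a subgroup containing k and p, hence 1.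
    ^-fixed⇒0 : ∀ {y} → geometric m y ≈ 0# → ∀ {k} → ¬ (p ℕ∣.∣ k) → ∀ {c} → y ^ k * c ≈ c → c ≈ 0#
    ^-fixed⇒0 {y} g≈0 {k} p∤k {c} fixed = p-regular c (begin
      p ×ᵐ c               ≈⟨ geometric-fixed m yc≈c ⟨
      geometric m y * c   ≈⟨ *-congʳ g≈0 ⟩
      0# * c              ≈⟨ zeroˡ c ⟩
      0#                  ∎)
      where
      fixed-p : y ^ p * c ≈ c
      fixed-p = trans (*-congʳ (geometric≈0⇒^p≈1 g≈0)) (*-identityˡ c)
      multiple : ∀ {n} → y ^ n * c ≈ c → ∀ t → y ^ (t ℕ.* n) * c ≈ c
      multiple {n} fixed-n t = begin
        y ^ (t ℕ.* n) * c   ≈⟨ *-congʳ (^-congʳ y (ℕₚ.*-comm t n)) ⟩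
        y ^ (n ℕ.* t) * c   ≈⟨ *-congʳ (^-assocʳ y n t) ⟨
        (y ^ n) ^ t * c     ≈⟨ ^-fixed t fixed-n ⟩
        c                   ∎
      consecutive : ∀ {a b} → 1 ℕ.+ a ≡ b → y ^ a * c ≈ c → y ^ b * c ≈ c → y * c ≈ c
      consecutive {a} ≡.refl fixed-a fixed-b = begin
        y * c             ≈⟨ *-congˡ fixed-a ⟨
        y * (y ^ a * c)   ≈⟨ *-assoc y (y ^ a) c ⟨
        y ^ suc a * c     ≈⟨ fixed-b ⟩
        c                 ∎
      yc≈c : y * c ≈ c
      yc≈c with coprime-Bézout (prime∤⇒coprime p-prime p∤k)
      ... | Bézout.+- s t 1+tp≡sk = consecutive 1+tp≡sk (multiple fixed-p t) (multiple fixed s)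
      ... | Bézout.-+ s t 1+sk≡tp = consecutive 1+sk≡tp (multiple fixed s) (multiple fixed-p t)

    -- Since (x^k)^p = 1, the step identity shows that the value at x^k does not change under
    -- multiplication by x^k. So it is itself one of the elements that `^-fixed⇒0` forces to vanish.
    geometric-^≈0 : ∀ {x} → geometric m x ≈ 0# → ∀ {k} → ¬ (p ℕ∣.∣ k) → geometric m (x ^ k) ≈ 0#
    geometric-^≈0 {x} g≈0 {k} p∤k = ^-fixed⇒0 g≈0 p∤k (+-cancelʳ 1# _ _ (begin
      x ^ k * geometric m (x ^ k) + 1#       ≈⟨ geometric-step m (x ^ k) ⟩
      geometric m (x ^ k) + (x ^ k) ^ p      ≈⟨ +-congˡ (^-assocʳ x k p) ⟩
      geometric m (x ^ k) + x ^ (k ℕ.* p)    ≈⟨ +-congˡ (^-congʳ x (ℕₚ.*-comm k p)) ⟩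
      geometric m (x ^ k) + x ^ (p ℕ.* k)    ≈⟨ +-congˡ (^-assocʳ x p k) ⟨
      geometric m (x ^ k) + (x ^ p) ^ k      ≈⟨ +-congˡ (^-congˡ′ k (geometric≈0⇒^p≈1 g≈0)) ⟩
      geometric m (x ^ k) + 1# ^ k           ≈⟨ +-congˡ (1^ k) ⟩
      geometric m (x ^ k) + 1#               ∎))
      where
      ^-congˡ′ : ∀ n {a b} → a ≈ b → a ^ n ≈ b ^ n
      ^-congˡ′ zero    a≈b = refl
      ^-congˡ′ (suc n) a≈b = *-cong a≈b (^-congˡ′ n a≈b)

    -- x^a is a unit, its inverse being its m-th power, so it can be cancelled; x^b c = c remains.
    ^-separates : ∀ {x} → geometric m x ≈ 0# → ∀ {a b} → ¬ (p ℕ∣.∣ b) →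
      ∀ {c} → x ^ a * c ≈ x ^ (a ℕ.+ b) * c → c ≈ 0#
    ^-separates {x} g≈0 {a} {b} p∤b {c} eq = ^-fixed⇒0 g≈0 p∤b (begin
      x ^ b * c                            ≈⟨ cancel (x ^ b * c) ⟨
      (x ^ a) ^ m * (x ^ a * (x ^ b * c))  ≈⟨ *-congˡ (*-assoc (x ^ a) (x ^ b) c) ⟨
      (x ^ a) ^ m * ((x ^ a * x ^ b) * c)  ≈⟨ *-congˡ (*-congʳ (^-homo-* x a b)) ⟨
      (x ^ a) ^ m * (x ^ (a ℕ.+ b) * c)    ≈⟨ *-congˡ eq ⟨
      (x ^ a) ^ m * (x ^ a * c)            ≈⟨ cancel c ⟩
      c                                    ∎)
      where
      cancel : ∀ d → (x ^ a) ^ m * (x ^ a * d) ≈ d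
      cancel d = begin
        (x ^ a) ^ m * (x ^ a * d)   ≈⟨ solve 3 (λ u v d → u :* (v :* d) := (v :* u) :* d) refl ((x ^ a) ^ m) (x ^ a) d ⟩
        (x ^ a) ^ p * d             ≈⟨ *-congʳ (^-assocʳ x a p) ⟩
        x ^ (a ℕ.* p) * d           ≈⟨ *-congʳ (^-congʳ x (ℕₚ.*-comm a p)) ⟩
        x ^ (p ℕ.* a) * d           ≈⟨ *-congʳ (^-assocʳ x p a) ⟨
        (x ^ p) ^ a * d             ≈⟨ ^-fixed a (trans (*-congʳ (geometric≈0⇒^p≈1 g≈0)) (*-identityˡ d)) ⟩
        d                           ∎

    -- The x^(a i) are as many roots of 1 + y + ... + y^m as its degree, so the polynomial is the
    -- product of the y - x^(a i). The claim is its value at y = 1.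
    ∏[1-xᵃ]≈p : ∀ {x} → geometric m x ≈ 0# → (a : ℕ → ℕ) → (∀ i → ¬ (p ℕ∣.∣ a i)) →
      (∀ i j → i ℕ.< j → j ℕ.< m → ∃[ b ] a j ≡ a i ℕ.+ b × ¬ (p ℕ∣.∣ b)) →
      ∏ m (λ i → 1# - x ^ a i) ≈ p ×ᵐ 1#
    ∏[1-xᵃ]≈p {x} g≈0 a p∤a separated = begin
      ∏ m (λ i → 1# - x ^ a i)   ≈⟨ monic-roots (replicate m 1#) (λ i → x ^ a i)
                                      (λ i _ → geometric-^≈0 g≈0 (p∤a i)) regular 1# ⟨
      geometric m 1#             ≈⟨ *-identityʳ _ ⟨
      geometric m 1# * 1#        ≈⟨ geometric-fixed m (*-identityˡ 1#) ⟩
      p ×ᵐ 1#                    ∎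
      where
      regular : ∀ i j → i ℕ.< j → j ℕ.< m → ∀ c → x ^ a i * c ≈ x ^ a j * c → c ≈ 0#
      regular i j i<j j<m c eq with separated i j i<j j<m
      ... | b , aⱼ≡aᵢ+b , p∤b =
        ^-separates g≈0 {a i} p∤b (trans eq (*-congʳ (^-congʳ x aⱼ≡aᵢ+b)))

open ≡ using (_≢_; _≗_; refl; sym; trans; cong; cong₂; subst; subst₂; module ≡-Reasoning)
open import Defs using (s₂; η; S; OddPrime; IsOrderOf2)

-- Shift operators

-- Integer polynomials in the shift T, acting on sequences indexed by ℤ by (T w)(z) = w(z - 1).
infixl 6 _⊕_
infixl 7 _⊗_
infix  8 ⊖_

data Op : Set where
  𝟎 𝟏 T   : Op
  _⊕_ _⊗_ : Op → Op → Op
  ⊖_      : Op → Op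

act : Op → (ℤ → ℤ) → ℤ → ℤ
act 𝟎       w z = ℤ.0ℤ
act 𝟏       w z = w z
act T       w z = w (z ℤ.- ℤ.1ℤ)
act (a ⊕ b) w z = act a w z ℤ.+ act b w z
act (a ⊗ b) w z = act a (act b w) z
act (⊖ a)   w z = ℤ.- act a w z

act-cong : ∀ a {v w} → v ≗ w → act a v ≗ act a w
act-cong 𝟎       v≗w z = refl
act-cong 𝟏       v≗w z = v≗w z
act-cong T       v≗w z = v≗w (z ℤ.- ℤ.1ℤ)
act-cong (a ⊕ b) v≗w z = cong₂ ℤ._+_ (act-cong a v≗w z) (act-cong b v≗w z)
act-cong (a ⊗ b) v≗w z = act-cong a (act-cong b v≗w) z
act-cong (⊖ a)   v≗w z = cong ℤ.-_ (act-cong a v≗w z)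

act-0 : ∀ a → act a (λ _ → ℤ.0ℤ) ≗ λ _ → ℤ.0ℤ
act-0 𝟎       z = refl
act-0 𝟏       z = refl
act-0 T       z = refl
act-0 (a ⊕ b) z = cong₂ ℤ._+_ (act-0 a z) (act-0 b z)
act-0 (a ⊗ b) z = trans (act-cong a (act-0 b) z) (act-0 a z)
act-0 (⊖ a)   z = cong ℤ.-_ (act-0 a z)

act-+ : ∀ a v w → act a (λ z → v z ℤ.+ w z) ≗ λ z → act a v z ℤ.+ act a w z
act-+ 𝟎       v w z = refl
act-+ 𝟏       v w z = refl
act-+ T       v w z = refl
act-+ (a ⊕ b) v w z = trans (cong₂ ℤ._+_ (act-+ a v w z) (act-+ b v w z))
  (solve 4 (λ p q r s → (p :+ q) :+ (r :+ s) := (p :+ r) :+ (q :+ s)) refl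
    (act a v z) (act a w z) (act b v z) (act b w z))
  where open ℤSolver.+-*-Solver
act-+ (a ⊗ b) v w z = trans (act-cong a (act-+ b v w) z) (act-+ a (act b v) (act b w) z)
act-+ (⊖ a)   v w z = trans (cong ℤ.-_ (act-+ a v w z)) (ℤₚ.neg-distrib-+ (act a v z) (act a w z))

act-neg : ∀ a w → act a (λ z → ℤ.- w z) ≗ λ z → ℤ.- act a w z
act-neg 𝟎       w z = refl
act-neg 𝟏       w z = refl
act-neg T       w z = refl
act-neg (a ⊕ b) w z = trans (cong₂ ℤ._+_ (act-neg a w z) (act-neg b w z))
  (sym (ℤₚ.neg-distrib-+ (act a w z) (act b w z)))
act-neg (a ⊗ b) w z = trans (act-cong a (act-neg b w) z) (act-neg a (act b w) z)
act-neg (⊖ a)   w z = cong ℤ.-_ (act-neg a w z)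

act-scale : ∀ a c w → act a (λ z → c ℤ.* w z) ≗ λ z → c ℤ.* act a w z
act-scale 𝟎       c w z = sym (ℤₚ.*-zeroʳ c)
act-scale 𝟏       c w z = refl
act-scale T       c w z = refl
act-scale (a ⊕ b) c w z = trans (cong₂ ℤ._+_ (act-scale a c w z) (act-scale b c w z))
  (sym (ℤₚ.*-distribˡ-+ c (act a w z) (act b w z)))
act-scale (a ⊗ b) c w z = trans (act-cong a (act-scale b c w) z) (act-scale a c (act b w) z)
act-scale (⊖ a)   c w z = trans (cong ℤ.-_ (act-scale a c w z)) (ℤₚ.neg-distribʳ-* c (act a w z))

act-T : ∀ a w → act a (act T w) ≗ act T (act a w)
act-T 𝟎       w z = refl
act-T 𝟏       w z = refl
act-T T       w z = refl
act-T (a ⊕ b) w z = cong₂ ℤ._+_ (act-T a w z) (act-T b w z)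
act-T (a ⊗ b) w z = trans (act-cong a (act-T b w) z) (act-T a (act b w) z)
act-T (⊖ a)   w z = cong ℤ.-_ (act-T a w z)

-- Induction on the second operator reduces everything to translation invariance, `act-T`. Arbitrary
-- linear maps on sequences do not commute; this is what the restriction to the syntax `Op` buys.
act-comm : ∀ a b w → act a (act b w) ≗ act b (act a w)
act-comm a 𝟎       w z = act-0 a z
act-comm a 𝟏       w z = refl
act-comm a T       w z = act-T a w z
act-comm a (b ⊕ c) w z = trans (act-+ a (act b w) (act c w) z) (cong₂ ℤ._+_ (act-comm a b w z) (act-comm a c w z))
act-comm a (b ⊗ c) w z = trans (act-comm a b (act c w) z) (act-cong b (act-comm a c w) z)
act-comm a (⊖ b)   w z = trans (act-neg a (act b w) z) (cong ℤ.-_ (act-comm a b w z))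

-- ℤ[T] modulo the annihilator of the kernel of N.
module KernelRing (N : Op) where

  Kernel : (ℤ → ℤ) → Set
  Kernel w = act N w ≗ λ _ → ℤ.0ℤ

  infix 4 _≋_
  _≋_ : Op → Op → Set
  a ≋ b = ∀ w → Kernel w → act a w ≗ act b w

  -- Multiplication is composition, so an equation valid on the kernel can be used after another
  -- operator only if that operator preserves the kernel; `*-cong` depends on this.
  act-kernel : ∀ a {w} → Kernel w → Kernel (act a w)
  act-kernel a {w} w∈ker z = trans (act-comm N a w z) (trans (act-cong a w∈ker z) (act-0 a z))

  commutativeRing : CommutativeRing 0ℓ 0ℓ
  commutativeRing = record
    { Carrier = Op ; _≈_ = _≋_ ; _+_ = _⊕_ ; _*_ = _⊗_ ; -_ = ⊖_ ; 0# = 𝟎 ; 1# = 𝟏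
    ; isCommutativeRing = record
      { isRing = record
        { +-isAbelianGroup = record
          { isGroup = record
            { isMonoid = record
              { isSemigroup = record
                { isMagma = record
                  { isEquivalence = record
                    { refl  = λ _ _ _ → refl
                    ; sym   = λ p w k z → sym (p w k z)
                    ; trans = λ p q w k z → trans (p w k z) (q w k z) }
                  ; ∙-cong = λ p q w k z → cong₂ ℤ._+_ (p w k z) (q w k z) }
                ; assoc = λ a b c w k z → ℤₚ.+-assoc (act a w z) (act b w z) (act c w z) }
              ; identity = (λ a w k z → ℤₚ.+-identityˡ (act a w z)) , (λ a w k z → ℤₚ.+-identityʳ (act a w z)) }
            ; inverse = (λ a w k z → ℤₚ.+-inverseˡ (act a w z)) , (λ a w k z → ℤₚ.+-inverseʳ (act a w z))
            ; ⁻¹-cong = λ p w k z → cong ℤ.-_ (p w k z) }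
          ; comm = λ a b w k z → ℤₚ.+-comm (act a w z) (act b w z) }
        ; *-cong = λ {a} {b} {c} {d} p q w k z →
            trans (act-cong a (q w k) z) (p (act d w) (act-kernel d k) z)
        ; *-assoc = λ _ _ _ _ _ _ → refl
        ; *-identity = (λ _ _ _ _ → refl) , (λ _ _ _ _ → refl)
        ; distrib = (λ a b c w k z → act-+ a (act b w) (act c w) z) , (λ _ _ _ _ _ _ → refl) }
      ; *-comm = λ a b w k z → act-comm a b w z } }

geometricOp : ℕ → Op
geometricOp zero    = 𝟏
geometricOp (suc n) = 𝟏 ⊕ T ⊗ geometricOp n

-- `geometric-step` is an equation in the ring and thus speaks of kernel sequences only. It will be
-- needed for `χ`, which lies outside the kernel, so it is proved here for arbitrary sequences.
act-geometricOp-step : ∀ n w z →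
  act (geometricOp n) w (z ℤ.- ℤ.1ℤ) ℤ.+ w z ≡ act (geometricOp n) w z ℤ.+ w (z ℤ.- + suc n)
act-geometricOp-step zero    w z = ℤₚ.+-comm (w (z ℤ.- ℤ.1ℤ)) (w z)
act-geometricOp-step (suc n) w z = begin
  (w z′ ℤ.+ G (z′ ℤ.- ℤ.1ℤ)) ℤ.+ w z
    ≡⟨ solve 3 (λ a g b → (a :+ g) :+ b := b :+ (g :+ a)) refl (w z′) (G (z′ ℤ.- ℤ.1ℤ)) (w z) ⟩
  w z ℤ.+ (G (z′ ℤ.- ℤ.1ℤ) ℤ.+ w z′)
    ≡⟨ cong (λ t → w z ℤ.+ t) (act-geometricOp-step n w z′) ⟩
  w z ℤ.+ (G z′ ℤ.+ w (z′ ℤ.- + suc n))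
    ≡⟨ cong (λ t → w z ℤ.+ (G z′ ℤ.+ w t))
         (solve 2 (λ z n → (z :- con ℤ.1ℤ) :- n := z :- (con ℤ.1ℤ :+ n)) refl z (+ suc n)) ⟩
  w z ℤ.+ (G z′ ℤ.+ w (z ℤ.- + suc (suc n)))
    ≡⟨ ℤₚ.+-assoc (w z) (G z′) _ ⟨
  (w z ℤ.+ G z′) ℤ.+ w (z ℤ.- + suc (suc n)) ∎
  where
  open ≡-Reasoning
  open ℤSolver.+-*-Solver
  z′ = z ℤ.- ℤ.1ℤ
  G = act (geometricOp n) w

act-geometricOp-const : ∀ n c z → act (geometricOp n) (λ _ → c) z ≡ + suc n ℤ.* c
act-geometricOp-const zero    c z = sym (ℤₚ.*-identityˡ c)
act-geometricOp-const (suc n) c z = begin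
  c ℤ.+ act (geometricOp n) (λ _ → c) (z ℤ.- ℤ.1ℤ)   ≡⟨ cong (λ t → c ℤ.+ t) (act-geometricOp-const n c _) ⟩
  c ℤ.+ + suc n ℤ.* c                                ≡⟨ ℤₚ.suc-* (+ suc n) c ⟨
  + suc (suc n) ℤ.* c                                ∎
  where open ≡-Reasoning

module _ (m : ℕ) where

  private
    p : ℕ
    p = suc m

  open KernelRing (geometricOp m) public
  open CommutativeRing commutativeRing using (_≈_; 0#; 1#; semiring)
  open RootsOfUnity commutativeRing
  open import Algebra.Properties.Semiring.Exp semiring using (_^_)
  open import Algebra.Properties.Semiring.Mult semiring using () renaming (_×_ to _×ᵐ_)

  act-× : ∀ n a w z → act (n ×ᵐ a) w z ≡ + n ℤ.* act a w z
  act-× zero    a w z = refl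
  act-× (suc n) a w z = begin
    act a w z ℤ.+ act (n ×ᵐ a) w z     ≡⟨ cong (λ t → act a w z ℤ.+ t) (act-× n a w z) ⟩
    act a w z ℤ.+ + n ℤ.* act a w z    ≡⟨ ℤₚ.suc-* (+ n) (act a w z) ⟨
    + suc n ℤ.* act a w z              ∎
    where open ≡-Reasoning

  geometric≡ : ∀ n → geometric n T ≡ geometricOp n
  geometric≡ zero    = refl
  geometric≡ (suc n) = cong (λ g → 𝟏 ⊕ T ⊗ g) (geometric≡ n)

  ×-regular : ∀ a → p ×ᵐ a ≈ 0# → a ≈ 0#
  ×-regular a eq w k z = ℤₚ.*-cancelˡ-≡ (+ p) (act a w z) ℤ.0ℤ
    (trans (sym (act-× p a w z)) (trans (eq w k z) (sym (ℤₚ.*-zeroʳ (+ p)))))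

  act-^ : ∀ n w z → act (T ^ n) w z ≡ w (z ℤ.- + n)
  act-^ zero    w z = cong w (sym (ℤₚ.+-identityʳ z))
  act-^ (suc n) w z = trans (act-^ n w (z ℤ.- ℤ.1ℤ))
    (cong w (solve 2 (λ z n → z :- con ℤ.1ℤ :- n := z :- (con ℤ.1ℤ :+ n)) refl z (+ n)))
    where open ℤSolver.+-*-Solver

  -- ∏_{t<k} (1 - T^(2ᵗ)), the generating polynomial of η on [0, 2ᵏ).
  thueMorse : ℕ → Op
  thueMorse k = ∏ k (λ t → 𝟏 ⊕ ⊖ (T ^ (2 ℕ.^ t)))

  act-thueMorse≡p : Prime p → (∀ i → ¬ (p ℕ∣.∣ 2 ℕ.^ i)) →
    (∀ i j → i ℕ.< j → j ℕ.< m → ∃[ b ] 2 ℕ.^ j ≡ 2 ℕ.^ i ℕ.+ b × ¬ (p ℕ∣.∣ b)) →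
    ∀ w → Kernel w → ∀ z → act (thueMorse m) w z ≡ + p ℤ.* w z
  act-thueMorse≡p p-prime p∤2^ separated w k z = trans
    (∏[1-xᵃ]≈p m p-prime ×-regular {T} T-root (2 ℕ.^_) p∤2^ separated w k z)
    (act-× p 𝟏 w z)
    where
    -- `T` is a root by construction: the polynomial evaluated at `T` is the operator that defines
    -- the kernel.
    T-root : geometric m T ≈ 0#
    T-root w k z = trans (cong (λ a → act a w z) (geometric≡ m)) (k z)

  act-thueMorse-suc : ∀ k w z → act (thueMorse (suc k)) w z ≡ act (thueMorse k) (λ y → w y ℤ.- w (y ℤ.- + (2 ℕ.^ k))) z
  act-thueMorse-suc k w z = act-cong (thueMorse k) (λ y → cong (λ t → w y ℤ.- t) (act-^ (2 ℕ.^ k) w y)) z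

  -- The single factor 1 - T^(2^k) annihilates constants; the index `suc k` guarantees that it
  -- occurs.
  act-thueMorse-const : ∀ k c z → act (thueMorse (suc k)) (λ _ → c) z ≡ ℤ.0ℤ
  act-thueMorse-const k c z = trans (act-thueMorse-suc k (λ _ → c) z)
    (trans (act-cong (thueMorse k) (λ _ → ℤₚ.+-inverseʳ c) z) (act-0 (thueMorse k) z))

-- Rarefied sums of the Thue–Morse sequence

digitSum : List (Fin 2) → ℕ
digitSum ds = sum (List.map toℕ ds)

digitSum-zero : ∀ ds → fromDigits ds ≡ 0 → digitSum ds ≡ 0
digitSum-zero []       eq = refl
digitSum-zero (d ∷ ds) eq = cong₂ ℕ._+_ (ℕₚ.m+n≡0⇒m≡0 (toℕ d) eq)
  (digitSum-zero ds (ℕₚ.m*n≡0⇒m≡0 (fromDigits ds) 2 (ℕₚ.m+n≡0⇒n≡0 (toℕ d) eq)))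

-- Expansions may end in zeros, hence are not unique, but their digit sum is.
digitSum-unique : ∀ ds es → fromDigits ds ≡ fromDigits es → digitSum ds ≡ digitSum es
digitSum-unique []       es       eq = sym (digitSum-zero es (sym eq))
digitSum-unique (d ∷ ds) []       eq = digitSum-zero (d ∷ ds) eq
digitSum-unique (d ∷ ds) (e ∷ es) eq = cong₂ ℕ._+_ d≡e (digitSum-unique ds es (ℕₚ.*-cancelʳ-≡ _ _ 2
  (ℕₚ.+-cancelˡ-≡ (toℕ e) _ _ (subst (λ t → t ℕ.+ fromDigits ds ℕ.* 2 ≡ _) d≡e eq))))
  where
  low : ∀ (b : Fin 2) n → (toℕ b ℕ.+ n ℕ.* 2) ℕ/.% 2 ≡ toℕ b
  low b n = trans (ℕ/.[m+kn]%n≡m%n (toℕ b) n 2) (ℕ/.m<n⇒m%n≡m (Finₚ.toℕ<n b))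
  d≡e : toℕ d ≡ toℕ e
  d≡e = trans (sym (low d (fromDigits ds))) (trans (cong (ℕ/._% 2) eq) (low e (fromDigits es)))

-- `toDigits` is used only through the value that its result represents: `b` in front of the digits
-- of `n` is a second expansion of the same number, and `digitSum-unique` compares the two.
s₂-cons : ∀ (b : Fin 2) n → s₂ (toℕ b ℕ.+ n ℕ.* 2) ≡ toℕ b ℕ.+ s₂ n
s₂-cons b n = digitSum-unique (proj₁ (toDigits 2 (toℕ b ℕ.+ n ℕ.* 2))) (b ∷ proj₁ (toDigits 2 n))
  (trans (proj₂ (toDigits 2 (toℕ b ℕ.+ n ℕ.* 2))) (cong (λ t → toℕ b ℕ.+ t ℕ.* 2) (sym (proj₂ (toDigits 2 n)))))

-- The lowest binary digit `b` of `j` is also that of 2^(k+1) + j. Removing it from both leaves the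
-- case `k` for the quotient of `j` by 2.
s₂-2^+ : ∀ k j → j ℕ.< 2 ℕ.^ k → s₂ (2 ℕ.^ k ℕ.+ j) ≡ suc (s₂ j)
s₂-2^+ zero    zero    _ = refl
s₂-2^+ zero    (suc j) (ℕ.s≤s ())
s₂-2^+ (suc k) j j<2^ = begin
  s₂ (2 ℕ.* 2 ℕ.^ k ℕ.+ j)                       ≡⟨ cong (λ t → s₂ (2 ℕ.* 2 ℕ.^ k ℕ.+ t)) j≡ ⟩
  s₂ (2 ℕ.* 2 ℕ.^ k ℕ.+ (toℕ b ℕ.+ q ℕ.* 2))     ≡⟨ cong s₂ (solve 3 (λ t b q → con 2 :* t :+ (b :+ q :* con 2) :=
                                                     b :+ (t :+ q) :* con 2) refl (2 ℕ.^ k) (toℕ b) q) ⟩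
  s₂ (toℕ b ℕ.+ (2 ℕ.^ k ℕ.+ q) ℕ.* 2)           ≡⟨ s₂-cons b (2 ℕ.^ k ℕ.+ q) ⟩
  toℕ b ℕ.+ s₂ (2 ℕ.^ k ℕ.+ q)                   ≡⟨ cong (toℕ b ℕ.+_) (s₂-2^+ k q q<2^) ⟩
  toℕ b ℕ.+ suc (s₂ q)                           ≡⟨ ℕₚ.+-suc (toℕ b) (s₂ q) ⟩
  suc (toℕ b ℕ.+ s₂ q)                           ≡⟨ cong suc (s₂-cons b q) ⟨
  suc (s₂ (toℕ b ℕ.+ q ℕ.* 2))                   ≡⟨ cong (λ t → suc (s₂ t)) j≡ ⟨
  suc (s₂ j)                                     ∎
  where
  open ≡-Reasoning
  open ℕSolver using (solve; _:+_; _:*_; _:=_; con)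
  division = j ℕ/.divMod 2
  q = ℕ/._div_ j 2
  b : Fin 2
  b = ℕ/._mod_ j 2
  j≡ : j ≡ toℕ b ℕ.+ q ℕ.* 2
  j≡ = ℕ/.DivMod.property division
  q<2^ : q ℕ.< 2 ℕ.^ k
  q<2^ = ℕₚ.*-cancelʳ-< 2 q (2 ℕ.^ k) (ℕₚ.≤-<-trans (ℕₚ.m≤n+m (q ℕ.* 2) (toℕ b))
    (subst₂ ℕ._<_ j≡ (ℕₚ.*-comm 2 (2 ℕ.^ k)) j<2^))

η-2^+ : ∀ k j → j ℕ.< 2 ℕ.^ k → η (2 ℕ.^ k ℕ.+ j) ≡ ℤ.- η j
η-2^+ k j j<2^ = trans (cong (ℤ.-1ℤ ℤ.^_) (s₂-2^+ k j j<2^)) (ℤₚ.-1*i≡-i (η j))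

∑ℤ : List ℤ → ℤ
∑ℤ = List.foldr ℤ._+_ ℤ.0ℤ

∑ℤ-cong : ∀ n {f g : ℕ → ℤ} → (∀ j → j ℕ.< n → f j ≡ g j) → ∑ℤ (applyUpTo f n) ≡ ∑ℤ (applyUpTo g n)
∑ℤ-cong zero    f≡g = refl
∑ℤ-cong (suc n) f≡g = cong₂ ℤ._+_ (f≡g 0 ℕ.z<s) (∑ℤ-cong n (λ j j<n → f≡g (suc j) (ℕ.s≤s j<n)))

∑ℤ-split : ∀ m n (f : ℕ → ℤ) →
  ∑ℤ (applyUpTo f (m ℕ.+ n)) ≡ ∑ℤ (applyUpTo f m) ℤ.+ ∑ℤ (applyUpTo (λ j → f (m ℕ.+ j)) n)
∑ℤ-split zero    n f = sym (ℤₚ.+-identityˡ _)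
∑ℤ-split (suc m) n f = trans (cong (λ t → f 0 ℤ.+ t) (∑ℤ-split m n (λ j → f (suc j)))) (sym (ℤₚ.+-assoc (f 0) _ _))

∑ℤ-+ : ∀ n (f g : ℕ → ℤ) →
  ∑ℤ (applyUpTo (λ j → f j ℤ.+ g j) n) ≡ ∑ℤ (applyUpTo f n) ℤ.+ ∑ℤ (applyUpTo g n)
∑ℤ-+ zero    f g = refl
∑ℤ-+ (suc n) f g = trans (cong (λ t → f 0 ℤ.+ g 0 ℤ.+ t) (∑ℤ-+ n (λ j → f (suc j)) (λ j → g (suc j))))
  (solve 4 (λ a b c d → (a :+ b) :+ (c :+ d) := (a :+ c) :+ (b :+ d)) refl (f 0) (g 0)
    (∑ℤ (applyUpTo (λ j → f (suc j)) n)) (∑ℤ (applyUpTo (λ j → g (suc j)) n)))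
  where open ℤSolver.+-*-Solver

∑ℤ-filter : ∀ {ℓ} {P : Pred ℕ ℓ} (P? : Decidable P) (f : ℕ → ℤ) js →
  ∑ℤ (List.map f (filter P? js)) ≡ ∑ℤ (List.map (λ j → f j ℤ.* (if does (P? j) then ℤ.1ℤ else ℤ.0ℤ)) js)
∑ℤ-filter P? f []       = refl
∑ℤ-filter P? f (j ∷ js) with P? j
... | yes _ = cong₂ ℤ._+_ (sym (ℤₚ.*-identityʳ (f j))) (∑ℤ-filter P? f js)
... | no  _ = trans (∑ℤ-filter P? f js)
  (trans (sym (ℤₚ.+-identityˡ _)) (cong (ℤ._+ _) (sym (ℤₚ.*-zeroʳ (f j)))))

-- The indicator of the multiples of p and its convolution with η

module _ (p : ℕ) where
  χ : ℤ → ℤ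
  χ z = if does (+ p ∣? z) then ℤ.1ℤ else ℤ.0ℤ

  χ-∣ : ∀ {z} → + p ℤ∣.∣ z → χ z ≡ ℤ.1ℤ
  χ-∣ {z} p∣z = cong (if_then ℤ.1ℤ else ℤ.0ℤ) (dec-true (+ p ∣? z) p∣z)

  χ-∤ : ∀ {z} → ¬ (+ p ℤ∣.∣ z) → χ z ≡ ℤ.0ℤ
  χ-∤ {z} p∤z = cong (if_then ℤ.1ℤ else ℤ.0ℤ) (dec-false (+ p ∣? z) p∤z)

  χ-⇔ : ∀ {y z} → (+ p ℤ∣.∣ y → + p ℤ∣.∣ z) → (+ p ℤ∣.∣ z → + p ℤ∣.∣ y) → χ y ≡ χ z
  χ-⇔ {y} {z} to from = case + p ∣? y of λ where
    (yes p∣y) → trans (χ-∣ p∣y) (sym (χ-∣ (to p∣y)))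
    (no  p∤y) → trans (χ-∤ p∤y) (sym (χ-∤ (λ p∣z → p∤y (from p∣z))))

  χ-neg : ∀ z → χ (ℤ.- z) ≡ χ z
  χ-neg z = χ-⇔ (λ d → subst (+ p ℤ∣.∣_) (ℤₚ.neg-involutive z) (ℤ∣.∣m⇒∣-m d)) ℤ∣.∣m⇒∣-m

  χ-periodic : ∀ z → χ (z ℤ.- + p) ≡ χ z
  χ-periodic z = χ-⇔
    (λ d → subst (+ p ℤ∣.∣_) (solve 2 (λ z p → (z :- p) :+ p := z) refl z (+ p)) (ℤ∣.∣m∣n⇒∣m+n d ℤ∣.∣-refl))
    (λ d → ℤ∣.∣m∣n⇒∣m-n d ℤ∣.∣-refl)
    where open ℤSolver.+-*-Solver

  -- Brings S into the form of a convolution. Evenness of χ turns the argument into i - j, since T^j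
  -- translates the argument by -j.
  S≡∑ηχ : ∀ i n → S p i n ≡ ∑ℤ (applyUpTo (λ j → η j ℤ.* χ (i ℤ.- + j)) n)
  S≡∑ηχ i n = begin
    ∑ℤ (List.map η (filter (λ j → + p ∣? (+ j ℤ.- i)) (upTo n)))   ≡⟨ ∑ℤ-filter (λ j → + p ∣? (+ j ℤ.- i)) η (upTo n) ⟩
    ∑ℤ (List.map (λ j → η j ℤ.* χ (+ j ℤ.- i)) (upTo n))           ≡⟨ cong ∑ℤ (Listₚ.map-upTo (λ j → η j ℤ.* χ (+ j ℤ.- i)) n) ⟩
    ∑ℤ (applyUpTo (λ j → η j ℤ.* χ (+ j ℤ.- i)) n)
      ≡⟨ ∑ℤ-cong n (λ j _ → cong (η j ℤ.*_) (trans (sym (χ-neg (+ j ℤ.- i)))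
           (cong χ (solve 2 (λ i j → :- (j :- i) := i :- j) refl i (+ j))))) ⟩
    ∑ℤ (applyUpTo (λ j → η j ℤ.* χ (i ℤ.- + j)) n)                 ∎
    where
    open ≡-Reasoning
    open ℤSolver.+-*-Solver using (solve; _:-_; :-_; _:=_)

step-invariant⇒constant : ∀ {f : ℤ → ℤ} → (∀ z → f z ≡ f (z ℤ.- ℤ.1ℤ)) → ∀ z → f z ≡ f ℤ.0ℤ
step-invariant⇒constant step (+ zero)  = refl
step-invariant⇒constant {f} step (+ suc n) = trans (step (+ suc n)) (trans (cong f (lemma n)) (step-invariant⇒constant step (+ n)))
  where
  lemma : ∀ n → + suc n ℤ.- ℤ.1ℤ ≡ + n
  lemma n = solve 1 (λ n → (con ℤ.1ℤ :+ n) :- con ℤ.1ℤ := n) refl (+ n)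
    where open ℤSolver.+-*-Solver
step-invariant⇒constant {f} step ℤ.-[1+ zero ]  = sym (step ℤ.0ℤ)
step-invariant⇒constant {f} step ℤ.-[1+ suc n ] =
  -- Subtracting 1 from `ℤ.-[1+ n ]` computes to a term with `n ℕ.+ 0`, which must be matched before
  -- `step` applies.
  trans (cong f (cong ℤ.-[1+_] (cong suc (sym (ℕₚ.+-identityʳ n)))))
    (trans (sym (step ℤ.-[1+ n ])) (step-invariant⇒constant step ℤ.-[1+ n ]))

-- The last factor 1 - T^(2^k) doubles the range of summation: its second term supplies the indices
-- from 2^k on, with the sign prescribed by `η-2^+`.
act-thueMorse≡∑η : ∀ m k w z →
  act (thueMorse m k) w z ≡ ∑ℤ (applyUpTo (λ j → η j ℤ.* w (z ℤ.- + j)) (2 ℕ.^ k))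
act-thueMorse≡∑η m zero    w z = begin
  w z                                   ≡⟨ cong w (ℤₚ.+-identityʳ z) ⟨
  w (z ℤ.- + 0)                         ≡⟨ ℤₚ.*-identityˡ _ ⟨
  ℤ.1ℤ ℤ.* w (z ℤ.- + 0)                ≡⟨ ℤₚ.+-identityʳ _ ⟨
  ℤ.1ℤ ℤ.* w (z ℤ.- + 0) ℤ.+ ℤ.0ℤ       ∎
  where open ≡-Reasoning
act-thueMorse≡∑η m (suc k) w z = begin
  act (thueMorse m (suc k)) w z
    ≡⟨ act-thueMorse-suc m k w z ⟩
  act (thueMorse m k) (λ y → w y ℤ.- w (y ℤ.- + K)) z
    ≡⟨ act-thueMorse≡∑η m k (λ y → w y ℤ.- w (y ℤ.- + K)) z ⟩
  ∑ℤ (applyUpTo (λ j → η j ℤ.* (w (z ℤ.- + j) ℤ.- w (z ℤ.- + j ℤ.- + K))) K)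
    ≡⟨ ∑ℤ-cong K term ⟩
  ∑ℤ (applyUpTo (λ j → f j ℤ.+ f (K ℕ.+ j)) K)
    ≡⟨ ∑ℤ-+ K f (λ j → f (K ℕ.+ j)) ⟩
  ∑ℤ (applyUpTo f K) ℤ.+ ∑ℤ (applyUpTo (λ j → f (K ℕ.+ j)) K)
    ≡⟨ ∑ℤ-split K K f ⟨
  ∑ℤ (applyUpTo f (K ℕ.+ K))
    ≡⟨ cong (λ t → ∑ℤ (applyUpTo f (K ℕ.+ t))) (ℕₚ.+-identityʳ K) ⟨
  ∑ℤ (applyUpTo f (2 ℕ.^ suc k)) ∎
  where
  open ≡-Reasoning
  open ℤSolver.+-*-Solver
  K = 2 ℕ.^ k
  f : ℕ → ℤ
  f j = η j ℤ.* w (z ℤ.- + j)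
  term : ∀ j → j ℕ.< K → η j ℤ.* (w (z ℤ.- + j) ℤ.- w (z ℤ.- + j ℤ.- + K)) ≡ f j ℤ.+ f (K ℕ.+ j)
  term j j<K = begin
    η j ℤ.* (w (z ℤ.- + j) ℤ.- w (z ℤ.- + j ℤ.- + K))
      ≡⟨ solve 3 (λ e a b → e :* (a :- b) := e :* a :+ :- e :* b) refl (η j) (w (z ℤ.- + j)) _ ⟩
    f j ℤ.+ ℤ.- η j ℤ.* w (z ℤ.- + j ℤ.- + K)
      ≡⟨ cong₂ (λ e y → f j ℤ.+ e ℤ.* w y) (sym (η-2^+ k j j<K))
           (solve 3 (λ z j K → z :- j :- K := z :- (K :+ j)) refl z (+ j) (+ K)) ⟩
    f j ℤ.+ f (K ℕ.+ j) ∎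

module _ (m : ℕ) where

  private
    p : ℕ
    p = suc (suc m)

  ∤-small : ∀ j → 0 ℕ.< j → j ℕ.< p → ¬ (+ p ℤ∣.∣ ℤ.- + j)
  ∤-small (suc j) _ j<p p∣-j = ℕ∣.>⇒∤ j<p (ℤ∣.∣⇒∣ᵤ p∣-j)

  -- Among p consecutive integers exactly one is a multiple of p. Periodicity makes the count
  -- independent of the window, so it is evaluated on 0, -1, ..., -(p - 1).
  act-geometricOp-χ : ∀ z → act (geometricOp (suc m)) (χ p) z ≡ ℤ.1ℤ
  act-geometricOp-χ z = trans (step-invariant⇒constant {N} invariant z) at-0
    where
    open ≡-Reasoning
    N : ℤ → ℤ
    N = act (geometricOp (suc m)) (χ p)
    invariant : ∀ z → N z ≡ N (z ℤ.- ℤ.1ℤ)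
    invariant z = sym (∙-cancelʳ (χ p z) (N (z ℤ.- ℤ.1ℤ)) (N z)
      (trans (act-geometricOp-step (suc m) (χ p) z) (cong (λ t → N z ℤ.+ t) (χ-periodic p z))))
      where open import Algebra.Properties.AbelianGroup ℤₚ.+-0-abelianGroup using (∙-cancelʳ)
    -- The window is -j, ..., -(j + n), which lies strictly between -p and 0.
    vanish : ∀ n j → 0 ℕ.< j → j ℕ.+ n ℕ.< p → act (geometricOp n) (χ p) (ℤ.- + j) ≡ ℤ.0ℤ
    vanish zero    j 0<j j+n<p = χ-∤ p (∤-small j 0<j (subst (ℕ._< p) (ℕₚ.+-identityʳ j) j+n<p))
    vanish (suc n) j 0<j j+n<p = cong₂ ℤ._+_
      (χ-∤ p (∤-small j 0<j (ℕₚ.≤-<-trans (ℕₚ.m≤m+n j (suc n)) j+n<p)))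
      (trans (cong (act (geometricOp n) (χ p))
          (solve 1 (λ j → :- j :- con ℤ.1ℤ := :- (con ℤ.1ℤ :+ j)) refl (+ j)))
        (vanish n (suc j) ℕ.z<s (subst (ℕ._< p) (ℕₚ.+-suc j n) j+n<p)))
      where open ℤSolver.+-*-Solver
    at-0 : N ℤ.0ℤ ≡ ℤ.1ℤ
    at-0 = cong₂ ℤ._+_ (χ-∣ p (ℤ∣.divides ℤ.0ℤ refl)) (vanish m 1 ℕ.z<s ℕₚ.≤-refl)

  -- With `F` the Thue-Morse product, `D` = Fχ - pχ is invariant under T, because the product
  -- formula applies to (1 - T)χ. Its constant value c is read off by applying `N`: N D = p c, while
  -- N F χ = F N χ = F 1 = 0 and N(pχ) = p, so c = -1.
  S≡pχ-1 : Prime p → (∀ i → ¬ (p ℕ∣.∣ 2 ℕ.^ i)) →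
    (∀ i j → i ℕ.< j → j ℕ.< suc m → ∃[ b ] 2 ℕ.^ j ≡ 2 ℕ.^ i ℕ.+ b × ¬ (p ℕ∣.∣ b)) →
    ∀ i → S p i (2 ℕ.^ suc m) ≡ + p ℤ.* χ p i ℤ.- ℤ.1ℤ
  S≡pχ-1 p-prime p∤2^ separated i = begin
    S p i (2 ℕ.^ suc m)
      ≡⟨ trans (S≡∑ηχ p i (2 ℕ.^ suc m)) (sym (act-thueMorse≡∑η (suc m) (suc m) (χ p) i)) ⟩
    Fχ i
      ≡⟨ solve 2 (λ f x → f := x :+ (f :- x)) refl (Fχ i) (+ p ℤ.* χ p i) ⟩
    + p ℤ.* χ p i ℤ.+ D i
      ≡⟨ cong (λ t → + p ℤ.* χ p i ℤ.+ t) (trans (D-constant i) D0≡-1) ⟩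
    + p ℤ.* χ p i ℤ.- ℤ.1ℤ
      ∎
    where
    open ≡-Reasoning
    open ℤSolver.+-*-Solver using (solve; _:+_; _:*_; _:-_; _:=_; con)
    F N 1-T : Op
    F = thueMorse (suc m) (suc m)
    N = geometricOp (suc m)
    1-T = 𝟏 ⊕ ⊖ T
    Fχ D : ℤ → ℤ
    Fχ = act F (χ p)
    D z = Fχ z ℤ.- + p ℤ.* χ p z
    kernel : Kernel (suc m) (act 1-T (χ p))
    kernel z = trans (act-comm N 1-T (χ p) z) (trans
      (cong₂ ℤ._-_ (act-geometricOp-χ z) (act-geometricOp-χ (z ℤ.- ℤ.1ℤ))) refl)
    D-step : ∀ z → D z ≡ D (z ℤ.- ℤ.1ℤ)
    D-step z = begin
      Fχ z ℤ.- + p ℤ.* x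
        ≡⟨ solve 4 (λ f f′ p x → f :- p :* x := ((f :- f′) :+ f′) :- p :* x) refl (Fχ z) f′ (+ p) x ⟩
      (Fχ z ℤ.- f′ ℤ.+ f′) ℤ.- + p ℤ.* x
        ≡⟨ cong (λ t → (t ℤ.+ f′) ℤ.- + p ℤ.* x) (trans (sym (act-comm F 1-T (χ p) z))
             (act-thueMorse≡p (suc m) p-prime p∤2^ separated (act 1-T (χ p)) kernel z)) ⟩
      (+ p ℤ.* (x ℤ.- x′) ℤ.+ f′) ℤ.- + p ℤ.* x
        ≡⟨ solve 4 (λ f′ p x x′ → (p :* (x :- x′) :+ f′) :- p :* x := f′ :- p :* x′) refl f′ (+ p) x x′ ⟩
      f′ ℤ.- + p ℤ.* x′ ∎
      where
      f′ = Fχ (z ℤ.- ℤ.1ℤ)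
      x  = χ p z
      x′ = χ p (z ℤ.- ℤ.1ℤ)
    D-constant : ∀ z → D z ≡ D ℤ.0ℤ
    D-constant = step-invariant⇒constant D-step
    NFχ≡0 : act N Fχ ℤ.0ℤ ≡ ℤ.0ℤ
    NFχ≡0 = begin
      act N (act F (χ p)) ℤ.0ℤ      ≡⟨ act-comm N F (χ p) ℤ.0ℤ ⟩
      act F (act N (χ p)) ℤ.0ℤ      ≡⟨ act-cong F act-geometricOp-χ ℤ.0ℤ ⟩
      act F (λ _ → ℤ.1ℤ) ℤ.0ℤ       ≡⟨ act-thueMorse-const (suc m) m ℤ.1ℤ ℤ.0ℤ ⟩
      ℤ.0ℤ                          ∎
    D0≡-1 : D ℤ.0ℤ ≡ ℤ.-1ℤ
    D0≡-1 = ℤₚ.*-cancelˡ-≡ (+ p) (D ℤ.0ℤ) ℤ.-1ℤ (begin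
      + p ℤ.* D ℤ.0ℤ                                       ≡⟨ act-geometricOp-const (suc m) (D ℤ.0ℤ) ℤ.0ℤ ⟨
      act N (λ _ → D ℤ.0ℤ) ℤ.0ℤ                            ≡⟨ act-cong N D-constant ℤ.0ℤ ⟨
      act N D ℤ.0ℤ                                         ≡⟨ act-+ N Fχ (λ z → ℤ.- (+ p ℤ.* χ p z)) ℤ.0ℤ ⟩
      act N Fχ ℤ.0ℤ ℤ.+ act N (λ z → ℤ.- (+ p ℤ.* χ p z)) ℤ.0ℤ
        ≡⟨ cong₂ ℤ._+_ NFχ≡0 (act-neg N (λ z → + p ℤ.* χ p z) ℤ.0ℤ) ⟩
      ℤ.0ℤ ℤ.- act N (λ z → + p ℤ.* χ p z) ℤ.0ℤ
        ≡⟨ cong (λ t → ℤ.0ℤ ℤ.- t) (act-scale N (+ p) (χ p) ℤ.0ℤ) ⟩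
      ℤ.0ℤ ℤ.- + p ℤ.* act N (χ p) ℤ.0ℤ
        ≡⟨ cong (λ t → ℤ.0ℤ ℤ.- + p ℤ.* t) (act-geometricOp-χ ℤ.0ℤ) ⟩
      ℤ.0ℤ ℤ.- + p ℤ.* ℤ.1ℤ
        ≡⟨ solve 1 (λ p → con ℤ.0ℤ :- p :* con ℤ.1ℤ := p :* con ℤ.-1ℤ) refl (+ p) ⟩
      + p ℤ.* ℤ.-1ℤ                                        ∎)

-- Powers of 2 modulo p

oddPrime∤2^ : ∀ {p} → OddPrime p → ∀ i → ¬ (p ℕ∣.∣ 2 ℕ.^ i)
oddPrime∤2^ (p-prime , 2∤p) zero    p∣1 = ¬prime[1] (subst Prime (ℕ∣.∣1⇒≡1 p∣1) p-prime)
oddPrime∤2^ (p-prime , 2∤p) (suc i) p∣2^ with euclidsLemma 2 (2 ℕ.^ i) p-prime p∣2^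
... | inj₂ p∣2^i = oddPrime∤2^ (p-prime , 2∤p) i p∣2^i
... | inj₁ p∣2 with prime⇒irreducible prime[2] p∣2
...   | inj₁ refl = ¬prime[1] p-prime
...   | inj₂ refl = 2∤p ℕ∣.∣-refl

-- The difference is 2^i (2^d - 1) with d = j - i. If p divided 2^d - 1, minimality of the order
-- would give s ≤ d ≤ j < s.
powers-of-2-separated : ∀ {p s} → OddPrime p → IsOrderOf2 p s →
  ∀ i j → i ℕ.< j → j ℕ.< s → ∃[ b ] 2 ℕ.^ j ≡ 2 ℕ.^ i ℕ.+ b × ¬ (p ℕ∣.∣ b)
powers-of-2-separated {p} {s} p-odd@(p-prime , _) (_ , _ , least) i j i<j j<s =
  2 ℕ.^ i ℕ.* (2 ℕ.^ d ℕ.∸ 1) , 2^j≡ , p∤b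
  where
  open ≡-Reasoning
  d = j ℕ.∸ i
  2^j≡ : 2 ℕ.^ j ≡ 2 ℕ.^ i ℕ.+ 2 ℕ.^ i ℕ.* (2 ℕ.^ d ℕ.∸ 1)
  2^j≡ = begin
    2 ℕ.^ j                                      ≡⟨ cong (2 ℕ.^_) (ℕₚ.m+[n∸m]≡n (ℕₚ.<⇒≤ i<j)) ⟨
    2 ℕ.^ (i ℕ.+ d)                              ≡⟨ ℕₚ.^-distribˡ-+-* 2 i d ⟩
    2 ℕ.^ i ℕ.* 2 ℕ.^ d                          ≡⟨ cong (2 ℕ.^ i ℕ.*_) (ℕₚ.m+[n∸m]≡n (ℕₚ.m^n>0 2 d)) ⟨
    2 ℕ.^ i ℕ.* (1 ℕ.+ (2 ℕ.^ d ℕ.∸ 1))          ≡⟨ ℕₚ.*-suc (2 ℕ.^ i) _ ⟩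
    2 ℕ.^ i ℕ.+ 2 ℕ.^ i ℕ.* (2 ℕ.^ d ℕ.∸ 1)      ∎
  p∤b : ¬ (p ℕ∣.∣ 2 ℕ.^ i ℕ.* (2 ℕ.^ d ℕ.∸ 1))
  p∤b p∣b with euclidsLemma (2 ℕ.^ i) (2 ℕ.^ d ℕ.∸ 1) p-prime p∣b
  ... | inj₁ p∣2^i = oddPrime∤2^ p-odd i p∣2^i
  ... | inj₂ p∣2^d-1 = ℕₚ.<⇒≱ j<s (ℕₚ.≤-trans (least d (ℕₚ.m<n⇒0<n∸m i<j) p∣2^d-1) (ℕₚ.m∸n≤m j i))

S-primitive : ∀ {m} (let p = suc (suc m)) → OddPrime p → IsOrderOf2 p (suc m) →
  ∀ i → S p i (2 ℕ.^ suc m) ≡ + p ℤ.* χ p i ℤ.- ℤ.1ℤ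
S-primitive {m} p-odd@(p-prime , _) order =
  S≡pχ-1 m p-prime (oddPrime∤2^ p-odd) (powers-of-2-separated p-odd order)

open import Data.Rational.Base
open import Data.Rational.Properties
open import Data.Rational.Solver using (module +-*-Solver)
open import Defs
open +-*-Solver using (solve; _:+_; _:*_; _:-_; :-_; _:=_; con)

-- Real and complex numbers

-- Wrapped so that unification recovers x and y from x ∼ y, which it cannot do from the unfolded x ≈ y.
infix 4 _∼_ _∼ᶜ_

record _∼_ (x y : ℝ) : Set where
  constructor wrap
  field unwrap : x ≈ y

record _∼ᶜ_ (z w : ℂ) : Set where
  constructor wrapᶜ
  field unwrapᶜ : z ≈ᶜ w

open _∼_ public
open _∼ᶜ_ public

eventually-≡ : ∀ {x y} N → (∀ n → N ℕ.≤ n → seq x n ≡ seq y n) → x ∼ y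
eventually-≡ {x} {y} N x≡y = wrap λ ε 0<ε → N , λ n N≤n → subst (_≤ ε)
  (sym (trans (cong (λ t → ∣ t - seq y n ∣) (x≡y n N≤n)) (cong ∣_∣ (+-inverseʳ (seq y n))))) (<⇒≤ 0<ε)

pointwise : ∀ {x y} → seq x ≗ seq y → x ∼ y
pointwise x≗y = eventually-≡ 0 (λ n _ → x≗y n)

≈-scale : ∀ {x y} K → 0ℚ < K →
  (∀ ε → 0ℚ < ε → ∃[ N ] ∀ n → N ℕ.≤ n → ∣ seq x n - seq y n ∣ ≤ K * ε) → x ∼ y
≈-scale {x} {y} K 0<K H = wrap λ ε 0<ε →
  let N , P = H (ε * inv K) (0<* 0<ε (inv-pos 0<K)) in
  N , λ n N≤n → subst (∣ seq x n - seq y n ∣ ≤_) (K*[ε/K]≡ε ε) (P n N≤n)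
  where
  K*[ε/K]≡ε : ∀ ε → K * (ε * inv K) ≡ ε
  K*[ε/K]≡ε ε = trans (solve 3 (λ k e i → k :* (e :* i) := e :* (k :* i)) refl K ε (inv K))
    (trans (cong (ε *_) (inv-≢0 0<K)) (*-identityʳ ε))

∼-refl : ∀ {x} → x ∼ x
∼-refl = pointwise (λ _ → refl)

∼-sym : ∀ {x y} → x ∼ y → y ∼ x
∼-sym {x} {y} x∼y = wrap λ ε 0<ε →
  let N , P = unwrap x∼y ε 0<ε in
  N , λ n N≤n → subst (_≤ ε) (∣-∣-sym (seq x n) (seq y n)) (P n N≤n)

ε+ε≡2ε : ∀ ε → ε + ε ≡ (1ℚ + 1ℚ) * ε
ε+ε≡2ε = solve 1 (λ e → e :+ e := (con 1ℚ :+ con 1ℚ) :* e) refl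

0<1+1 : 0ℚ < 1ℚ + 1ℚ
0<1+1 = positive⁻¹ (1ℚ + 1ℚ)

∼-trans : ∀ {x y z} → x ∼ y → y ∼ z → x ∼ z
∼-trans {x} {y} {z} x∼y y∼z = ≈-scale (1ℚ + 1ℚ) 0<1+1 λ ε 0<ε →
  let N₁ , P = unwrap x∼y ε 0<ε ; N₂ , Q = unwrap y∼z ε 0<ε in
  N₁ ℕ.⊔ N₂ , λ n N≤n → begin
    ∣ seq x n - seq z n ∣                          ≤⟨ tri (seq x n) (seq y n) (seq z n) ⟩
    ∣ seq x n - seq y n ∣ + ∣ seq y n - seq z n ∣  ≤⟨ +-mono-≤ (P n (⊔⇒ˡ N₁ N₂ N≤n)) (Q n (⊔⇒ʳ N₁ N₂ N≤n)) ⟩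
    ε + ε                                          ≡⟨ ε+ε≡2ε ε ⟩
    (1ℚ + 1ℚ) * ε                                  ∎
  where open ≤-Reasoning

+ᵣ-cong : ∀ {x x′ y y′} → x ∼ x′ → y ∼ y′ → x +ᵣ y ∼ x′ +ᵣ y′
+ᵣ-cong {x} {x′} {y} {y′} x∼x′ y∼y′ = ≈-scale (1ℚ + 1ℚ) 0<1+1 λ ε 0<ε →
  let N₁ , P = unwrap x∼x′ ε 0<ε ; N₂ , Q = unwrap y∼y′ ε 0<ε in
  N₁ ℕ.⊔ N₂ , λ n N≤n → begin
    ∣ (seq x n + seq y n) - (seq x′ n + seq y′ n) ∣
      ≡⟨ cong ∣_∣ (solve 4 (λ a b c d → (a :+ b) :- (c :+ d) := (a :- c) :+ (b :- d)) refl
           (seq x n) (seq y n) (seq x′ n) (seq y′ n)) ⟩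
    ∣ (seq x n - seq x′ n) + (seq y n - seq y′ n) ∣   ≤⟨ ∣p+q∣≤∣p∣+∣q∣ (seq x n - seq x′ n) (seq y n - seq y′ n) ⟩
    ∣ seq x n - seq x′ n ∣ + ∣ seq y n - seq y′ n ∣   ≤⟨ +-mono-≤ (P n (⊔⇒ˡ N₁ N₂ N≤n)) (Q n (⊔⇒ʳ N₁ N₂ N≤n)) ⟩
    ε + ε                                             ≡⟨ ε+ε≡2ε ε ⟩
    (1ℚ + 1ℚ) * ε                                     ∎
  where open ≤-Reasoning

*ᵣ-cong : ∀ {x x′ y y′} → x ∼ x′ → y ∼ y′ → x *ᵣ y ∼ x′ *ᵣ y′
*ᵣ-cong {x} {x′} {y} {y′} x∼x′ y∼y′ =
  let A , 0<A , N₁ , ∣x∣≤A = bounded (cauchy x) ; B , 0<B , N₂ , ∣y′∣≤B = bounded (cauchy y′) in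
  ≈-scale (A + B) (+-mono-< 0<A 0<B) λ ε 0<ε →
    let N₃ , P = unwrap x∼x′ ε 0<ε ; N₄ , Q = unwrap y∼y′ ε 0<ε in
    (N₁ ℕ.⊔ N₂) ℕ.⊔ (N₃ ℕ.⊔ N₄) , λ n N≤n →
      let N₁₂≤n = ⊔⇒ˡ (N₁ ℕ.⊔ N₂) (N₃ ℕ.⊔ N₄) N≤n ; N₃₄≤n = ⊔⇒ʳ (N₁ ℕ.⊔ N₂) (N₃ ℕ.⊔ N₄) N≤n in
      *-diff (seq x n) (seq y n) (seq x′ n) (seq y′ n) (<⇒≤ 0<ε)
        (∣x∣≤A n (⊔⇒ˡ N₁ N₂ N₁₂≤n)) (∣y′∣≤B n (⊔⇒ʳ N₁ N₂ N₁₂≤n))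
        (Q n (⊔⇒ʳ N₃ N₄ N₃₄≤n)) (P n (⊔⇒ˡ N₃ N₄ N₃₄≤n))

-ᵣ-cong₂ : ∀ {x x′ y y′} → x ∼ x′ → y ∼ y′ → x -ᵣ y ∼ x′ -ᵣ y′
-ᵣ-cong₂ {x} {x′} {y} {y′} x∼x′ y∼y′ = ≈-scale (1ℚ + 1ℚ) 0<1+1 λ ε 0<ε →
  let N₁ , P = unwrap x∼x′ ε 0<ε ; N₂ , Q = unwrap (∼-sym y∼y′) ε 0<ε in
  N₁ ℕ.⊔ N₂ , λ n N≤n → begin
    ∣ (seq x n - seq y n) - (seq x′ n - seq y′ n) ∣
      ≡⟨ cong ∣_∣ (solve 4 (λ a b c d → (a :- b) :- (c :- d) := (a :- c) :+ (d :- b)) refl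
           (seq x n) (seq y n) (seq x′ n) (seq y′ n)) ⟩
    ∣ (seq x n - seq x′ n) + (seq y′ n - seq y n) ∣   ≤⟨ ∣p+q∣≤∣p∣+∣q∣ (seq x n - seq x′ n) (seq y′ n - seq y n) ⟩
    ∣ seq x n - seq x′ n ∣ + ∣ seq y′ n - seq y n ∣   ≤⟨ +-mono-≤ (P n (⊔⇒ˡ N₁ N₂ N≤n)) (Q n (⊔⇒ʳ N₁ N₂ N≤n)) ⟩
    ε + ε                                             ≡⟨ ε+ε≡2ε ε ⟩
    (1ℚ + 1ℚ) * ε                                     ∎
  where open ≤-Reasoning

pointwiseᶜ : ∀ {z w} → seq (re z) ≗ seq (re w) → seq (im z) ≗ seq (im w) → z ∼ᶜ w
pointwiseᶜ {z} {w} p q = wrapᶜ (unwrap (pointwise {re z} {re w} p) , unwrap (pointwise {im z} {im w} q))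

re-cong : ∀ {z w} → z ∼ᶜ w → re z ∼ re w
re-cong z∼w = wrap (proj₁ (unwrapᶜ z∼w))

im-cong : ∀ {z w} → z ∼ᶜ w → im z ∼ im w
im-cong z∼w = wrap (proj₂ (unwrapᶜ z∼w))

∼ᶜ-isEquivalence : IsEquivalence _∼ᶜ_
∼ᶜ-isEquivalence = record
  { refl  = pointwiseᶜ (λ _ → refl) (λ _ → refl)
  ; sym   = λ p → wrapᶜ (unwrap (∼-sym (re-cong p)) , unwrap (∼-sym (im-cong p)))
  ; trans = λ p q → wrapᶜ (unwrap (∼-trans (re-cong p) (re-cong q)) , unwrap (∼-trans (im-cong p) (im-cong q))) }

ℂ-setoid : Setoid 0ℓ 0ℓ
ℂ-setoid = record { isEquivalence = ∼ᶜ-isEquivalence }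

-- Abstract, since unfolding these operations makes conversion compare Cauchy moduli.
infixl 6 _⊞_
infixl 7 _⊠_

abstract
  _⊞_ _⊠_ : ℂ → ℂ → ℂ
  _⊞_ = _+ᶜ_
  _⊠_ = _*ᶜ_

  ⊞≡+ᶜ : _⊞_ ≡ _+ᶜ_
  ⊞≡+ᶜ = refl

  ⊠≡*ᶜ : _⊠_ ≡ _*ᶜ_
  ⊠≡*ᶜ = refl

  ⊞-cong : ∀ {z z′ w w′} → z ∼ᶜ z′ → w ∼ᶜ w′ → z ⊞ w ∼ᶜ z′ ⊞ w′
  ⊞-cong p q = wrapᶜ
    (unwrap (+ᵣ-cong (re-cong p) (re-cong q)) , unwrap (+ᵣ-cong (im-cong p) (im-cong q)))

  ⊞-assoc : ∀ z w u → (z ⊞ w) ⊞ u ∼ᶜ z ⊞ (w ⊞ u)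
  ⊞-assoc z w u = pointwiseᶜ
    (λ n → +-assoc (seq (re z) n) (seq (re w) n) (seq (re u) n))
    (λ n → +-assoc (seq (im z) n) (seq (im w) n) (seq (im u) n))

  ⊞-comm : ∀ z w → z ⊞ w ∼ᶜ w ⊞ z
  ⊞-comm z w = pointwiseᶜ (λ n → +-comm (seq (re z) n) (seq (re w) n)) (λ n → +-comm (seq (im z) n) (seq (im w) n))

  ⊞-identityˡ : ∀ z → 0ᶜ ⊞ z ∼ᶜ z
  ⊞-identityˡ z = pointwiseᶜ (λ n → +-identityˡ (seq (re z) n)) (λ n → +-identityˡ (seq (im z) n))

  ⊠-cong : ∀ {z z′ w w′} → z ∼ᶜ z′ → w ∼ᶜ w′ → z ⊠ w ∼ᶜ z′ ⊠ w′
  ⊠-cong p q = wrapᶜ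
    ( unwrap (-ᵣ-cong₂ (*ᵣ-cong (re-cong p) (re-cong q)) (*ᵣ-cong (im-cong p) (im-cong q)))
    , unwrap (+ᵣ-cong (*ᵣ-cong (re-cong p) (im-cong q)) (*ᵣ-cong (im-cong p) (re-cong q))))

  ⊠-assoc : ∀ z w u → (z ⊠ w) ⊠ u ∼ᶜ z ⊠ (w ⊠ u)
  ⊠-assoc z w u = pointwiseᶜ
    (λ n → solve 6 (λ a b c d e f → (a :* c :- b :* d) :* e :- (a :* d :+ b :* c) :* f :=
                                    a :* (c :* e :- d :* f) :- b :* (c :* f :+ d :* e)) refl
             (seq (re z) n) (seq (im z) n) (seq (re w) n) (seq (im w) n) (seq (re u) n) (seq (im u) n))
    (λ n → solve 6 (λ a b c d e f → (a :* c :- b :* d) :* f :+ (a :* d :+ b :* c) :* e :=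
                                    a :* (c :* f :+ d :* e) :+ b :* (c :* e :- d :* f)) refl
             (seq (re z) n) (seq (im z) n) (seq (re w) n) (seq (im w) n) (seq (re u) n) (seq (im u) n))

  ⊠-comm : ∀ z w → z ⊠ w ∼ᶜ w ⊠ z
  ⊠-comm z w = pointwiseᶜ
    (λ n → solve 4 (λ a b c d → a :* c :- b :* d := c :* a :- d :* b) refl
             (seq (re z) n) (seq (im z) n) (seq (re w) n) (seq (im w) n))
    (λ n → solve 4 (λ a b c d → a :* d :+ b :* c := c :* b :+ d :* a) refl
             (seq (re z) n) (seq (im z) n) (seq (re w) n) (seq (im w) n))

  ⊠-identityˡ : ∀ z → ℤ→ℂ (+ 1) ⊠ z ∼ᶜ z
  ⊠-identityˡ z = pointwiseᶜ
    (λ n → solve 2 (λ a b → con 1ℚ :* a :- con 0ℚ :* b := a) refl (seq (re z) n) (seq (im z) n))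
    (λ n → solve 2 (λ a b → con 1ℚ :* b :+ con 0ℚ :* a := b) refl (seq (re z) n) (seq (im z) n))

  ⊠-distribˡ-⊞ : ∀ z w u → z ⊠ (w ⊞ u) ∼ᶜ z ⊠ w ⊞ z ⊠ u
  ⊠-distribˡ-⊞ z w u = pointwiseᶜ
    (λ n → solve 6 (λ a b c d e f → a :* (c :+ e) :- b :* (d :+ f) :=
                                    (a :* c :- b :* d) :+ (a :* e :- b :* f)) refl
             (seq (re z) n) (seq (im z) n) (seq (re w) n) (seq (im w) n) (seq (re u) n) (seq (im u) n))
    (λ n → solve 6 (λ a b c d e f → a :* (d :+ f) :+ b :* (c :+ e) :=
                                    (a :* d :+ b :* c) :+ (a :* f :+ b :* e)) refl
             (seq (re z) n) (seq (im z) n) (seq (re w) n) (seq (im w) n) (seq (re u) n) (seq (im u) n))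

  ℤ→ℂ-suc-⊠ : ∀ n z → ℤ→ℂ (+ suc n) ⊠ z ∼ᶜ z ⊞ ℤ→ℂ (+ n) ⊠ z
  ℤ→ℂ-suc-⊠ n z = pointwiseᶜ
    (λ k → trans (cong (λ t → t * seq (re z) k - 0ℚ * seq (im z) k) (fromℕ-+ 1 n))
      (solve 3 (λ n a b → (con 1ℚ :+ n) :* a :- con 0ℚ :* b := a :+ (n :* a :- con 0ℚ :* b)) refl
        (fromℕ n) (seq (re z) k) (seq (im z) k)))
    (λ k → trans (cong (λ t → t * seq (im z) k + 0ℚ * seq (re z) k) (fromℕ-+ 1 n))
      (solve 3 (λ n a b → (con 1ℚ :+ n) :* b :+ con 0ℚ :* a := b :+ (n :* b :+ con 0ℚ :* a)) refl
        (fromℕ n) (seq (re z) k) (seq (im z) k)))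

  -1⊠z⊞z∼0 : ∀ z → ℤ→ℂ ℤ.-1ℤ ⊠ z ⊞ z ∼ᶜ 0ᶜ
  -1⊠z⊞z∼0 z = pointwiseᶜ
    (λ n → solve 2 (λ a b → con (- 1ℚ) :* a :- con 0ℚ :* b :+ a := con 0ℚ) refl (seq (re z) n) (seq (im z) n))
    (λ n → solve 2 (λ a b → con (- 1ℚ) :* b :+ con 0ℚ :* a :+ b := con 0ℚ) refl (seq (re z) n) (seq (im z) n))

  1⊞-1∼0 : ℤ→ℂ (+ 1) ⊞ ℤ→ℂ ℤ.-1ℤ ∼ᶜ 0ᶜ
  1⊞-1∼0 = pointwiseᶜ (λ _ → refl) (λ _ → refl)

-- Negation is multiplication by -1, so that `-1⊠z⊞z∼0` serves both as the inverse law and as the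
-- cancellation of the off-diagonal entries of the matrix.
⊟_ : ℂ → ℂ
⊟ z = ℤ→ℂ ℤ.-1ℤ ⊠ z

ℂ-commutativeRing : CommutativeRing 0ℓ 0ℓ
ℂ-commutativeRing = record
  { Carrier = ℂ ; _≈_ = _∼ᶜ_ ; _+_ = _⊞_ ; _*_ = _⊠_ ; -_ = ⊟_ ; 0# = 0ᶜ ; 1# = ℤ→ℂ (+ 1)
  ; isCommutativeRing = record
    { isRing = record
      { +-isAbelianGroup = record
        { isGroup = record
          { isMonoid = record
            { isSemigroup = record
              { isMagma = record { isEquivalence = ∼ᶜ-isEquivalence ; ∙-cong = ⊞-cong }
              ; assoc = ⊞-assoc }
            ; identity = comm∧idˡ⇒id ⊞-comm ⊞-identityˡ }
          ; inverse = comm∧invˡ⇒inv ⊞-comm -1⊠z⊞z∼0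
          ; ⁻¹-cong = ⊠-cong (IsEquivalence.refl ∼ᶜ-isEquivalence) }
        ; comm = ⊞-comm }
      ; *-cong = ⊠-cong
      ; *-assoc = ⊠-assoc
      ; *-identity = comm∧idˡ⇒id ⊠-comm ⊠-identityˡ
      ; distrib = comm∧distrˡ⇒distr ⊞-cong ⊠-comm ⊠-distribˡ-⊞ }
    ; *-comm = ⊠-comm } }
  where
  open import Algebra.Consequences.Setoid ℂ-setoid

module ℂᶜ = CommutativeRing ℂ-commutativeRing

abstract
  -- The squared modulus. Its multiplicativity is the Brahmagupta-Fibonacci identity, so moduli are
  -- compared through their squares.
  norm : ℂ → ℝ
  norm z = re z *ᵣ re z +ᵣ im z *ᵣ im z

  norm-def : ∀ z → norm z ∼ re z *ᵣ re z +ᵣ im z *ᵣ im z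
  norm-def z = pointwise (λ _ → refl)

  norm-⊠ : ∀ z w → norm (z ⊠ w) ∼ norm z *ᵣ norm w
  norm-⊠ z w = pointwise λ n →
    solve 4 (λ a b c d → (a :* c :- b :* d) :* (a :* c :- b :* d) :+ (a :* d :+ b :* c) :* (a :* d :+ b :* c) :=
                         (a :* a :+ b :* b) :* (c :* c :+ d :* d)) refl
      (seq (re z) n) (seq (im z) n) (seq (re w) n) (seq (im w) n)

norm-cong : ∀ {z w} → z ∼ᶜ w → norm z ∼ norm w
norm-cong {z} {w} p =
  let re² = *ᵣ-cong (re-cong p) (re-cong p)
      im² = *ᵣ-cong (im-cong p) (im-cong p)
      sum = +ᵣ-cong re² im²
  in ∼-trans (norm-def z) (∼-trans sum (∼-sym (norm-def w)))

IsModulus⇒r²∼norm : ∀ {z r} → IsModulus z r → r *ᵣ r ∼ norm z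
IsModulus⇒r²∼norm {z} (_ , r²≈) = ∼-trans (wrap r²≈) (∼-sym (norm-def z))

IsModulus-ℤ→ℂ : ∀ k → 0ℚ ≤ k / 1 → IsModulus (ℤ→ℂ k) (ι (k / 1))
IsModulus-ℤ→ℂ k 0≤k = 0≤ᵣ , unwrap (q²∼q²+0² (k / 1))
  where
  q²∼q²+0² : ∀ q → ι q *ᵣ ι q ∼ ι q *ᵣ ι q +ᵣ ι 0ℚ *ᵣ ι 0ℚ
  q²∼q²+0² q = pointwise λ _ → solve 1 (λ q → q :* q := q :* q :+ con 0ℚ :* con 0ℚ) refl q
  0≤ᵣ : ι 0ℚ ≤ᵣ ι (k / 1)
  0≤ᵣ (δ , 0<δ , N , P) = <-irrefl refl (<-≤-trans (<-≤-trans 0<δ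
    (subst (_≤ k / 1 + δ) (+-identityˡ δ) (+-monoˡ-≤ δ 0≤k))) (P N ℕₚ.≤-refl))

0≤p² : ∀ p → 0ℚ ≤ p * p
0≤p² p with ≤-total 0ℚ p
... | inj₁ 0≤p = 0≤* 0≤p 0≤p
... | inj₂ p≤0 = subst (0ℚ ≤_) (solve 1 (λ p → :- p :* :- p := p :* p) refl p)
                   (0≤* (neg-antimono-≤ p≤0) (neg-antimono-≤ p≤0))

-- Eventually x - w ≥ δ, so |y| ≤ |xy - wy| / δ. The rational gap δ inside `_<ᵣ_` is what makes the
-- division constructive.
<ᵣ-cancel : ∀ {w x y} → w <ᵣ x → x *ᵣ y ∼ w *ᵣ y → y ∼ ι 0ℚ
<ᵣ-cancel {w} {x} {y} (δ , 0<δ , N₁ , P) xy∼wy = ≈-scale (inv δ) (inv-pos 0<δ) λ ε 0<ε →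
  let N₂ , Q = unwrap xy∼wy ε 0<ε in
  N₁ ℕ.⊔ N₂ , λ n N≤n → bound (seq w n) (seq x n) (seq y n) ε (P n (⊔⇒ˡ N₁ N₂ N≤n)) (Q n (⊔⇒ʳ N₁ N₂ N≤n))
  where
  open ≤-Reasoning
  bound : ∀ w x y ε → w + δ ≤ x → ∣ x * y - w * y ∣ ≤ ε → ∣ y - 0ℚ ∣ ≤ inv δ * ε
  bound w x y ε w+δ≤x ∣xy-wy∣≤ε = begin
    ∣ y - 0ℚ ∣                    ≡⟨ cong ∣_∣ (+-identityʳ y) ⟩
    ∣ y ∣                         ≡⟨ *-identityʳ ∣ y ∣ ⟨
    ∣ y ∣ * 1ℚ                    ≡⟨ cong (∣ y ∣ *_) (inv-≢0 0<δ) ⟨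
    ∣ y ∣ * (δ * inv δ)           ≡⟨ solve 3 (λ y d i → y :* (d :* i) := i :* (d :* y)) refl ∣ y ∣ δ (inv δ) ⟩
    inv δ * (δ * ∣ y ∣)           ≤⟨ *-monoˡ-≤-nonNeg (inv δ) {{nonNegative (<⇒≤ (inv-pos 0<δ))}} (begin
      δ * ∣ y ∣                     ≤⟨ *-monoʳ-≤-nonNeg ∣ y ∣ {{∣-∣-nonNeg y}} δ≤∣x-w∣ ⟩
      ∣ x - w ∣ * ∣ y ∣             ≡⟨ ∣p*q∣≡∣p∣*∣q∣ (x - w) y ⟨
      ∣ (x - w) * y ∣               ≡⟨ cong ∣_∣ (solve 3 (λ x w y → (x :- w) :* y := x :* y :- w :* y) refl x w y) ⟩
      ∣ x * y - w * y ∣             ≤⟨ ∣xy-wy∣≤ε ⟩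
      ε                             ∎) ⟩
    inv δ * ε                     ∎
    where
    δ≤x-w : δ ≤ x - w
    δ≤x-w = subst (_≤ x - w) (solve 2 (λ w d → (w :+ d) :- w := d) refl w δ) (+-monoˡ-≤ (- w) w+δ≤x)
    δ≤∣x-w∣ : δ ≤ ∣ x - w ∣
    δ≤∣x-w∣ = ≤-trans δ≤x-w (≤-reflexive (sym (0≤p⇒∣p∣≡p (≤-trans (<⇒≤ 0<δ) δ≤x-w))))

<ᵣ-square : ∀ {q r} → 0ℚ ≤ q → ι q <ᵣ r → ι q *ᵣ ι q <ᵣ r *ᵣ r
<ᵣ-square {q} {r} 0≤q (δ , 0<δ , N , P) = δ * δ , 0<* 0<δ 0<δ , N , λ n N≤n → bound (seq r n) (P n N≤n)
  where
  open ≤-Reasoning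
  0≤δ : 0ℚ ≤ δ
  0≤δ = <⇒≤ 0<δ
  bound : ∀ r → q + δ ≤ r → q * q + δ * δ ≤ r * r
  bound r q+δ≤r = begin
    q * q + δ * δ                         ≡⟨ +-identityʳ _ ⟨
    q * q + δ * δ + 0ℚ                    ≤⟨ +-monoʳ-≤ (q * q + δ * δ) (0≤+ (0≤* 0≤q 0≤δ) (0≤* 0≤q 0≤δ)) ⟩
    q * q + δ * δ + (q * δ + q * δ)       ≡⟨ solve 2 (λ q d → q :* q :+ d :* d :+ (q :* d :+ q :* d) :=
                                               (q :+ d) :* (q :+ d)) refl q δ ⟩
    (q + δ) * (q + δ)                     ≤⟨ 0≤*-mono-≤ (0≤+ 0≤q 0≤δ) (≤-trans (0≤+ 0≤q 0≤δ) q+δ≤r) q+δ≤r q+δ≤r ⟩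
    r * r                                 ∎

∣p∣*∣p∣≡p*p : ∀ p → ∣ p ∣ * ∣ p ∣ ≡ p * p
∣p∣*∣p∣≡p*p p = trans (sym (∣p*q∣≡∣p∣*∣q∣ p p)) (0≤p⇒∣p∣≡p (0≤p² p))

p²+q²≤ε²⇒∣p∣≤ε : ∀ {ε} p q → 0ℚ < ε → ∣ p * p + q * q ∣ ≤ ε * ε → ∣ p ∣ ≤ ε
p²+q²≤ε²⇒∣p∣≤ε {ε} p q 0<ε H = ≮⇒≥ λ ε<∣p∣ → <-irrefl refl (begin-strict
  ε * ε               <⟨ *-monoʳ-<-pos ε {{positive 0<ε}} ε<∣p∣ ⟩
  ε * ∣ p ∣           ≤⟨ *-monoʳ-≤-nonNeg ∣ p ∣ {{∣-∣-nonNeg p}} (<⇒≤ ε<∣p∣) ⟩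
  ∣ p ∣ * ∣ p ∣       ≡⟨ ∣p∣*∣p∣≡p*p p ⟩
  p * p               ≡⟨ +-identityʳ (p * p) ⟨
  p * p + 0ℚ          ≤⟨ +-monoʳ-≤ (p * p) (0≤p² q) ⟩
  p * p + q * q       ≡⟨ 0≤p⇒∣p∣≡p (0≤+ (0≤p² p) (0≤p² q)) ⟨
  ∣ p * p + q * q ∣   ≤⟨ H ⟩
  ε * ε               ∎)
  where open ≤-Reasoning

0∼0*0* : ∀ x → ι 0ℚ ∼ ι 0ℚ *ᵣ ι 0ℚ *ᵣ x
0∼0*0* x = pointwise λ n → solve 1 (λ x → con 0ℚ := con 0ℚ :* con 0ℚ :* x) refl (seq x n)

norm∼0⇒∼0 : ∀ {z} → norm z ∼ ι 0ℚ → z ∼ᶜ 0ᶜ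
norm∼0⇒∼0 {z} norm∼0 = wrapᶜ (re≈0 , im≈0)
  where
  ∣0-q∣ : ∀ q → ∣ q - 0ℚ ∣ ≡ ∣ q ∣
  ∣0-q∣ q = cong ∣_∣ (+-identityʳ q)
  bound : ∀ ε → 0ℚ < ε → ∃[ N ] ∀ n → N ℕ.≤ n →
    ∣ seq (re z) n * seq (re z) n + seq (im z) n * seq (im z) n ∣ ≤ ε * ε
  bound ε 0<ε =
    let N , P = unwrap (∼-trans (∼-sym (norm-def z)) norm∼0) (ε * ε) (0<* 0<ε 0<ε) in
    N , λ n N≤n → ≤-trans (≤-reflexive (sym (∣0-q∣ _))) (P n N≤n)
  re≈0 : re z ≈ ι 0ℚ
  re≈0 ε 0<ε = let N , P = bound ε 0<ε in
    N , λ n N≤n → ≤-trans (≤-reflexive (∣0-q∣ (seq (re z) n)))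
      (p²+q²≤ε²⇒∣p∣≤ε (seq (re z) n) (seq (im z) n) 0<ε (P n N≤n))
  im≈0 : im z ≈ ι 0ℚ
  im≈0 ε 0<ε = let N , P = bound ε 0<ε in
    N , λ n N≤n → ≤-trans (≤-reflexive (∣0-q∣ (seq (im z) n)))
      (p²+q²≤ε²⇒∣p∣≤ε (seq (im z) n) (seq (re z) n) 0<ε
        (≤-trans (≤-reflexive (cong ∣_∣ (+-comm (seq (im z) n * seq (im z) n) _))) (P n N≤n)))

-- Finite complex sums and the eigenvalues of pI - J

open import Algebra.Properties.CommutativeMonoid.Sum ℂᶜ.+-commutativeMonoid
  using (∑-distrib-+; sum-cong-≋; sum-replicate-zero; sum-remove)
open import Algebra.Properties.Semiring.Sum ℂᶜ.semiring using (*-distribˡ-sum)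

∑ᶜ : ∀ {n} → (Fin n → ℂ) → ℂ
∑ᶜ = Vec.foldr _⊞_ 0ᶜ

∑ᶜ-zero : ∀ {n} (t : Fin n → ℂ) → (∀ j → t j ∼ᶜ 0ᶜ) → ∑ᶜ t ∼ᶜ 0ᶜ
∑ᶜ-zero {n} t t∼0 = ℂᶜ.trans (sum-cong-≋ t∼0) (sum-replicate-zero n)

∑ᶜ-single : ∀ {n} i (t : Fin n → ℂ) → (∀ j → j ≢ i → t j ∼ᶜ 0ᶜ) → ∑ᶜ t ∼ᶜ t i
∑ᶜ-single {suc n} i t t∼0 = ℂᶜ.trans (sum-remove {n} {i} t)
  (ℂᶜ.trans (ℂᶜ.+-congˡ (∑ᶜ-zero (Vec.removeAt t i) (λ j → t∼0 (punchIn i j) (Finₚ.punchInᵢ≢i i j))))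
    (ℂᶜ.+-identityʳ (t i)))

∑ᶜ-const : ∀ n z → ∑ᶜ {n} (λ _ → z) ∼ᶜ ℤ→ℂ (+ n) ⊠ z
∑ᶜ-const zero    z = ℂᶜ.sym (ℂᶜ.zeroˡ z)
∑ᶜ-const (suc n) z = ℂᶜ.trans (ℂᶜ.+-congˡ (∑ᶜ-const n z)) (ℂᶜ.sym (ℤ→ℂ-suc-⊠ n z))

module pI-J {m : ℕ} (A : Matrix ℤ (suc (suc m)))
  (diagonal : ∀ i → A i i ≡ + suc m) (off-diagonal : ∀ i j → j ≢ i → A i j ≡ ℤ.-1ℤ) where

  open import Relation.Binary.Reasoning.Setoid ℂᶜ.setoid

  mulVec : (Fin (suc (suc m)) → ℂ) → Fin (suc (suc m)) → ℂ
  mulVec v i = ∑ᶜ (λ j → ℤ→ℂ (A i j) ⊠ v j)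

  -- Adding the sum of `v` term by term cancels every entry -1 and raises the diagonal entry p - 1
  -- to p.
  mulVec+∑∼p* : ∀ v i → mulVec v i ⊞ ∑ᶜ v ∼ᶜ ℤ→ℂ (+ suc (suc m)) ⊠ v i
  mulVec+∑∼p* v i = begin
    mulVec v i ⊞ ∑ᶜ v                       ≈⟨ ∑-distrib-+ (λ j → ℤ→ℂ (A i j) ⊠ v j) v ⟨
    ∑ᶜ (λ j → ℤ→ℂ (A i j) ⊠ v j ⊞ v j)     ≈⟨ ∑ᶜ-single i (λ j → ℤ→ℂ (A i j) ⊠ v j ⊞ v j) off ⟩
    ℤ→ℂ (A i i) ⊠ v i ⊞ v i                ≡⟨ cong (λ a → ℤ→ℂ a ⊠ v i ⊞ v i) (diagonal i) ⟩
    ℤ→ℂ (+ suc m) ⊠ v i ⊞ v i              ≈⟨ ℂᶜ.+-comm (ℤ→ℂ (+ suc m) ⊠ v i) (v i) ⟩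
    v i ⊞ ℤ→ℂ (+ suc m) ⊠ v i              ≈⟨ ℤ→ℂ-suc-⊠ (suc m) (v i) ⟨
    ℤ→ℂ (+ suc (suc m)) ⊠ v i                                ∎
    where
    off : ∀ j → j ≢ i → ℤ→ℂ (A i j) ⊠ v j ⊞ v j ∼ᶜ 0ᶜ
    off j j≢i = subst (λ a → ℤ→ℂ a ⊠ v j ⊞ v j ∼ᶜ 0ᶜ) (sym (off-diagonal i j j≢i)) (-1⊠z⊞z∼0 (v j))

  -- The two operations are arguments so that an eigenvector equation can be transported, in both
  -- directions, between the abstract operations and those in `IsEigenvalue`.
  IsEigenvector : ℂ → (Fin (suc (suc m)) → ℂ) → (ℂ → ℂ → ℂ) → (ℂ → ℂ → ℂ) → Set
  IsEigenvector z v _+′_ _*′_ = ∀ i → Vec.foldr _+′_ 0ᶜ (λ j → ℤ→ℂ (A i j) *′ v j) ≈ᶜ z *′ v i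

  eigenvalue-p : IsEigenvalue A (ℤ→ℂ (+ suc (suc m)))
  eigenvalue-p = v , v≉0 ,
    subst₂ (IsEigenvector (ℤ→ℂ (+ suc (suc m))) v) ⊞≡+ᶜ ⊠≡*ᶜ (λ i → unwrapᶜ (Av∼pv i))
    where
    v : Fin (suc (suc m)) → ℂ
    -- A nonzero vector with zero sum, hence killed by J.
    v zero          = ℤ→ℂ (+ 1)
    v (suc zero)    = ℤ→ℂ ℤ.-1ℤ
    v (suc (suc _)) = 0ᶜ
    v≉0 : ¬ (∀ i → v i ≈ᶜ 0ᶜ)
    v≉0 v≈0 with proj₁ (v≈0 zero) ½ (positive⁻¹ ½)
    ... | N , P = contradiction (≤⇒≤ᵇ (P N ℕₚ.≤-refl)) λ ()
    ∑v∼0 : ∑ᶜ v ∼ᶜ 0ᶜ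
    ∑v∼0 = begin
      ℤ→ℂ (+ 1) ⊞ (ℤ→ℂ ℤ.-1ℤ ⊞ ∑ᶜ {m} (λ _ → 0ᶜ))
        ≈⟨ ℂᶜ.+-congˡ (ℂᶜ.trans (ℂᶜ.+-congˡ (sum-replicate-zero m)) (ℂᶜ.+-identityʳ (ℤ→ℂ ℤ.-1ℤ))) ⟩
      ℤ→ℂ (+ 1) ⊞ ℤ→ℂ ℤ.-1ℤ    ≈⟨ 1⊞-1∼0 ⟩
      0ᶜ                        ∎
    Av∼pv : ∀ i → mulVec v i ∼ᶜ ℤ→ℂ (+ suc (suc m)) ⊠ v i
    Av∼pv i = begin
      mulVec v i               ≈⟨ ℂᶜ.+-identityʳ (mulVec v i) ⟨
      mulVec v i ⊞ 0ᶜ          ≈⟨ ℂᶜ.+-congˡ ∑v∼0 ⟨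
      mulVec v i ⊞ ∑ᶜ v        ≈⟨ mulVec+∑∼p* v i ⟩
      ℤ→ℂ (+ suc (suc m)) ⊠ v i                 ∎

  -- If A v = z v, then u = z v = p v - ∑ v has zero sum, hence z u = A u = p u.
  eigenvector-scaled : ∀ {z v} → (∀ i → mulVec v i ∼ᶜ z ⊠ v i) →
    ∀ i → z ⊠ (z ⊠ v i) ∼ᶜ ℤ→ℂ (+ suc (suc m)) ⊠ (z ⊠ v i)
  eigenvector-scaled {z} {v} Av∼zv i = begin
    z ⊠ u i                    ≈⟨ ℂᶜ.+-identityʳ (z ⊠ u i) ⟨
    z ⊠ u i ⊞ 0ᶜ              ≈⟨ ℂᶜ.+-congˡ (ℂᶜ.trans (*-distribˡ-sum z v) ∑u∼0) ⟨
    z ⊠ u i ⊞ z ⊠ ∑ᶜ v       ≈⟨ ℂᶜ.distribˡ z (u i) (∑ᶜ v) ⟨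
    z ⊠ (u i ⊞ ∑ᶜ v)          ≈⟨ ℂᶜ.*-congˡ (u+∑v∼pv i) ⟩
    z ⊠ (ℤ→ℂ (+ suc (suc m)) ⊠ v i)            ≈⟨ x∙yz≈y∙xz z (ℤ→ℂ (+ suc (suc m))) (v i) ⟩
    ℤ→ℂ (+ suc (suc m)) ⊠ (z ⊠ v i)            ∎
    where
    open import Algebra.Properties.CommutativeSemigroup ℂᶜ.*-commutativeSemigroup using (x∙yz≈y∙xz)
    open import Algebra.Properties.AbelianGroup ℂᶜ.+-abelianGroup using (identityˡ-unique)
    u : Fin (suc (suc m)) → ℂ
    u i = z ⊠ v i
    u+∑v∼pv : ∀ i → u i ⊞ ∑ᶜ v ∼ᶜ ℤ→ℂ (+ suc (suc m)) ⊠ v i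
    u+∑v∼pv i = ℂᶜ.trans (ℂᶜ.+-congʳ (ℂᶜ.sym (Av∼zv i))) (mulVec+∑∼p* v i)
    ∑u∼0 : ∑ᶜ u ∼ᶜ 0ᶜ
    ∑u∼0 = identityˡ-unique (∑ᶜ u) (ℤ→ℂ (+ suc (suc m)) ⊠ ∑ᶜ v) (begin
      ∑ᶜ u ⊞ ℤ→ℂ (+ suc (suc m)) ⊠ ∑ᶜ v                ≈⟨ ℂᶜ.+-congˡ (∑ᶜ-const (suc (suc m)) (∑ᶜ v)) ⟨
      ∑ᶜ u ⊞ ∑ᶜ {suc (suc m)} (λ _ → ∑ᶜ v)       ≈⟨ ∑-distrib-+ u (λ _ → ∑ᶜ v) ⟨
      ∑ᶜ (λ i → u i ⊞ ∑ᶜ v)            ≈⟨ sum-cong-≋ u+∑v∼pv ⟩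
      ∑ᶜ (λ i → ℤ→ℂ (+ suc (suc m)) ⊠ v i)              ≈⟨ *-distribˡ-sum (ℤ→ℂ (+ suc (suc m))) v ⟨
      ℤ→ℂ (+ suc (suc m)) ⊠ ∑ᶜ v                        ∎)

  -- Suppose r > q, where q = |p|. For u = z v, `eigenvector-scaled` gives r²|u|² = q²|u|², hence u
  -- = 0; then r²|v|² = |u|² = 0 with r > 0 gives v = 0, a contradiction. This way nothing has to
  -- decide whether z is 0 or p.
  modulus≤ : ∀ {q} → 0ℚ ≤ q → norm (ℤ→ℂ (+ suc (suc m))) ∼ ι q *ᵣ ι q →
    ∀ z r → IsEigenvalue A z → IsModulus z r → r ≤ᵣ ι q
  modulus≤ {q} 0≤q norm-p z r (v , v≉0 , Av≈zv) |z|=r q<r@(δ , 0<δ , N , P) = v≉0 λ i → unwrapᶜ (norm∼0⇒∼0 (norm-v∼0 i))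
    where
    u : Fin (suc (suc m)) → ℂ
    u i = z ⊠ v i
    Av∼zv : ∀ i → mulVec v i ∼ᶜ z ⊠ v i
    Av∼zv i = wrapᶜ (subst₂ (IsEigenvector z v) (sym ⊞≡+ᶜ) (sym ⊠≡*ᶜ) Av≈zv i)
    r²*norm : ∀ w → r *ᵣ r *ᵣ norm w ∼ norm (z ⊠ w)
    r²*norm w = ∼-trans (*ᵣ-cong {r *ᵣ r} {norm z} {norm w} {norm w} (IsModulus⇒r²∼norm |z|=r) ∼-refl) (∼-sym (norm-⊠ z w))
    r²u²∼p²u² : ∀ i → r *ᵣ r *ᵣ norm (u i) ∼ ι q *ᵣ ι q *ᵣ norm (u i)
    r²u²∼p²u² i = ∼-trans (r²*norm (u i)) (∼-trans (norm-cong (eigenvector-scaled Av∼zv i))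
      (∼-trans (norm-⊠ (ℤ→ℂ (+ suc (suc m))) (u i)) (*ᵣ-cong {norm (ℤ→ℂ (+ suc (suc m)))} {ι q *ᵣ ι q} {norm (u i)} {norm (u i)} norm-p ∼-refl)))
    norm-u∼0 : ∀ i → norm (u i) ∼ ι 0ℚ
    norm-u∼0 i = <ᵣ-cancel {ι q *ᵣ ι q} {r *ᵣ r} {norm (u i)} (<ᵣ-square {q} {r} 0≤q q<r) (r²u²∼p²u² i)
    0<r : ι 0ℚ <ᵣ r
    0<r = δ , 0<δ , N , λ n N≤n → ≤-trans (+-monoˡ-≤ δ 0≤q) (P n N≤n)
    norm-v∼0 : ∀ i → norm (v i) ∼ ι 0ℚ
    norm-v∼0 i = <ᵣ-cancel {ι 0ℚ *ᵣ ι 0ℚ} {r *ᵣ r} {norm (v i)} (<ᵣ-square {0ℚ} {r} ≤-refl 0<r) (∼-trans (r²*norm (v i)) (∼-trans (norm-u∼0 i) (0∼0*0* (norm (v i)))))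

  largest : ∀ {q} → 0ℚ ≤ q → IsModulus (ℤ→ℂ (+ suc (suc m))) (ι q) → IsLargestEigenvalueModulus A (ι q)
  largest 0≤q |p|=q = (ℤ→ℂ (+ suc (suc m)) , eigenvalue-p , |p|=q) , modulus≤ 0≤q (∼-sym (IsModulus⇒r²∼norm |p|=q))

toℕ-distinct-mod : ∀ {p} {i j : Fin p} → j ≢ i → ¬ (+ p ℤ∣.∣ + toℕ i ℤ.- + toℕ j)
toℕ-distinct-mod {p} {i} {j} j≢i p∣i-j =
  ℕ∣.>⇒∤ {{ℕ.≢-nonZero i-j≢0}} ∣i-j∣<p (ℤ∣.∣⇒∣ᵤ p∣i-j)
  where
  i-j≢0 : ℤ.∣ + toℕ i ℤ.- + toℕ j ∣ ≢ 0
  i-j≢0 ∣i-j∣≡0 = j≢i (sym (Finₚ.toℕ-injective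
    (ℤₚ.+-injective (ℤₚ.i-j≡0⇒i≡j (+ toℕ i) (+ toℕ j) (ℤₚ.∣i∣≡0⇒i≡0 ∣i-j∣≡0)))))
  ∣i-j∣<p : ℤ.∣ + toℕ i ℤ.- + toℕ j ∣ ℕ.< p
  ∣i-j∣<p = ℕₚ.≤-<-trans
    (ℕₚ.≤-trans (ℕₚ.≤-reflexive (cong ℤ.∣_∣ (ℤₚ.m-n≡m⊖n (toℕ i) (toℕ j)))) (ℤₚ.∣m⊝n∣≤m⊔n (toℕ i) (toℕ j)))
    (ℕₚ.⊔-lub (Finₚ.toℕ<n i) (Finₚ.toℕ<n j))

0≤n/1 : ∀ n → 0ℚ ≤ + n / 1
0≤n/1 n = 0≤fromℕ n

largest-eigenvalue-modulus : ∀ {m} (let p = suc (suc m)) → P₁ p →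
  IsLargestEigenvalueModulus (M p (suc m)) (ι (+ p / 1))
largest-eigenvalue-modulus {m} (p-odd , order) =
  pI-J.largest (M (suc (suc m)) (suc m)) diagonal off-diagonal {+ suc (suc m) / 1} (0≤n/1 (suc (suc m)))
    (IsModulus-ℤ→ℂ (+ suc (suc m)) (0≤n/1 (suc (suc m))))
  where
  p = suc (suc m)
  open ≡-Reasoning
  diagonal : ∀ i → M p (suc m) i i ≡ + suc m
  diagonal i = begin
    S p (+ toℕ i ℤ.- + toℕ i) (2 ℕ.^ suc m)   ≡⟨ S-primitive p-odd order (+ toℕ i ℤ.- + toℕ i) ⟩
    + p ℤ.* χ p (+ toℕ i ℤ.- + toℕ i) ℤ.- ℤ.1ℤ
      ≡⟨ cong (λ x → + p ℤ.* x ℤ.- ℤ.1ℤ) (χ-∣ p (subst (+ p ℤ∣.∣_) (sym (ℤₚ.+-inverseʳ (+ toℕ i))) (ℤ∣.divides ℤ.0ℤ refl))) ⟩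
    + p ℤ.* ℤ.1ℤ ℤ.- ℤ.1ℤ                     ≡⟨ cong (ℤ._- ℤ.1ℤ) (ℤₚ.*-identityʳ (+ p)) ⟩
    + suc m                                   ∎
  off-diagonal : ∀ i j → j ≢ i → M p (suc m) i j ≡ ℤ.-1ℤ
  off-diagonal i j j≢i = begin
    S p (+ toℕ i ℤ.- + toℕ j) (2 ℕ.^ suc m)   ≡⟨ S-primitive p-odd order (+ toℕ i ℤ.- + toℕ j) ⟩
    + p ℤ.* χ p (+ toℕ i ℤ.- + toℕ j) ℤ.- ℤ.1ℤ
      ≡⟨ cong (λ x → + p ℤ.* x ℤ.- ℤ.1ℤ) (χ-∤ p (toℕ-distinct-mod j≢i)) ⟩
    + p ℤ.* ℤ.0ℤ ℤ.- ℤ.1ℤ                     ≡⟨ cong (ℤ._- ℤ.1ℤ) (ℤₚ.*-zeroʳ (+ p)) ⟩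
    ℤ.-1ℤ                                     ∎

-- Logarithms as harmonic sums

0<fromℕ-suc : ∀ n → 0ℚ < fromℕ (suc n)
0<fromℕ-suc n = <-≤-trans 0<1 (fromℕ-mono {1} {suc n} (ℕ.s≤s ℕ.z≤n))

∑<-cong : ∀ n {f g : ℕ → ℚ} → (∀ k → k ℕ.< n → f k ≡ g k) → ∑< n f ≡ ∑< n g
∑<-cong zero    f≡g = refl
∑<-cong (suc n) f≡g = cong₂ _+_ (∑<-cong n (λ k k<n → f≡g k (ℕₚ.m<n⇒m<1+n k<n))) (f≡g n ℕₚ.≤-refl)

∑<-mono : ∀ n {f g : ℕ → ℚ} → (∀ k → k ℕ.< n → f k ≤ g k) → ∑< n f ≤ ∑< n g
∑<-mono zero    f≤g = ≤-refl
∑<-mono (suc n) f≤g = +-mono-≤ (∑<-mono n (λ k k<n → f≤g k (ℕₚ.m<n⇒m<1+n k<n))) (f≤g n ℕₚ.≤-refl)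

*-inv-unique : ∀ {a b} → 0ℚ < a → a * b ≡ 1ℚ → b ≡ inv a
*-inv-unique {a} {b} 0<a ab≡1 = begin
  b                  ≡⟨ *-identityˡ b ⟨
  1ℚ * b             ≡⟨ cong (_* b) (inv-≢0 0<a) ⟨
  (a * inv a) * b    ≡⟨ solve 3 (λ a i b → (a :* i) :* b := i :* (a :* b)) refl a (inv a) b ⟩
  inv a * (a * b)    ≡⟨ cong (inv a *_) ab≡1 ⟩
  inv a * 1ℚ         ≡⟨ *-identityʳ (inv a) ⟩
  inv a              ∎
  where open ≡-Reasoning

-- The harmonic sum over the integers in [a, a + n). Additivity under cutting this interval plays
-- the part of the functional equation of log.
block : ℕ → ℕ → ℚ
block a n = ∑< n (λ k → inv (fromℕ (a ℕ.+ k)))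

block-split : ∀ a m n → block a (m ℕ.+ n) ≡ block a m + block (a ℕ.+ m) n
block-split a m n = trans (∑<-split m n (λ k → inv (fromℕ (a ℕ.+ k))))
  (cong (λ t → block a m + t) (∑<-cong n (λ k _ → cong (λ t → inv (fromℕ t)) (sym (ℕₚ.+-assoc a m k)))))

block-lower : ∀ a n → fromℕ n * inv (fromℕ (suc a ℕ.+ n)) ≤ block (suc a) n
block-lower a n = subst (_≤ block (suc a) n) (∑<-const n (inv (fromℕ (suc a ℕ.+ n))))
  (∑<-mono n (λ k k<n → inv-anti (0<fromℕ-suc (a ℕ.+ k)) (fromℕ-mono (ℕₚ.+-monoʳ-≤ (suc a) (ℕₚ.<⇒≤ k<n)))))

block-nonneg : ∀ a n → 0ℚ ≤ block (suc a) n
block-nonneg a n = ≤-trans (0≤* (0≤fromℕ n) (<⇒≤ (inv-pos (0<fromℕ-suc (a ℕ.+ n))))) (block-lower a n)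

block-mono : ∀ a {m n} → m ℕ.≤ n → block (suc a) m ≤ block (suc a) n
block-mono a {m} {n} m≤n = begin
  block (suc a) m                                               ≡⟨ +-identityʳ _ ⟨
  block (suc a) m + 0ℚ                                          ≤⟨ +-monoʳ-≤ (block (suc a) m) (block-nonneg (a ℕ.+ m) (n ℕ.∸ m)) ⟩
  block (suc a) m + block (suc a ℕ.+ m) (n ℕ.∸ m)               ≡⟨ block-split (suc a) m (n ℕ.∸ m) ⟨
  block (suc a) (m ℕ.+ (n ℕ.∸ m))                               ≡⟨ cong (block (suc a)) (ℕₚ.m+[n∸m]≡n m≤n) ⟩
  block (suc a) n                                               ∎
  where open ≤-Reasoning

inv-* : ∀ {a b} → 0ℚ < a → 0ℚ < b → inv (a * b) ≡ inv a * inv b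
inv-* {a} {b} 0<a 0<b = sym (*-inv-unique (0<* 0<a 0<b) (begin
  (a * b) * (inv a * inv b)   ≡⟨ solve 4 (λ a b i j → (a :* b) :* (i :* j) := (a :* i) :* (b :* j)) refl a b (inv a) (inv b) ⟩
  (a * inv a) * (b * inv b)   ≡⟨ cong₂ _*_ (inv-≢0 0<a) (inv-≢0 0<b) ⟩
  1ℚ * 1ℚ                     ≡⟨ *-identityʳ 1ℚ ⟩
  1ℚ                          ∎))
  where open ≡-Reasoning

fromℕ-*-inv : ∀ n q → fromℕ (suc n) * inv (fromℕ (suc n ℕ.* suc q)) ≡ inv (fromℕ (suc q))
fromℕ-*-inv n q = begin
  N * inv (fromℕ (suc n ℕ.* suc q))   ≡⟨ cong (λ t → N * inv t) (fromℕ-* (suc n) (suc q)) ⟩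
  N * inv (N * Q)                     ≡⟨ cong (N *_) (inv-* (0<fromℕ-suc n) (0<fromℕ-suc q)) ⟩
  N * (inv N * inv Q)                 ≡⟨ *-assoc N (inv N) (inv Q) ⟨
  (N * inv N) * inv Q                 ≡⟨ cong (_* inv Q) (inv-≢0 (0<fromℕ-suc n)) ⟩
  1ℚ * inv Q                          ≡⟨ *-identityˡ (inv Q) ⟩
  inv Q                               ∎
  where
  open ≡-Reasoning
  N = fromℕ (suc n)
  Q = fromℕ (suc q)

-- Steps of length 1/n from 1 to q + 1 turn the Riemann sum of dt/t into a harmonic block.
logSum-block : ∀ N n q → suc N ≡ suc n ℕ.* q → logSum (fromℕ (suc q)) (suc N) ≡ block (suc n) (suc n ℕ.* q)
logSum-block N n q N≡nq = trans (∑<-cong (suc N) (λ k _ → term k)) (cong (block (suc n)) N≡nq)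
  where
  open ≡-Reasoning
  a = fromℕ (suc n)
  h = (fromℕ (suc q) - 1ℚ) * 1/n (suc N)
  ah≡1 : a * h ≡ 1ℚ
  ah≡1 = begin
    a * ((fromℕ (suc q) - 1ℚ) * i)    ≡⟨ cong (λ t → a * ((t - 1ℚ) * i)) (fromℕ-+ 1 q) ⟩
    a * ((1ℚ + fromℕ q - 1ℚ) * i)     ≡⟨ solve 3 (λ a q i → a :* ((con 1ℚ :+ q :- con 1ℚ) :* i) := (a :* q) :* i) refl a (fromℕ q) i ⟩
    (a * fromℕ q) * i                 ≡⟨ cong (_* i) (fromℕ-* (suc n) q) ⟨
    fromℕ (suc n ℕ.* q) * i           ≡⟨ cong (λ t → fromℕ t * i) N≡nq ⟨
    fromℕ (suc N) * i                 ≡⟨ n*1/n (suc N) ⟩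
    1ℚ                                ∎
    where i = 1/n (suc N)
  h≡ : h ≡ inv a
  h≡ = *-inv-unique (0<fromℕ-suc n) ah≡1
  term : ∀ k → h * inv (1ℚ + fromℕ k * h) ≡ inv (fromℕ (suc n ℕ.+ k))
  term k = begin
    h * inv (1ℚ + fromℕ k * h)              ≡⟨ cong (λ t → h * inv (t + fromℕ k * h)) ah≡1 ⟨
    h * inv (a * h + fromℕ k * h)           ≡⟨ cong (λ t → h * inv t) (*-distribʳ-+ h a (fromℕ k)) ⟨
    h * inv ((a + fromℕ k) * h)             ≡⟨ cong (λ t → h * inv (t * h)) (fromℕ-+ (suc n) k) ⟨
    h * inv (b * h)                         ≡⟨ cong (h *_) (inv-* (0<fromℕ-suc (n ℕ.+ k)) 0<h) ⟩
    h * (inv b * inv h)                     ≡⟨ solve 3 (λ h b i → h :* (b :* i) := b :* (h :* i)) refl h (inv b) (inv h) ⟩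
    inv b * (h * inv h)                     ≡⟨ cong (inv b *_) (inv-≢0 0<h) ⟩
    inv b * 1ℚ                              ≡⟨ *-identityʳ (inv b) ⟩
    inv b                                   ∎
    where
    b = fromℕ (suc n ℕ.+ k)
    0<h : 0ℚ < h
    0<h = subst (0ℚ <_) (sym h≡) (inv-pos (0<fromℕ-suc n))

-- 2^k - 1, the length factor for which blocks approximate log 2^k. The recursion by doubling
-- matches the cut made in `block-2^`.
mersenne : ℕ → ℕ
mersenne zero    = 0
mersenne (suc k) = suc (mersenne k ℕ.+ mersenne k)

suc-mersenne : ∀ k → suc (mersenne k) ≡ 2 ℕ.^ k
suc-mersenne zero    = refl
suc-mersenne (suc k) = trans (cong suc (sym (ℕₚ.+-suc (mersenne k) (mersenne k))))
  (trans (cong₂ ℕ._+_ (suc-mersenne k) (suc-mersenne k)) (cong (2 ℕ.^ k ℕ.+_) (sym (ℕₚ.+-identityʳ (2 ℕ.^ k)))))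

-- L q approximates log (q + 1), not log q.
abstract
  L : ℕ → ℕ → ℚ
  L q n = logSum (fromℕ (suc q)) (suc n)

  L-def : ∀ q n → L q n ≡ logSum (fromℕ (suc q)) (suc n)
  L-def q n = refl

  L-cauchy : ∀ q → Cauchy (L q)
  L-cauchy q = logSum-cauchy (ι (fromℕ (suc q))) (fromℕ (suc q) , 0<fromℕ-suc q , 0 , λ _ _ → ≤-reflexive (+-identityˡ _))

L-block : ∀ N n q → suc N ≡ suc n ℕ.* q → L q N ≡ block (suc n) (suc n ℕ.* q)
L-block N n q N≡nq = trans (L-def q N) (logSum-block N n q N≡nq)

-- By `L-block` the block is itself a term of the sequence `L (suc q)`, the one with n + 1 steps per
-- unit length, and its index is at least n. So the Cauchy property suffices.
block-approximates-L : ∀ q ε → 0ℚ < ε → ∃[ N ] ∀ n m → N ℕ.≤ n → N ℕ.≤ m →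
  ∣ block (suc n) (suc n ℕ.* suc q) - L (suc q) m ∣ ≤ ε
block-approximates-L q ε 0<ε = let N , P = L-cauchy (suc q) ε 0<ε in
  N , λ n m N≤n N≤m → subst (λ t → ∣ t - L (suc q) m ∣ ≤ ε)
    (L-block (q ℕ.+ n ℕ.* suc q) n (suc q) refl)
    (P (q ℕ.+ n ℕ.* suc q) m (ℕₚ.≤-trans N≤n (ℕₚ.≤-trans (ℕₚ.m≤m*n n (suc q)) (ℕₚ.m≤n+m _ q))) N≤m)

∣p-q∣≤⇒p≤q+ : ∀ p q {ε} → ∣ p - q ∣ ≤ ε → p ≤ q + ε
∣p-q∣≤⇒p≤q+ p q {ε} H = begin
  p               ≡⟨ solve 2 (λ p q → p := q :+ (p :- q)) refl p q ⟩
  q + (p - q)     ≤⟨ +-monoʳ-≤ q (p≤∣p∣ (p - q)) ⟩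
  q + ∣ p - q ∣   ≤⟨ +-monoʳ-≤ q H ⟩
  q + ε           ∎
  where
  open ≤-Reasoning
  p≤∣p∣ : ∀ p → p ≤ ∣ p ∣
  p≤∣p∣ p with ≤-total 0ℚ p
  ... | inj₁ 0≤p = ≤-reflexive (sym (0≤p⇒∣p∣≡p 0≤p))
  ... | inj₂ p≤0 = ≤-trans p≤0 (0≤∣p∣ p)

∣p-q∣≤⇒q≤p+ : ∀ p q {ε} → ∣ p - q ∣ ≤ ε → q ≤ p + ε
∣p-q∣≤⇒q≤p+ p q {ε} H = ∣p-q∣≤⇒p≤q+ q p (subst (_≤ ε) (∣-∣-sym p q) H)

*-suc-double : ∀ n m → n ℕ.* suc (m ℕ.+ m) ≡ n ℕ.+ (n ℕ.+ n) ℕ.* m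
*-suc-double n m = solveℕ 2 (λ n m → n *′ (con′ 1 +′ (m +′ m)) =′ n +′ (n +′ n) *′ m) refl n m
  where
  open ℕSolver using () renaming (solve to solveℕ; _:+_ to _+′_; _:*_ to _*′_; _:=_ to _=′_; con to con′)

-- log 2^k = k log 2 for blocks: with n' = n + 1, the interval [n', 2^(k+1) n') is cut at 2n'. The
-- first piece is within ε of x, and the second is the case `k` starting from 2n'.
block-2^ : ∀ {N x ε} → (∀ n → N ℕ.≤ n → ∣ block (suc n) (suc n ℕ.* 1) - x ∣ ≤ ε) → ∀ k n → N ℕ.≤ n →
  ∣ block (suc n) (suc n ℕ.* mersenne k) - fromℕ k * x ∣ ≤ fromℕ k * ε
block-2^ {N} {x} {ε} H zero n N≤n = begin
  ∣ block (suc n) (n ℕ.* 0) - 0ℚ * x ∣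
    ≡⟨ cong₂ (λ t y → ∣ block (suc n) t - y ∣) (ℕₚ.*-zeroʳ n) (*-zeroˡ x) ⟩
  0ℚ              ≡⟨ *-zeroˡ ε ⟨
  0ℚ * ε          ∎
  where open ≤-Reasoning
block-2^ {N} {x} {ε} H (suc k) n N≤n = begin
  ∣ block n′ (n′ ℕ.* mersenne (suc k)) - fromℕ (suc k) * x ∣
    ≡⟨ cong₂ (λ s t → ∣ s - t * x ∣) splitting (fromℕ-+ 1 k) ⟩
  ∣ (A + B) - (1ℚ + fromℕ k) * x ∣
    ≡⟨ cong ∣_∣ (solve 4 (λ a b k x → (a :+ b) :- (con 1ℚ :+ k) :* x := (a :- x) :+ (b :- k :* x)) refl A B (fromℕ k) x) ⟩
  ∣ (A - x) + (B - fromℕ k * x) ∣     ≤⟨ ∣p+q∣≤∣p∣+∣q∣ (A - x) (B - fromℕ k * x) ⟩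
  ∣ A - x ∣ + ∣ B - fromℕ k * x ∣     ≤⟨ +-mono-≤ (H n N≤n)
                                           (block-2^ {N} {x} {ε} H k (n ℕ.+ n′) (ℕₚ.≤-trans N≤n (ℕₚ.m≤m+n n n′))) ⟩
  ε + fromℕ k * ε                     ≡⟨ solve 2 (λ k e → e :+ k :* e := (con 1ℚ :+ k) :* e) refl (fromℕ k) ε ⟩
  (1ℚ + fromℕ k) * ε                  ≡⟨ cong (_* ε) (fromℕ-+ 1 k) ⟨
  fromℕ (suc k) * ε                   ∎
  where
  open ≤-Reasoning
  n′ = suc n
  m = mersenne k
  A = block n′ (n′ ℕ.* 1)
  B = block (n′ ℕ.+ n′) ((n′ ℕ.+ n′) ℕ.* m)
  splitting : block n′ (n′ ℕ.* mersenne (suc k)) ≡ A + B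
  splitting = trans (cong (block n′) (*-suc-double n′ m)) (trans (block-split n′ n′ ((n′ ℕ.+ n′) ℕ.* m))
    (cong (λ t → block n′ t + B) (sym (ℕₚ.*-identityʳ n′))))

-- The block has m + 1 terms, each at least 1 / (2(m + 1)). The bound holds at every index, so
-- denominators stay away from 0 uniformly.
log2-lower : ∀ m → ½ ≤ L 1 m
log2-lower m = begin
  ½                                          ≡⟨⟩
  inv (fromℕ 2)                              ≡⟨ fromℕ-*-inv m 1 ⟨
  fromℕ (suc m) * inv (fromℕ (suc m ℕ.* 2))  ≡⟨ cong (λ t → fromℕ (suc m) * inv (fromℕ t)) (n*2≡n*1+n*1 (suc m)) ⟩
  fromℕ (suc m) * inv (fromℕ (suc m ℕ.+ suc m ℕ.* 1))
    ≡⟨ cong (λ t → fromℕ t * inv (fromℕ (suc m ℕ.+ suc m ℕ.* 1))) (ℕₚ.*-identityʳ (suc m)) ⟨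
  fromℕ (suc m ℕ.* 1) * inv (fromℕ (suc m ℕ.+ suc m ℕ.* 1))  ≤⟨ block-lower m (suc m ℕ.* 1) ⟩
  block (suc m) (suc m ℕ.* 1)                ≡⟨ L-block m m 1 (sym (ℕₚ.*-identityʳ (suc m))) ⟨
  L 1 m                                      ∎
  where
  open ≤-Reasoning
  n*2≡n*1+n*1 : ∀ n → n ℕ.* 2 ≡ n ℕ.+ n ℕ.* 1
  n*2≡n*1+n*1 n = ℕₚ.*-suc n 1

scaled-ε : ∀ n ε → fromℕ (suc n) * (ε * inv (fromℕ (suc n))) ≡ ε
scaled-ε n ε = begin
  a * (ε * inv a)   ≡⟨ solve 3 (λ a e i → a :* (e :* i) := e :* (a :* i)) refl a ε (inv a) ⟩
  ε * (a * inv a)   ≡⟨ cong (ε *_) (inv-≢0 (0<fromℕ-suc n)) ⟩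
  ε * 1ℚ            ≡⟨ *-identityʳ ε ⟩
  ε                 ∎
  where
  open ≡-Reasoning
  a = fromℕ (suc n)

-- log p² = 2 log p for p = q + 1: an interval [n, np²) is cut at np, and p² - 1 = q + pq.
block-square : ∀ n q → block (suc n) (suc n ℕ.* (q ℕ.+ suc q ℕ.* q)) ≡
  block (suc n) (suc n ℕ.* q) + block (suc n ℕ.* suc q) (suc n ℕ.* suc q ℕ.* q)
block-square n q = begin
  block n′ (n′ ℕ.* (q ℕ.+ suc q ℕ.* q))                        ≡⟨ cong (block n′) (trans (ℕₚ.*-distribˡ-+ n′ q (suc q ℕ.* q))
                                                                    (cong (n′ ℕ.* q ℕ.+_) (sym (ℕₚ.*-assoc n′ (suc q) q)))) ⟩
  block n′ (n′ ℕ.* q ℕ.+ n′ ℕ.* suc q ℕ.* q)                   ≡⟨ block-split n′ (n′ ℕ.* q) (n′ ℕ.* suc q ℕ.* q) ⟩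
  block n′ (n′ ℕ.* q) + block (n′ ℕ.+ n′ ℕ.* q) (n′ ℕ.* suc q ℕ.* q)
    ≡⟨ cong (λ t → block n′ (n′ ℕ.* q) + block t (n′ ℕ.* suc q ℕ.* q)) (ℕₚ.*-suc n′ q) ⟨
  block n′ (n′ ℕ.* q) + block (n′ ℕ.* suc q) (n′ ℕ.* suc q ℕ.* q) ∎
  where
  open ≡-Reasoning
  n′ = suc n

-- With p = q + 1, this is log p² ≤ log 2^q, obtained from block n (n (p² - 1)) ≤ block n (n (2^q - 1)).
2L≤qL₁ : ∀ q → suc (suc q) ℕ.* suc (suc q) ℕ.≤ 2 ℕ.^ suc q → ∀ ε → 0ℚ < ε →
  ∃[ N ] ∀ m → N ℕ.≤ m → L (suc q) m + L (suc q) m ≤ fromℕ (suc q) * L 1 m + ε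
2L≤qL₁ q p²≤2^q ε 0<ε =
  let N₁ , P = block-approximates-L q ε′ 0<ε′
      N₂ , R = block-approximates-L 0 ε′ 0<ε′
      n = N₁ ℕ.⊔ N₂
  in n , λ m n≤m → bound n (L Q m) (L 1 m)
    (λ k n≤k → P k m (⊔⇒ˡ N₁ N₂ n≤k) (⊔⇒ˡ N₁ N₂ n≤m))
    (λ k n≤k → R k m (⊔⇒ʳ N₁ N₂ n≤k) (⊔⇒ʳ N₁ N₂ n≤m))
  where
  open ≤-Reasoning
  Q = suc q
  -- Error budget: one `ε′` for each of the two blocks near log p, and `Q` of them for the block
  -- near Q log 2.
  K = fromℕ (2 ℕ.+ Q)
  ε′ = ε * inv K
  0<ε′ : 0ℚ < ε′
  0<ε′ = 0<* 0<ε (inv-pos (0<fromℕ-suc (suc Q)))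
  length≤ : Q ℕ.+ suc Q ℕ.* Q ℕ.≤ mersenne Q
  length≤ = ℕₚ.≤-pred (ℕₚ.≤-trans (ℕₚ.≤-reflexive (cong (suc Q ℕ.+_) (ℕₚ.*-comm (suc Q) Q)))
    (ℕₚ.≤-trans p²≤2^q (ℕₚ.≤-reflexive (sym (suc-mersenne Q)))))
  bound : ∀ n y x →
    (∀ k → n ℕ.≤ k → ∣ block (suc k) (suc k ℕ.* Q) - y ∣ ≤ ε′) →
    (∀ k → n ℕ.≤ k → ∣ block (suc k) (suc k ℕ.* 1) - x ∣ ≤ ε′) →
    y + y ≤ fromℕ Q * x + ε
  bound n y x P R = begin
    y + y
      -- The start `suc n ℕ.* suc Q` of the second block is the successor of `Q ℕ.+ n ℕ.* suc Q`, so
      -- `P` covers it too.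
      ≤⟨ +-mono-≤ (∣p-q∣≤⇒q≤p+ A y (P n ℕₚ.≤-refl))
           (∣p-q∣≤⇒q≤p+ B y (P (Q ℕ.+ n ℕ.* suc Q) (ℕₚ.≤-trans (ℕₚ.m≤m*n n (suc Q)) (ℕₚ.m≤n+m (n ℕ.* suc Q) Q)))) ⟩
    (A + ε′) + (B + ε′)
      ≡⟨ solve 3 (λ a b e → (a :+ e) :+ (b :+ e) := (a :+ b) :+ (e :+ e)) refl A B ε′ ⟩
    (A + B) + (ε′ + ε′)
      ≡⟨ cong (λ t → t + (ε′ + ε′)) (block-square n Q) ⟨
    block (suc n) (suc n ℕ.* (Q ℕ.+ suc Q ℕ.* Q)) + (ε′ + ε′)
      ≤⟨ +-monoˡ-≤ (ε′ + ε′) (block-mono n (ℕₚ.*-monoʳ-≤ (suc n) length≤)) ⟩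
    block (suc n) (suc n ℕ.* mersenne Q) + (ε′ + ε′)
      ≤⟨ +-monoˡ-≤ (ε′ + ε′) (∣p-q∣≤⇒p≤q+ (block (suc n) (suc n ℕ.* mersenne Q)) (fromℕ Q * x) (block-2^ {n} {x} {ε′} R Q n ℕₚ.≤-refl)) ⟩
    (fromℕ Q * x + fromℕ Q * ε′) + (ε′ + ε′)
      ≡⟨ solve 3 (λ q x e → (q :* x :+ q :* e) :+ (e :+ e) := q :* x :+ (con 1ℚ :+ (con 1ℚ :+ q)) :* e) refl (fromℕ Q) x ε′ ⟩
    fromℕ Q * x + (1ℚ + (1ℚ + fromℕ Q)) * ε′
      ≡⟨ cong (λ t → fromℕ Q * x + t * ε′) (trans (cong (λ t → 1ℚ + t) (sym (fromℕ-+ 1 Q))) (sym (fromℕ-+ 1 (suc Q)))) ⟩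
    fromℕ Q * x + K * ε′
      ≡⟨ cong (λ t → fromℕ Q * x + t) (scaled-ε (suc Q) ε) ⟩
    fromℕ Q * x + ε ∎
    where
    A = block (suc n) (suc n ℕ.* Q)
    B = block (suc n ℕ.* suc Q) (suc n ℕ.* suc Q ℕ.* Q)

-- log(2^k + 1) > log 2^k with a definite gap: with n' = n + 1, the stretch from n' 2^k to n'(2^k +
-- 1) has n' terms, each at least 1 / (n'(2^k + 1)), hence a sum of at least `I` = 1 / (2^k + 1) for
-- every n. Half of `I` is kept as the gap; the other half pays for k + 1 approximation errors `ε`.
kL₁<L : ∀ k → Σ[ δ ∈ ℚ ] 0ℚ < δ × ∃[ N ] ∀ m → N ℕ.≤ m → fromℕ k * L 1 m + δ ≤ L (suc (mersenne k)) m
kL₁<L k =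
  let N₁ , P = block-approximates-L μ ε 0<ε
      N₂ , R = block-approximates-L 0 ε 0<ε
      n = N₁ ℕ.⊔ N₂
  in ½ * I , 0<½I , n , λ m n≤m → bound n (L (suc μ) m) (L 1 m)
    (P n m (⊔⇒ˡ N₁ N₂ ℕₚ.≤-refl) (⊔⇒ˡ N₁ N₂ n≤m))
    (λ k n≤k → R k m (⊔⇒ʳ N₁ N₂ n≤k) (⊔⇒ʳ N₁ N₂ n≤m))
  where
  open ≤-Reasoning
  μ = mersenne k
  I = inv (fromℕ (suc (suc μ)))
  0<½I : 0ℚ < ½ * I
  0<½I = 0<* (positive⁻¹ ½) (inv-pos (0<fromℕ-suc (suc μ)))
  ε = ½ * I * inv (fromℕ (suc k))
  0<ε : 0ℚ < ε
  0<ε = 0<* 0<½I (inv-pos (0<fromℕ-suc k))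
  tail : ∀ n → I ≤ block (suc n ℕ.* suc μ) (suc n)
  tail n = begin
    I                                                            ≡⟨ fromℕ-*-inv n (suc μ) ⟨
    fromℕ (suc n) * inv (fromℕ (suc n ℕ.* suc (suc μ)))          ≡⟨ cong (λ t → fromℕ (suc n) * inv (fromℕ t))
                                                                      (trans (ℕₚ.*-suc (suc n) (suc μ)) (ℕₚ.+-comm (suc n) _)) ⟩
    fromℕ (suc n) * inv (fromℕ (suc n ℕ.* suc μ ℕ.+ suc n))      ≤⟨ block-lower (μ ℕ.+ n ℕ.* suc μ) (suc n) ⟩
    block (suc n ℕ.* suc μ) (suc n)                              ∎
  splitting : ∀ n → block (suc n) (suc n ℕ.* suc μ) ≡ block (suc n) (suc n ℕ.* μ) + block (suc n ℕ.* suc μ) (suc n)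
  splitting n = trans
    (cong (block (suc n)) (trans (ℕₚ.*-suc (suc n) μ) (ℕₚ.+-comm (suc n) (suc n ℕ.* μ))))
    (trans (block-split (suc n) (suc n ℕ.* μ) (suc n))
      (cong (λ t → block (suc n) (suc n ℕ.* μ) + block t (suc n)) (sym (ℕₚ.*-suc (suc n) μ))))
  bound : ∀ n y x →
    ∣ block (suc n) (suc n ℕ.* suc μ) - y ∣ ≤ ε →
    (∀ k → n ℕ.≤ k → ∣ block (suc k) (suc k ℕ.* 1) - x ∣ ≤ ε) →
    fromℕ k * x + ½ * I ≤ y
  bound n y x P R = begin
    fromℕ k * x + ½ * I
      ≡⟨ solve 2 (λ a i → a :+ con ½ :* i := (a :+ i) :- con ½ :* i) refl (fromℕ k * x) I ⟩
    (fromℕ k * x + I) - ½ * I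
      ≤⟨ +-monoˡ-≤ (- (½ * I)) (begin
        fromℕ k * x + I
          ≤⟨ +-mono-≤ (∣p-q∣≤⇒q≤p+ A (fromℕ k * x) (block-2^ {n} {x} {ε} R k n ℕₚ.≤-refl)) (tail n) ⟩
        (A + fromℕ k * ε) + B
          ≡⟨ solve 3 (λ a e b → (a :+ e) :+ b := (a :+ b) :+ e) refl A (fromℕ k * ε) B ⟩
        (A + B) + fromℕ k * ε
          ≡⟨ cong (λ t → t + fromℕ k * ε) (splitting n) ⟨
        block (suc n) (suc n ℕ.* suc μ) + fromℕ k * ε
          ≤⟨ +-monoˡ-≤ (fromℕ k * ε) (∣p-q∣≤⇒p≤q+ (block (suc n) (suc n ℕ.* suc μ)) y P) ⟩
        (y + ε) + fromℕ k * ε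
          ≡⟨ solve 3 (λ y e k → (y :+ e) :+ k :* e := y :+ (con 1ℚ :+ k) :* e) refl y ε (fromℕ k) ⟩
        y + (1ℚ + fromℕ k) * ε
          ≡⟨ cong (λ t → y + t * ε) (fromℕ-+ 1 k) ⟨
        y + fromℕ (suc k) * ε
          ≡⟨ cong (λ t → y + t) (scaled-ε k (½ * I)) ⟩
        y + ½ * I ∎) ⟩
    (y + ½ * I) - ½ * I
      ≡⟨ solve 2 (λ y i → (y :+ i) :- i := y) refl y (½ * I) ⟩
    y ∎
    where
    A = block (suc n) (suc n ℕ.* μ)
    B = block (suc n ℕ.* suc μ) (suc n)

-- Uniqueness of the order and of the largest modulus

-- `_≤ᵣ_` is a negation, but at a fixed late index the rational terms can be compared. If the
-- inequality failed there, passing to later indices would cost ε/3 for each of x and y, and the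
-- remaining ε/3 would witness y < x.
≤ᵣ⇒eventually-≤ : ∀ {x y} → x ≤ᵣ y → ∀ ε → 0ℚ < ε → ∃[ N ] ∀ n → N ℕ.≤ n → seq x n ≤ seq y n + ε
≤ᵣ⇒eventually-≤ {x} {y} x≤y ε 0<ε =
  let N₁ , P = cauchy x ε′ 0<ε′ ; N₂ , Q = cauchy y ε′ 0<ε′ in
  N₁ ℕ.⊔ N₂ , λ n N≤n → ≮⇒≥ λ y+ε<x → x≤y (ε′ , 0<ε′ , n , λ m n≤m →
    gap (seq x n) (seq y n) (seq x m) (seq y m) (<⇒≤ y+ε<x)
      (∣p-q∣≤⇒p≤q+ (seq x n) (seq x m) (P n m (⊔⇒ˡ N₁ N₂ N≤n) (ℕₚ.≤-trans (⊔⇒ˡ N₁ N₂ N≤n) n≤m)))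
      (∣p-q∣≤⇒q≤p+ (seq y n) (seq y m) (Q n m (⊔⇒ʳ N₁ N₂ N≤n) (ℕₚ.≤-trans (⊔⇒ʳ N₁ N₂ N≤n) n≤m))))
  where
  open ≤-Reasoning
  ε′ = + 1 / 3 * ε
  0<ε′ : 0ℚ < ε′
  0<ε′ = 0<* (positive⁻¹ (+ 1 / 3)) 0<ε
  gap : ∀ xₙ yₙ xₘ yₘ → yₙ + ε ≤ xₙ → xₙ ≤ xₘ + ε′ → yₘ ≤ yₙ + ε′ → yₘ + ε′ ≤ xₘ
  gap xₙ yₙ xₘ yₘ y+ε≤x xₙ≤ yₘ≤ = begin
    yₘ + ε′                 ≤⟨ +-monoˡ-≤ ε′ yₘ≤ ⟩
    yₙ + ε′ + ε′            ≡⟨ solve 2 (λ y e → y :+ con (+ 1 / 3) :* e :+ con (+ 1 / 3) :* e :=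
                                 (y :+ e) :- con (+ 1 / 3) :* e) refl yₙ ε ⟩
    (yₙ + ε) - ε′           ≤⟨ +-monoˡ-≤ (- ε′) (≤-trans y+ε≤x xₙ≤) ⟩
    (xₘ + ε′) - ε′          ≡⟨ solve 2 (λ x e → (x :+ e) :- e := x) refl xₘ ε′ ⟩
    xₘ                      ∎

p≤q+⇒∣p-q∣≤ : ∀ {ε} p q → p ≤ q + ε → q ≤ p + ε → ∣ p - q ∣ ≤ ε
p≤q+⇒∣p-q∣≤ {ε} p q p≤q+ε q≤p+ε with ∣p∣≡p∨∣p∣≡-p (p - q)
... | inj₁ eq = ≤-trans (≤-reflexive eq) (difference p q p≤q+ε)
  where
  difference : ∀ p q → p ≤ q + ε → p - q ≤ ε
  difference p q H = ≤-trans (+-monoˡ-≤ (- q) H) (≤-reflexive (solve 2 (λ q e → (q :+ e) :- q := e) refl q ε))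
... | inj₂ eq = ≤-trans (≤-reflexive (trans eq (solve 2 (λ p q → :- (p :- q) := q :- p) refl p q)))
  (≤-trans (+-monoˡ-≤ (- p) q≤p+ε) (≤-reflexive (solve 2 (λ q e → (q :+ e) :- q := e) refl p ε)))

≤ᵣ-antisym : ∀ {x y} → x ≤ᵣ y → y ≤ᵣ x → x ∼ y
≤ᵣ-antisym {x} {y} x≤y y≤x = wrap λ ε 0<ε →
  let N₁ , P = ≤ᵣ⇒eventually-≤ {x} {y} x≤y ε 0<ε ; N₂ , Q = ≤ᵣ⇒eventually-≤ {y} {x} y≤x ε 0<ε in
  N₁ ℕ.⊔ N₂ , λ n N≤n → p≤q+⇒∣p-q∣≤ (seq x n) (seq y n) (P n (⊔⇒ˡ N₁ N₂ N≤n)) (Q n (⊔⇒ʳ N₁ N₂ N≤n))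

-- `Isβ` allows any real with the defining property as λ₁; this identifies it with the computed one.
-- Each candidate is attained, so it is bounded by the other.
largest-unique : ∀ {n} {A : Matrix ℤ n} {r r′ : ℝ} →
  IsLargestEigenvalueModulus A r → IsLargestEigenvalueModulus A r′ → r ∼ r′
largest-unique {A = A} {r} {r′} ((z , z-eigen , |z|=r) , r-max) ((z′ , z′-eigen , |z′|=r′) , r′-max) =
  ≤ᵣ-antisym {r} {r′} (r′-max z r z-eigen |z|=r) (r-max z′ r′ z′-eigen |z′|=r′)

order-unique : ∀ {p s t} → IsOrderOf2 p s → IsOrderOf2 p t → s ≡ t
order-unique (0<s , p∣s , s-least) (0<t , p∣t , t-least) = ℕₚ.≤-antisym (s-least _ 0<t p∣t) (t-least _ 0<s p∣s)

-- Comparison of β with 1/2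

seq-β : ∀ x (0<x : ι 0ℚ <ᵣ x) s (0<d : ι 0ℚ <ᵣ ι (+ s / 1) *ᵣ log2) n →
  seq (log x 0<x /ᵣ (ι (+ s / 1) *ᵣ log2) [ 0<d ]) n ≡ logSum (seq x n) (suc n) * inv (fromℕ s * L 1 n)
seq-β x 0<x s 0<d n = cong (λ t → logSum (seq x n) (suc n) * inv (fromℕ s * t)) (sym (L-def 1 n))

logSum-lipschitz₁ : ∀ {a b} n → 1ℚ ≤ a → 1ℚ ≤ b → ∣ logSum a (suc n) - logSum b (suc n) ∣ ≤ ∣ a - b ∣
logSum-lipschitz₁ {a} {b} n 1≤a 1≤b =
  ≤-trans (logSum-lipschitz (suc n) 0<1 ≤-refl 1≤a 1≤b) (≤-reflexive (*-identityʳ ∣ a - b ∣))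

1≤s*log2 : ∀ s n → 2 ℕ.≤ s → 1ℚ ≤ fromℕ s * L 1 n
1≤s*log2 s n 2≤s = 0≤*-mono-≤ {fromℕ 2} {fromℕ s} {½} {L 1 n} (0≤fromℕ 2)
  (≤-trans (<⇒≤ (positive⁻¹ ½)) (log2-lower n)) (fromℕ-mono 2≤s) (log2-lower n)

¼ : ℚ
¼ = + 1 / 4

-- The contradiction at one index, with `ℓ`, `y`, `d` the terms for log λ₁, log p and s log 2.
-- Writing ε = δ/4 and using 1/d ≤ 1, doubling gives 1 + 2δ ≤ 2ℓ/d + 2ε ≤ (d + 3ε)/d + 2ε ≤ 1 +
-- 5δ/4.
ratio≤½ : ∀ {δ} b ℓ y d → 0ℚ < δ → ½ + δ ≤ b → ∣ b - ℓ * inv d ∣ ≤ ¼ * δ → ∣ ℓ - y ∣ ≤ ¼ * δ →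
  y + y ≤ d + ¼ * δ → 1ℚ ≤ d → ⊥
ratio≤½ {δ} b ℓ y d 0<δ ½+δ≤b b≈ ℓ≈y 2y≤d 1≤d = <-irrefl refl (begin-strict
  1ℚ + (1ℚ + ¼) * δ                         <⟨ +-monoʳ-< 1ℚ (*-monoˡ-<-pos δ {{positive 0<δ}} {1ℚ + ¼} {1ℚ + 1ℚ} (from-yes (1ℚ + ¼ <? 1ℚ + 1ℚ))) ⟩
  1ℚ + (1ℚ + 1ℚ) * δ                        ≡⟨ solve 1 (λ δ → con 1ℚ :+ (con 1ℚ :+ con 1ℚ) :* δ := (con ½ :+ δ) :+ (con ½ :+ δ)) refl δ ⟩
  (½ + δ) + (½ + δ)                         ≤⟨ +-mono-≤ ½+δ≤ ½+δ≤ ⟩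
  (ℓ * i + ε) + (ℓ * i + ε)                 ≡⟨ solve 3 (λ l i e → (l :* i :+ e) :+ (l :* i :+ e) := (l :+ l) :* i :+ (e :+ e)) refl ℓ i ε ⟩
  (ℓ + ℓ) * i + (ε + ε)                     ≤⟨ +-monoˡ-≤ (ε + ε) (*-monoʳ-≤-nonNeg i {{nonNegative 0≤i}} 2ℓ≤) ⟩
  (d + (ε + ε + ε)) * i + (ε + ε)           ≡⟨ cong (λ t → t + (ε + ε)) (*-distribʳ-+ i d (ε + ε + ε)) ⟩
  (d * i + (ε + ε + ε) * i) + (ε + ε)       ≡⟨ cong (λ t → (t + (ε + ε + ε) * i) + (ε + ε)) (inv-≢0 0<d) ⟩
  (1ℚ + (ε + ε + ε) * i) + (ε + ε)          ≤⟨ +-monoˡ-≤ (ε + ε) (+-monoʳ-≤ 1ℚ (*-monoˡ-≤-nonNeg (ε + ε + ε)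
                                                 {{nonNegative (0≤+ (0≤+ 0≤ε 0≤ε) 0≤ε)}} (inv-anti 0<1 1≤d))) ⟩
  (1ℚ + (ε + ε + ε) * 1ℚ) + (ε + ε)         ≡⟨ solve 1 (λ δ → let e = con ¼ :* δ in
                                                 (con 1ℚ :+ (e :+ e :+ e) :* con 1ℚ) :+ (e :+ e) := con 1ℚ :+ (con 1ℚ :+ con ¼) :* δ) refl δ ⟩
  1ℚ + (1ℚ + ¼) * δ                         ∎)
  where
  open ≤-Reasoning
  i = inv d
  ε = ¼ * δ
  0<d : 0ℚ < d
  0<d = <-≤-trans 0<1 1≤d
  0≤i : 0ℚ ≤ i
  0≤i = <⇒≤ (inv-pos 0<d)
  0≤ε : 0ℚ ≤ ε
  0≤ε = 0≤* (<⇒≤ (positive⁻¹ ¼)) (<⇒≤ 0<δ)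
  ½+δ≤ : ½ + δ ≤ ℓ * i + ε
  ½+δ≤ = ≤-trans ½+δ≤b (∣p-q∣≤⇒p≤q+ b (ℓ * i) b≈)
  2ℓ≤ : ℓ + ℓ ≤ d + (ε + ε + ε)
  2ℓ≤ = begin
    ℓ + ℓ                   ≤⟨ +-mono-≤ (∣p-q∣≤⇒p≤q+ ℓ y ℓ≈y) (∣p-q∣≤⇒p≤q+ ℓ y ℓ≈y) ⟩
    (y + ε) + (y + ε)       ≡⟨ solve 2 (λ y e → (y :+ e) :+ (y :+ e) := (y :+ y) :+ (e :+ e)) refl y ε ⟩
    (y + y) + (ε + ε)       ≤⟨ +-monoˡ-≤ (ε + ε) 2y≤d ⟩
    (d + ε) + (ε + ε)       ≡⟨ solve 2 (λ d e → (d :+ e) :+ (e :+ e) := d :+ (e :+ e :+ e)) refl d ε ⟩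
    d + (ε + ε + ε)         ∎

-- Closeness within 1 to a number ≥ 2 keeps x ≥ 1, where the Riemann sums are 1-Lipschitz uniformly
-- in n; closeness within ε then gives the estimate.
logSum-near : ∀ {ε} x q n → ∣ x - fromℕ (suc (suc q)) ∣ ≤ 1ℚ → ∣ x - fromℕ (suc (suc q)) ∣ ≤ ε →
  ∣ logSum x (suc n) - L (suc q) n ∣ ≤ ε
logSum-near {ε} x q n near₁ near-ε = subst (λ t → ∣ logSum x (suc n) - t ∣ ≤ ε) (sym (L-def (suc q) n))
  (≤-trans (logSum-lipschitz₁ {x} {Q} n 1≤x (fromℕ-mono {1} {suc (suc q)} (ℕ.s≤s ℕ.z≤n))) near-ε)
  where
  open ≤-Reasoning
  Q = fromℕ (suc (suc q))
  1≤x : 1ℚ ≤ x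
  1≤x = begin
    1ℚ              ≡⟨⟩
    fromℕ 2 - 1ℚ    ≤⟨ +-monoˡ-≤ (- 1ℚ) (fromℕ-mono {2} {suc (suc q)} (ℕ.s≤s (ℕ.s≤s ℕ.z≤n))) ⟩
    Q - 1ℚ          ≤⟨ +-monoˡ-≤ (- 1ℚ) (∣p-q∣≤⇒q≤p+ x Q near₁) ⟩
    (x + 1ℚ) - 1ℚ   ≡⟨ solve 1 (λ x → (x :+ con 1ℚ) :- con 1ℚ := x) refl x ⟩
    x               ∎

∼ι⇒near : ∀ {x} k → x ∼ ι (+ k / 1) → ∀ ε → 0ℚ < ε → ∃[ N ] ∀ n → N ℕ.≤ n → ∣ seq x n - fromℕ k ∣ ≤ ε
∼ι⇒near k x∼k = unwrap x∼k

-- Every estimate involved holds from some index on, so all of them are evaluated at one common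
-- index, where `ratio≤½` refutes them.
β≤½ : ∀ {m b} (let p = suc (suc (suc m))) → P₁ p → p ℕ.* p ℕ.≤ 2 ℕ.^ suc (suc m) → Isβ p b → ¬ (ι ½ <ᵣ b)
β≤½ {m} {b} p∈P₁ p²≤2^ (s , order , λ₁ , λ₁-largest , 0<λ₁ , 0<d , b≈) (δ , 0<δ , N₀ , ½+δ≤b) =
  let N₁ , B = b≈ ε 0<ε
      N₂ , C = ∼ι⇒near (suc (suc (suc m))) λ₁∼p ε 0<ε
      N₃ , D = ∼ι⇒near (suc (suc (suc m))) λ₁∼p 1ℚ 0<1
      N₄ , E = 2L≤qL₁ (suc m) p²≤2^ ε 0<ε
      n = ((N₀ ℕ.⊔ N₁) ℕ.⊔ (N₂ ℕ.⊔ N₃)) ℕ.⊔ N₄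
      n₀₁₂₃ = ⊔⇒ˡ ((N₀ ℕ.⊔ N₁) ℕ.⊔ (N₂ ℕ.⊔ N₃)) N₄ ℕₚ.≤-refl
      n₀₁ = ⊔⇒ˡ (N₀ ℕ.⊔ N₁) (N₂ ℕ.⊔ N₃) n₀₁₂₃
      n₂₃ = ⊔⇒ʳ (N₀ ℕ.⊔ N₁) (N₂ ℕ.⊔ N₃) n₀₁₂₃
  in contradictory n (½+δ≤b n (⊔⇒ˡ N₀ N₁ n₀₁)) (B n (⊔⇒ʳ N₀ N₁ n₀₁))
       (C n (⊔⇒ˡ N₂ N₃ n₂₃)) (D n (⊔⇒ʳ N₂ N₃ n₂₃)) (E n (⊔⇒ʳ ((N₀ ℕ.⊔ N₁) ℕ.⊔ (N₂ ℕ.⊔ N₃)) N₄ ℕₚ.≤-refl))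
  where
  ε = ¼ * δ
  0<ε : 0ℚ < ε
  0<ε = 0<* (positive⁻¹ ¼) 0<δ
  s≡p-1 : s ≡ suc (suc m)
  s≡p-1 = order-unique order (proj₂ p∈P₁)
  λ₁∼p : λ₁ ∼ ι (+ suc (suc (suc m)) / 1)
  λ₁∼p = largest-unique {A = M (suc (suc (suc m))) (suc (suc m))} {λ₁} {ι (+ suc (suc (suc m)) / 1)}
    (subst (λ s → IsLargestEigenvalueModulus (M (suc (suc (suc m))) s) λ₁) s≡p-1 λ₁-largest)
    (largest-eigenvalue-modulus p∈P₁)
  contradictory : ∀ n → ½ + δ ≤ seq b n →
    ∣ seq b n - seq (log λ₁ 0<λ₁ /ᵣ (ι (+ s / 1) *ᵣ log2) [ 0<d ]) n ∣ ≤ ε →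
    ∣ seq λ₁ n - fromℕ (suc (suc (suc m))) ∣ ≤ ε → ∣ seq λ₁ n - fromℕ (suc (suc (suc m))) ∣ ≤ 1ℚ →
    L (suc (suc m)) n + L (suc (suc m)) n ≤ fromℕ (suc (suc m)) * L 1 n + ε → ⊥
  contradictory n ½+δ≤b b≈ λ≈ λ≈₁ 2L≤ =
    ratio≤½ (seq b n) (logSum (seq λ₁ n) (suc n)) (L (suc (suc m)) n) (fromℕ (suc (suc m)) * L 1 n) 0<δ ½+δ≤b
      (subst (λ t → ∣ seq b n - t ∣ ≤ ε)
        (trans (seq-β λ₁ 0<λ₁ s 0<d n) (cong (λ s → logSum (seq λ₁ n) (suc n) * inv (fromℕ s * L 1 n)) s≡p-1)) b≈)
      (logSum-near (seq λ₁ n) (suc m) n λ≈₁ λ≈) 2L≤ (1≤s*log2 (suc (suc m)) n (ℕ.s≤s (ℕ.s≤s ℕ.z≤n)))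

-- Since d = 2kx, the quotient exceeds 1/2 by at least δ/d. The upper bound `B` for d makes this
-- excess independent of the index, as `_<ᵣ_` demands.
ratio>½ : ∀ {δ B} y kx d → 0ℚ < δ → 0ℚ < d → d ≤ B → kx + kx ≡ d → kx + δ ≤ y → ½ + δ * inv B ≤ y * inv d
ratio>½ {δ} {B} y kx d 0<δ 0<d d≤B 2kx≡d kx+δ≤y = begin
  ½ + δ * inv B                   ≤⟨ +-monoʳ-≤ ½ (*-monoˡ-≤-nonNeg δ {{nonNegative (<⇒≤ 0<δ)}} (inv-anti 0<d d≤B)) ⟩
  ½ + δ * inv d                   ≡⟨ cong (λ t → t + δ * inv d) (*-identityʳ ½) ⟨
  ½ * 1ℚ + δ * inv d              ≡⟨ cong (λ t → ½ * t + δ * inv d) (trans (sym (inv-≢0 0<d)) (cong (_* inv d) (sym 2kx≡d))) ⟩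
  ½ * ((kx + kx) * inv d) + δ * inv d ≡⟨ solve 3 (λ k i δ → con ½ :* ((k :+ k) :* i) :+ δ :* i := (k :+ δ) :* i) refl kx (inv d) δ ⟩
  (kx + δ) * inv d                ≤⟨ *-monoʳ-≤-nonNeg (inv d) {{nonNegative (<⇒≤ (inv-pos 0<d))}} kx+δ≤y ⟩
  y * inv d                       ∎
  where open ≤-Reasoning

0<s*log2 : ∀ s → ι 0ℚ <ᵣ ι (+ suc s / 1) *ᵣ log2
0<s*log2 s = ½ , positive⁻¹ ½ , 0 , λ n _ → bound (logSum (fromℕ 2) (suc n)) (≤-trans (log2-lower n) (≤-reflexive (L-def 1 n)))
  where
  bound : ∀ x → ½ ≤ x → 0ℚ + ½ ≤ fromℕ (suc s) * x
  bound x ½≤x = 0≤*-mono-≤ {1ℚ} {fromℕ (suc s)} {½} {x} (<⇒≤ 0<1) (≤-trans (<⇒≤ (positive⁻¹ ½)) ½≤x)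
    (fromℕ-mono {1} {suc s} (ℕ.s≤s ℕ.z≤n)) ½≤x

-- The two equations say 2k = p - 1 = 2^k, which holds for k = 1 and k = 2, that is, for p = 3 and p
-- = 5.
½<β : ∀ {m} k → suc m ≡ k ℕ.+ k → m ≡ mersenne k → P₁ (suc (suc m)) → ∃[ b ] Isβ (suc (suc m)) b × ι ½ <ᵣ b
½<β {m} k s≡2k m≡ p∈P₁ =
  β , (suc m , proj₂ p∈P₁ , λ₁ , largest-eigenvalue-modulus p∈P₁ , 0<λ₁ , 0<s*log2 m , unwrap (∼-refl {β})) , ½<
  where
  λ₁ : ℝ
  λ₁ = ι (+ suc (suc m) / 1)
  0<λ₁ : ι 0ℚ <ᵣ λ₁
  0<λ₁ = 1ℚ , 0<1 , 0 , λ _ _ → fromℕ-mono {1} {suc (suc m)} (ℕ.s≤s ℕ.z≤n)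
  β : ℝ
  β = log λ₁ 0<λ₁ /ᵣ (ι (+ suc m / 1) *ᵣ log2) [ 0<s*log2 m ]
  d : ℕ → ℚ
  d n = fromℕ (suc m) * L 1 n
  0<d : ∀ n → 0ℚ < d n
  0<d n = 0<* (0<fromℕ-suc m) (<-≤-trans (positive⁻¹ ½) (log2-lower n))
  2kL₁≡d : ∀ n → fromℕ k * L 1 n + fromℕ k * L 1 n ≡ d n
  2kL₁≡d n = trans (sym (*-distribʳ-+ (L 1 n) (fromℕ k) (fromℕ k)))
    (cong (_* L 1 n) (trans (sym (fromℕ-+ k k)) (cong fromℕ (sym s≡2k))))
  seq≡ : ∀ n → seq β n ≡ L (suc m) n * inv (d n)
  seq≡ n = trans (seq-β λ₁ 0<λ₁ (suc m) (0<s*log2 m) n) (cong (_* inv (d n)) (sym (L-def (suc m) n)))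
  ½< : ι ½ <ᵣ β
  ½< =
    let δ , 0<δ , N₁ , P = kL₁<L k
        B , 0<B , N₂ , Q = bounded (*-cauchy (λ _ → fromℕ (suc m)) (L 1) (cauchy (ι (fromℕ (suc m)))) (L-cauchy 1))
    in δ * inv B , 0<* 0<δ (inv-pos 0<B) , N₁ ℕ.⊔ N₂ , λ n N≤n →
      ≤-trans (ratio>½ (L (suc m) n) (fromℕ k * L 1 n) (d n) 0<δ (0<d n)
          (≤-trans (≤-reflexive (sym (0≤p⇒∣p∣≡p (<⇒≤ (0<d n))))) (Q n (⊔⇒ʳ N₁ N₂ N≤n)))
          (2kL₁≡d n)
          (subst (λ q → fromℕ k * L 1 n + δ ≤ L (suc q) n) (sym m≡) (P n (⊔⇒ˡ N₁ N₂ N≤n))))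
        (≤-reflexive (sym (seq≡ n)))

-- The primes 3 and 5, and the bound for p ≥ 7

3∈P₁ : P₁ 3
3∈P₁ = (from-yes (prime? 3) , from-no (2 ℕ∣.∣? 3)) , ℕ.z<s , from-yes (3 ℕ∣.∣? 3) , least
  where
  least : ∀ t → 0 ℕ.< t → 3 ℕ∣.∣ 2 ℕ.^ t ℕ.∸ 1 → 2 ℕ.≤ t
  least 1 _ = ⊥-elim ∘ from-no (3 ℕ∣.∣? 1)
  least (suc (suc t)) _ _ = ℕ.s≤s (ℕ.s≤s ℕ.z≤n)

5∈P₁ : P₁ 5
5∈P₁ = (from-yes (prime? 5) , from-no (2 ℕ∣.∣? 5)) , ℕ.z<s , from-yes (5 ℕ∣.∣? 15) , least
  where
  least : ∀ t → 0 ℕ.< t → 5 ℕ∣.∣ 2 ℕ.^ t ℕ.∸ 1 → 4 ℕ.≤ t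
  least 1 _ = ⊥-elim ∘ from-no (5 ℕ∣.∣? 1)
  least 2 _ = ⊥-elim ∘ from-no (5 ℕ∣.∣? 3)
  least 3 _ = ⊥-elim ∘ from-no (5 ℕ∣.∣? 7)
  least (suc (suc (suc (suc t)))) _ _ = ℕ.s≤s (ℕ.s≤s (ℕ.s≤s (ℕ.s≤s ℕ.z≤n)))

p²≤2^[p-1] : ∀ m → (7 ℕ.+ m) ℕ.* (7 ℕ.+ m) ℕ.≤ 2 ℕ.^ (6 ℕ.+ m)
p²≤2^[p-1] zero    = ℕₚ.≤ᵇ⇒≤ 49 64 _
p²≤2^[p-1] (suc m) = begin
  -- The added polynomial is 2(7 + m)² - (8 + m)², whose coefficients are all positive.
  (8 ℕ.+ m) ℕ.* (8 ℕ.+ m)                                           ≤⟨ ℕₚ.m≤m+n _ (34 ℕ.+ 12 ℕ.* m ℕ.+ m ℕ.* m) ⟩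
  (8 ℕ.+ m) ℕ.* (8 ℕ.+ m) ℕ.+ (34 ℕ.+ 12 ℕ.* m ℕ.+ m ℕ.* m)         ≡⟨ expand m ⟩
  2 ℕ.* ((7 ℕ.+ m) ℕ.* (7 ℕ.+ m))                                   ≤⟨ ℕₚ.*-monoʳ-≤ 2 (p²≤2^[p-1] m) ⟩
  2 ℕ.^ (6 ℕ.+ suc m)                                               ∎
  where
  open ℕₚ.≤-Reasoning
  expand : ∀ m → (8 ℕ.+ m) ℕ.* (8 ℕ.+ m) ℕ.+ (34 ℕ.+ 12 ℕ.* m ℕ.+ m ℕ.* m) ≡ 2 ℕ.* ((7 ℕ.+ m) ℕ.* (7 ℕ.+ m))
  expand = ℕSolver.solve 1 (λ m → (k 8 +′ m) *′ (k 8 +′ m) +′ (k 34 +′ k 12 *′ m +′ m *′ m) =′ k 2 *′ ((k 7 +′ m) *′ (k 7 +′ m))) refl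
    where
    open ℕSolver using () renaming (_:+_ to _+′_; _:*_ to _*′_; _:=_ to _=′_; con to k)

proposition5p5 : (p : ℕ) → (P₁ p × (∃[ β ] Isβ p β × ι ½ <ᵣ β)) ⇔ (p ≡ 3 ⊎ p ≡ 5)
proposition5p5 p = mk⇔ (to p) from
  where
  to : ∀ p → P₁ p × (∃[ β ] Isβ p β × ι ½ <ᵣ β) → p ≡ 3 ⊎ p ≡ 5
  to 0 (((p-prime , _) , _) , _) = ⊥-elim (¬prime[0] p-prime)
  to 1 (((p-prime , _) , _) , _) = ⊥-elim (¬prime[1] p-prime)
  to 2 (((_ , 2∤p) , _) , _) = ⊥-elim (2∤p (from-yes (2 ℕ∣.∣? 2)))
  to 3 _ = inj₁ refl
  to 4 (((_ , 2∤p) , _) , _) = ⊥-elim (2∤p (from-yes (2 ℕ∣.∣? 4)))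
  to 5 _ = inj₂ refl
  to 6 (((_ , 2∤p) , _) , _) = ⊥-elim (2∤p (from-yes (2 ℕ∣.∣? 6)))
  to (suc (suc (suc (suc (suc (suc (suc m))))))) (p∈P₁ , b , b-isβ , ½<b) =
    ⊥-elim (β≤½ {suc (suc (suc (suc m)))} {b} p∈P₁ (p²≤2^[p-1] m) b-isβ ½<b)
  from : ∀ {p} → p ≡ 3 ⊎ p ≡ 5 → P₁ p × (∃[ β ] Isβ p β × ι ½ <ᵣ β)
  from (inj₁ refl) = 3∈P₁ , ½<β 1 refl refl 3∈P₁
  from (inj₂ refl) = 5∈P₁ , ½<β 2 refl refl 5∈P₁
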